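{- A matroid is a $3$-connected binary $(2,2)$-uniform matroid if and only if it is a $3$-connected minor of one of $Z_5\backslash t$, $P_{10}$, $AG(4,2)$, or $AG(4,2)^*$.
   Context: A matroid is $(2,2)$-uniform if it has no minor isomorphic to $U_{2,2}\oplus U_{0,2}$. For $r\ge 3$, the rank-$r$ binary spike $Z_r$ is the vector matroid over $GF(2)$ of the $r\times(2r+1)$ matrix $[I_r \mid J_r-I_r \mid \mathbf{1}]$, where $J_r$ is the all-ones $r\times r$ matrix and the last column, the all-ones vector, is the tip $t$; $Z_5\backslash t$ is the deletion of the tip from $Z_5$. $AG(4,2)$ is the rank-$5$ binary affine geometry (the $16$ points of $PG(4,2)$ off a hyperplane). $P_{10}$ is the rank-$5$ binary matroid on $\{1,\dots,10\}$ represented over $GF(2)$ by the matrix with columns $1,\dots,10$ and rows $(1,0,0,0,0,1,0,0,1,1)$, $(0,1,0,0,0,1,1,0,0,1)$, $(0,0,1,0,0,0,1,1,0,1)$, $(0,0,0,1,0,0,0,1,1,0)$, $(0,0,0,0,1,1,1,1,0,0)$. -}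

module Defs where

open import Data.Bool using (Bool; true; false; not; _∧_; _xor_)
import Data.Bool.Properties as Bool
open import Data.Fin using (Fin; zero; _↑ʳ_) renaming (_≟_ to _≟ᶠ_)
open import Data.Fin.Permutation using (Permutation; _⟨$⟩ʳ_)
open import Data.Fin.Subset
open import Data.Fin.Subset.Properties using (anySubset?; _⊆?_)
open import Data.List as List using ()
open import Data.List.Extrema.Nat using (max)
open import Data.Nat using (ℕ; zero; suc; _+_; _^_; _≤_; _<_; _≤?_)
open import Data.Product using (∃; ∃₂; ∃-syntax; _×_; _,_)
open import Data.Vec as Vec using (Vec; []; _∷_; _++_; lookup; tabulate; zipWith; replicate)
open import Data.Vec.Properties using (≡-dec)
open import Function using (_⇔_; _∘_)
open import Level using (0ℓ)
open import Relation.Binary.PropositionalEquality using (_≡_)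
open import Relation.Nullary using (¬_)
open import Relation.Nullary.Decidable
  using (Dec; does; map′; decidable-stable; ¬?; _×-dec_; _→-dec_)
open import Relation.Unary using (Pred; Decidable)

private
  variable
    m n r : ℕ

allSubsets? : {P : Pred (Subset n) 0ℓ} → Decidable P → Dec (∀ X → P X)
allSubsets? P? = map′
  (λ ∄¬P X → decidable-stable (P? X) (λ ¬PX → ∄¬P (X , ¬PX)))
  (λ ∀P (X , ¬PX) → ¬PX (∀P X))
  (¬? (anySubset? (¬? ∘ P?)))

allBoolVecs : ∀ n → Vec (Vec Bool n) (2 ^ n)
allBoolVecs zero    = [] ∷ []
allBoolVecs (suc n) =
  Vec.map (false ∷_) (allBoolVecs n) ++ Vec.map (true ∷_) (allBoolVecs n) ++ []

-- A matroid on the ground set Fin n is given by its independent sets.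
-- As with the library's raw algebraic bundles, operations are defined on raw
-- matroids; the axioms are stated separately in IsMatroid.
record RawMatroid (n : ℕ) : Set₁ where
  field
    Indep  : Pred (Subset n) 0ℓ
    indep? : Decidable Indep

open RawMatroid public

record IsMatroid (M : RawMatroid n) : Set where
  field
    indep-⊥   : Indep M ⊥
    indep-⊆   : ∀ {I J} → I ⊆ J → Indep M J → Indep M I
    indep-aug : ∀ {I J} → Indep M I → Indep M J → ∣ I ∣ < ∣ J ∣ →
                ∃[ e ] e ∈ J × e ∉ I × Indep M (I ∪ ⁅ e ⁆)

record Matroid (n : ℕ) : Set₁ where
  field
    raw       : RawMatroid n
    isMatroid : IsMatroid raw

infix 4 _≅_ _≼_

-- The tabulated vector is the preimage of Y under φ; since φ is a bijection
-- this says that both φ and its inverse preserve independence.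
_≅_ : RawMatroid m → RawMatroid n → Set
_≅_ {m} {n} M N = ∃ λ (φ : Permutation m n) →
  ∀ Y → Indep M (tabulate (λ e → lookup Y (φ ⟨$⟩ʳ e))) ⇔ Indep N Y

IsBasis : RawMatroid n → Pred (Subset n) 0ℓ
IsBasis M B = Indep M B × (∀ X → Indep M X → B ⊆ X → X ⊆ B)

isBasis? : (M : RawMatroid n) → Decidable (IsBasis M)
isBasis? M B =
  indep? M B ×-dec allSubsets? (λ X → indep? M X →-dec (B ⊆? X →-dec X ⊆? B))

infix 25 _*
infixl 20 _／_ _＼_
infixr 15 _⊕_

-- The bases of the dual are the complements of the bases.
_* : RawMatroid n → RawMatroid n
M * = record
  { Indep  = λ X → ∃[ B ] IsBasis M B × X ⊆ ∁ B
  ; indep? = λ X → anySubset? (λ B → isBasis? M B ×-dec X ⊆? ∁ B)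
  }

-- The unique increasing bijection Fin ∣ p ∣ → p, applied to a subset.
expand : (p : Subset n) → Subset ∣ p ∣ → Subset n
expand []            []      = []
expand (outside ∷ p) X       = outside ∷ expand p X
expand (inside  ∷ p) (x ∷ X) = x ∷ expand p X

-- The ground set of M ＼ D is the complement of D, relabelled increasingly as
-- an initial segment of ℕ.
_＼_ : RawMatroid n → (D : Subset n) → RawMatroid ∣ ∁ D ∣
M ＼ D = record
  { Indep  = Indep M ∘ expand (∁ D)
  ; indep? = indep? M ∘ expand (∁ D)
  }

_／_ : RawMatroid n → (C : Subset n) → RawMatroid ∣ ∁ C ∣
M ／ C = (M * ＼ C) *

-- N is isomorphic to a minor of M.  D is a set of elements of M ／ C, so it is
-- automatically disjoint from C.
_≼_ : RawMatroid m → RawMatroid n → Set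
N ≼ M = ∃₂ λ C D → N ≅ M ／ C ＼ D

_⊕_ : RawMatroid m → RawMatroid n → RawMatroid (m + n)
_⊕_ {m} M N = record
  { Indep  = λ X → Indep M (Vec.take m X) × Indep N (Vec.drop m X)
  ; indep? = λ X → indep? M (Vec.take m X) ×-dec indep? N (Vec.drop m X)
  }

-- The uniform matroid of rank r on n elements (for r ≤ n).
U : ∀ r n → RawMatroid n
U r n = record
  { Indep  = λ X → ∣ X ∣ ≤ r
  ; indep? = λ X → ∣ X ∣ ≤? r
  }

IsUniform : ℕ → ℕ → RawMatroid n → Set
IsUniform k l M = ¬ (U k k ⊕ U 0 l ≼ M)

rank : RawMatroid n → Subset n → ℕ
rank {n} M X = max 0 (List.map ∣_∣
  (List.filter (λ I → indep? M I ×-dec I ⊆? X) (Vec.toList (allBoolVecs n))))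

-- (X , ∁ X) is a k-separation: both sides have at least k elements and
-- r(X) + r(E − X) − r(E) < k.
IsSeparation : RawMatroid n → ℕ → Subset n → Set
IsSeparation M k X =
  k ≤ ∣ X ∣ × k ≤ ∣ ∁ X ∣ × rank M X + rank M (∁ X) < rank M ⊤ + k

IsConnected : ℕ → RawMatroid n → Set
IsConnected l M = ∀ k → 1 ≤ k → k < l → ∀ X → ¬ IsSeparation M k X

-- GF(2) is Bool, with _xor_ as addition and _∧_ as multiplication.  A matrix
-- is given by its rows.
Matrix₂ : ℕ → ℕ → Set
Matrix₂ r n = Vec (Vec Bool n) r

infixl 7 _·_

_·_ : Matrix₂ r n → Vec Bool n → Vec Bool r
A · c = Vec.map (λ row → Vec.foldr _ _xor_ false (zipWith _∧_ row c)) A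

-- The columns of A indexed by X are linearly independent.  A vector c of
-- coefficients over GF(2) is at the same time the subset of Fin n on which it
-- is nonzero, so c ⊆ X says that only columns indexed by X are combined.
vectorMatroid : Matrix₂ r n → RawMatroid n
vectorMatroid {r} {n} A = record
  { Indep  = λ X → ∀ c → c ⊆ X → A · c ≡ replicate r false → c ≡ replicate n false
  ; indep? = λ X → allSubsets? (λ c →
      c ⊆? X →-dec (≡-dec Bool._≟_ (A · c) (replicate r false)
             →-dec ≡-dec Bool._≟_ c (replicate n false)))
  }

Binary : RawMatroid n → Set
Binary {n} M = ∃₂ λ r (A : Matrix₂ r n) → M ≅ vectorMatroid A

identity : ∀ r → Matrix₂ r r
identity r = tabulate (λ i → tabulate (λ j → does (i ≟ᶠ j)))

-- [ I | J - I | 1 ]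
spikeMatrix : ∀ r → Matrix₂ r (r + (r + 1))
spikeMatrix r =
  Vec.map (λ row → row ++ Vec.map not row ++ (true ∷ [])) (identity r)

tip : ∀ r → Fin (r + (r + 1))
tip r = r ↑ʳ (r ↑ʳ zero)

Z : ∀ r → RawMatroid (r + (r + 1))
Z r = vectorMatroid (spikeMatrix r)

-- The points of PG(d, 2) are the nonzero vectors of GF(2)^(d+1); those off the
-- hyperplane x₀ = 0 are the vectors with first coordinate 1.
AG[_,2] : ∀ d → RawMatroid (2 ^ d)
AG[ d ,2] = vectorMatroid (Vec.transpose (Vec.map (true ∷_) (allBoolVecs d)))

P₁₀ : RawMatroid 10
P₁₀ = vectorMatroid
  ( (I ∷ O ∷ O ∷ O ∷ O ∷ I ∷ O ∷ O ∷ I ∷ I ∷ [])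
  ∷ (O ∷ I ∷ O ∷ O ∷ O ∷ I ∷ I ∷ O ∷ O ∷ I ∷ [])
  ∷ (O ∷ O ∷ I ∷ O ∷ O ∷ O ∷ I ∷ I ∷ O ∷ I ∷ [])
  ∷ (O ∷ O ∷ O ∷ I ∷ O ∷ O ∷ O ∷ I ∷ I ∷ O ∷ [])
  ∷ (O ∷ O ∷ O ∷ O ∷ I ∷ I ∷ I ∷ I ∷ O ∷ O ∷ [])
  ∷ [])
  where
  I = true
  O = false

{-# OPTIONS --safe #-}

-- A binary matroid is described by the code C of its dependencies; its dual
-- belongs to C ᗮ, deletion shortens C and contraction punctures it.  Then
-- M fails to be (2,2)-uniform exactly when C and C ᗮ contain two-dimensional
-- subcodes with disjoint supports; this condition passes to larger codes and is
-- checked on the four maximal matroids through their rank-3 flats.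
--
-- Conversely let M be 3-connected with standard matrix [ I | A ], A of size
-- r × s.  If r ≤ 4, simplicity puts M inside PG(3,2) = AG(4,2)/0, and dually if
-- s ≤ 4.  A column of A vanishing in three rows forces s ≤ 5: on these rows the
-- other columns are distinct with at most one zero, which leaves four options.
-- If r, s ≥ 6, two columns agree in four of six rows, and a pivot creates such a
-- column.  So, up to duality, r = 5 ≤ s.  If M has a triangle, it becomes a
-- column of weight two after pivoting; s = 5, and the 256 possibilities for A
-- give P₁₀, a coaffine matroid, or a contradiction.  If M has no triangle, then
-- it is affine or has a 5-circuit; the elements off the hyperplane spanned by
-- this circuit form a star in the complement of the folded 5-cube, so M is Z₅\t.

module Submission where

open import Defs
open import Algebra.Bundles using (CommutativeRing)
open import Data.Bool using (Bool; true; false; not; _∧_; _xor_)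
import Data.Bool.Properties as Bool
open import Data.Fin using (Fin; zero; suc)
import Data.Fin as Fin
open import Data.Fin.Permutation as Perm using (Permutation; permutation; _⟨$⟩ʳ_; _⟨$⟩ˡ_)
import Data.Fin.Properties as Fin
open import Data.Fin.Subset
open import Data.Fin.Subset.Properties
open import Data.List as List using (List)
open import Data.List.Extrema.Nat using (max<v⁺; xs≤max)
open import Data.List.Membership.Propositional using () renaming (_∈_ to _∈ˡ_)
import Data.List.Membership.Propositional.Properties as ListMem
import Data.List.Relation.Unary.All as All
open import Data.List.Relation.Unary.Any using (here; there)
open import Data.Nat using (ℕ; zero; suc; _+_; _^_; _≤_; _<_; _≤?_; _<?_; z≤n; s≤s)
import Data.Nat.Properties as ℕ
open import Data.Product using (∃; ∃₂; _×_; _,_; proj₁; proj₂)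
open import Data.Sum using (_⊎_; inj₁; inj₂; [_,_]′)
open import Data.Vec as Vec using (Vec; []; _∷_; here; there; lookup; tabulate; zipWith)
open import Data.Vec.Functional using (updateAt)
open import Data.Vec.Functional.Properties using (updateAt-updates; updateAt-minimal)
open import Data.Vec.Membership.Propositional using () renaming (_∈_ to _∈ᵛ_)
import Data.Vec.Membership.Propositional.Properties as VecMem
open import Data.Vec.Properties
  using (lookup-zipWith; lookup-replicate; lookup-map; lookup∘tabulate; tabulate∘lookup; tabulate-cong
        ; []=⇒lookup; lookup⇒[]=; ≡-dec)
import Data.Vec.Relation.Unary.Any as VecAny
open import Function using (_∘_; _⇔_; mk⇔; Equivalence)
open import Level using (0ℓ)
open import Relation.Binary.PropositionalEquality
open import Relation.Nullary using (¬_; Dec; yes; no; does; contradiction)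
open import Relation.Nullary.Decidable
  using (map′; toWitness; decidable-stable; ¬?; _×-dec_; _⊎-dec_; _→-dec_)
open import Relation.Unary using (Pred; Decidable)

open import Algebra.Properties.Semiring.Sum
  (CommutativeRing.semiring Bool.xor-∧-commutativeRing)
  using (sum; ∑-comm; ∑-distrib-+; sum-cong-≗; *-distribˡ-sum; *-distribʳ-sum)

-- Contraction is defined through two duals, so independent sets are awkward to follow through a
-- minor. For spaces of dependencies, duality is orthogonality and a whole minor is one map with a
-- contracted and a deleted set. The excluded minor is self-dual, so each argument about rank also
-- serves for corank. Three zeros in a column are the right number because a vector of GF(2)³ is
-- orthogonal to at least a plane: the zero column and two columns that are equal on these rows
-- already give the forbidden pair of subcodes. Six rows are needed for a count of zeros: if no
-- column has three zeros there, four columns that pairwise differ in three places would need at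
-- least seven rows. P₁₀ and Z₅ without its tip occur in the list without their duals. They are
-- reached only when the corank is five, so nothing is lost when the case of rank at least six is
-- settled in the dual. With at most three elements, 3-connectivity permits small circuits and
-- cocircuits, as in U₁,₂; these matroids are treated separately.

private
  variable
    k l m n r s : ℕ

-- Vectors over GF(2) and the dot product

infixl 9 _!_
infixl 6 _⊕ᵥ_
infix 7 _∙_

_!_ : {A : Set} → Vec A n → Fin n → A
_!_ = lookup

_⊕ᵥ_ : Vec Bool n → Vec Bool n → Vec Bool n
_⊕ᵥ_ = zipWith _xor_

_∙_ : Vec Bool n → Vec Bool n → Bool
[]      ∙ []      = false
(a ∷ c) ∙ (b ∷ d) = (a ∧ b) xor c ∙ d

_≟ᵥ_ : (c d : Vec Bool n) → Dec (c ≡ d)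
_≟ᵥ_ = ≡-dec Bool._≟_

δ : Fin n → Fin n → Bool
δ i j = does (i Fin.≟ j)

δ-refl : (i : Fin n) → δ i i ≡ true
δ-refl i with i Fin.≟ i
... | yes _  = refl
... | no i≢i = contradiction refl i≢i

δ-≢ : {i j : Fin n} → i ≢ j → δ i j ≡ false
δ-≢ {i = i} {j} i≢j with i Fin.≟ j
... | yes i≡j = contradiction i≡j i≢j
... | no _    = refl

δ-sound : {i j : Fin n} → δ i j ≡ true → i ≡ j
δ-sound {i = i} {j} eq with i Fin.≟ j
... | yes i≡j = i≡j

vec-ext : {A : Set} {c d : Vec A n} → (∀ x → c ! x ≡ d ! x) → c ≡ d
vec-ext {c = c} {d} eq =
  trans (sym (tabulate∘lookup c)) (trans (tabulate-cong eq) (tabulate∘lookup d))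

true≢false : {b : Bool} → b ≡ true → b ≢ false
true≢false refl ()

≢true : ∀ {b} → b ≢ true → b ≡ false
≢true {false} _ = refl
≢true {true}  h = contradiction refl h

xor-≡ : ∀ {a b} → a xor b ≡ false → a ≡ b
xor-≡ {false} {false} _ = refl
xor-≡ {true}  {true}  _ = refl

xor-involˡ : ∀ a b → a xor (a xor b) ≡ b
xor-involˡ false b = refl
xor-involˡ true  b = Bool.not-involutive b

∈⇒! : {x : Fin n} {c : Subset n} → x ∈ c → c ! x ≡ true
∈⇒! = []=⇒lookup

!⇒∈ : {x : Fin n} {c : Subset n} → c ! x ≡ true → x ∈ c
!⇒∈ = lookup⇒[]= _ _

∉⇒! : {x : Fin n} {c : Subset n} → x ∉ c → c ! x ≡ false
∉⇒! x∉c = ≢true (x∉c ∘ !⇒∈)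

!⇒∉ : {x : Fin n} {c : Subset n} → c ! x ≡ false → x ∉ c
!⇒∉ eq x∈c = true≢false (∈⇒! x∈c) eq

⊥! : (x : Fin n) → ⊥ ! x ≡ false
⊥! x = lookup-replicate x false

⊕! : (c d : Vec Bool n) (x : Fin n) → (c ⊕ᵥ d) ! x ≡ c ! x xor d ! x
⊕! c d x = lookup-zipWith _xor_ x c d

⁅⁆! : (x y : Fin n) → ⁅ x ⁆ ! y ≡ δ x y
⁅⁆! x y with x Fin.≟ y
... | yes refl = ∈⇒! (x∈⁅x⁆ x)
... | no x≢y   = ∉⇒! (x≢y ∘ sym ∘ x∈⁅y⁆⇒x≡y x)

≢⊥⇒∃ : {c : Vec Bool n} → c ≢ ⊥ → ∃ λ x → c ! x ≡ true
≢⊥⇒∃ {c = c} c≢⊥ with Fin.any? (λ x → c ! x Bool.≟ true)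
... | yes w = w
... | no ¬w = contradiction (vec-ext λ x → trans (≢true (λ e → ¬w (x , e))) (sym (⊥! x))) c≢⊥

∃⇒≢⊥ : {c : Vec Bool n} (x : Fin n) → c ! x ≡ true → c ≢ ⊥
∃⇒≢⊥ x eq refl = true≢false eq (⊥! x)

⊕-zero : {c d : Vec Bool n} → c ⊕ᵥ d ≡ ⊥ → c ≡ d
⊕-zero {c = c} {d} eq = vec-ext λ x →
  xor-≡ (trans (sym (⊕! c d x)) (trans (cong (_! x) eq) (⊥! x)))

sum-false : {f : Fin n → Bool} → (∀ x → f x ≡ false) → sum f ≡ false
sum-false {zero}  eq = refl
sum-false {suc n} {f} eq rewrite eq zero = sum-false (eq ∘ suc)

sum-single : {f : Fin n → Bool} (x : Fin n) → (∀ y → y ≢ x → f y ≡ false) → sum f ≡ f x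
sum-single {f = f} zero h
  rewrite sum-false {f = f ∘ suc} (λ y → h (suc y) λ ()) = Bool.xor-identityʳ _
sum-single (suc x) h
  rewrite h zero (λ ()) = sum-single x (λ y y≢x → h (suc y) (y≢x ∘ Fin.suc-injective))

sum-δ : (f : Fin n → Bool) (x : Fin n) → sum (λ y → δ y x ∧ f y) ≡ f x
sum-δ f x = trans (sum-single {f = λ y → δ y x ∧ f y} x (λ y y≢x → cong (_∧ f y) (δ-≢ y≢x)))
                  (cong (_∧ f x) (δ-refl x))

∙-sum : (c d : Vec Bool n) → c ∙ d ≡ sum (λ x → c ! x ∧ d ! x)
∙-sum []      []      = refl
∙-sum (a ∷ c) (b ∷ d) = cong ((a ∧ b) xor_) (∙-sum c d)

∙-comm : (c d : Vec Bool n) → c ∙ d ≡ d ∙ c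
∙-comm []      []      = refl
∙-comm (a ∷ c) (b ∷ d) = cong₂ _xor_ (Bool.∧-comm a b) (∙-comm c d)

∙-⊕ˡ : (c c′ d : Vec Bool n) → (c ⊕ᵥ c′) ∙ d ≡ c ∙ d xor c′ ∙ d
∙-⊕ˡ c c′ d = trans (∙-sum (c ⊕ᵥ c′) d) (trans
  (sum-cong-≗ λ x → trans (cong (_∧ d ! x) (⊕! c c′ x)) (Bool.∧-distribʳ-xor (d ! x) (c ! x) (c′ ! x)))
  (trans (∑-distrib-+ (λ x → c ! x ∧ d ! x) (λ x → c′ ! x ∧ d ! x))
         (sym (cong₂ _xor_ (∙-sum c d) (∙-sum c′ d)))))

∙-⊕ʳ : (c d d′ : Vec Bool n) → c ∙ (d ⊕ᵥ d′) ≡ c ∙ d xor c ∙ d′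
∙-⊕ʳ c d d′ = trans (∙-comm c (d ⊕ᵥ d′))
  (trans (∙-⊕ˡ d d′ c) (cong₂ _xor_ (∙-comm d c) (∙-comm d′ c)))

∙-⊥ˡ : (d : Vec Bool n) → ⊥ ∙ d ≡ false
∙-⊥ˡ []      = refl
∙-⊥ˡ (_ ∷ d) = ∙-⊥ˡ d

∙-⊥ʳ : (c : Vec Bool n) → c ∙ ⊥ ≡ false
∙-⊥ʳ c = trans (∙-comm c ⊥) (∙-⊥ˡ c)

∙-single : {c d : Vec Bool n} (x : Fin n) → (∀ y → y ≢ x → c ! y ≡ true → d ! y ≡ false) →
           c ∙ d ≡ c ! x ∧ d ! x
∙-single {c = c} {d} x h = trans (∙-sum c d) (sum-single {f = λ y → c ! y ∧ d ! y} x at)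
  where
  at : ∀ y → y ≢ x → c ! y ∧ d ! y ≡ false
  at y y≢x with c ! y in eq
  ... | false = refl
  ... | true  = h y y≢x eq

∙-⁅⁆ : (x : Fin n) (d : Vec Bool n) → ⁅ x ⁆ ∙ d ≡ d ! x
∙-⁅⁆ x d = trans
  (∙-single {c = ⁅ x ⁆} {d} x λ y y≢x y∈ → contradiction (x∈⁅y⁆⇒x≡y x (!⇒∈ y∈)) y≢x)
  (cong (_∧ d ! x) (∈⇒! (x∈⁅x⁆ x)))

-- Codes over GF(2) and orthogonality

record Code (n : ℕ) : Set₁ where
  field
    Mem   : Pred (Vec Bool n) 0ℓ
    mem?  : Decidable Mem
    mem-⊥ : Mem ⊥
    mem-⊕ : ∀ {c d} → Mem c → Mem d → Mem (c ⊕ᵥ d)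

open Code public

infix 4 _∋_ _≐_
infix 25 _ᗮ

_∋_ : Code n → Vec Bool n → Set
_∋_ = Mem

_≐_ : Code n → Code n → Set
C ≐ D = ∀ {c} → (C ∋ c → D ∋ c) × (D ∋ c → C ∋ c)

_ᗮ : Code n → Code n
C ᗮ = record
  { Mem   = λ d → ∀ c → C ∋ c → c ∙ d ≡ false
  ; mem?  = λ d → allSubsets? (λ c → mem? C c →-dec (c ∙ d Bool.≟ false))
  ; mem-⊥ = λ c _ → ∙-⊥ʳ c
  ; mem-⊕ = λ {d} {d′} p q c Cc → trans (∙-⊕ʳ c d d′) (cong₂ _xor_ (p c Cc) (q c Cc))
  }

shorten₁ : Code (suc n) → Code n
shorten₁ C = record
  { Mem   = λ c → C ∋ (false ∷ c)
  ; mem?  = λ c → mem? C (false ∷ c)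
  ; mem-⊥ = mem-⊥ C
  ; mem-⊕ = mem-⊕ C
  }

⊕-self : (c : Vec Bool n) → c ⊕ᵥ c ≡ ⊥
⊕-self c = vec-ext λ x → trans (⊕! c c x) (trans (Bool.xor-same (c ! x)) (sym (⊥! x)))

⊕-cancel : (c d : Vec Bool n) → c ⊕ᵥ (c ⊕ᵥ d) ≡ d
⊕-cancel c d = vec-ext λ x →
  trans (⊕! c _ x) (trans (cong (c ! x xor_) (⊕! c d x)) (xor-involˡ (c ! x) (d ! x)))

-- Induction on the length. If there is a codeword `true ∷ w`, it clears the first coordinate of
-- other words, and a functional `d` on the shortened code extends by `w ∙ d`, the value that makes
-- it orthogonal to `true ∷ w`. Otherwise the first coordinate vanishes on `C` and can be chosen
-- freely.
separate : (C : Code n) (v : Vec Bool n) → ¬ C ∋ v → ∃ λ d → C ᗮ ∋ d × v ∙ d ≡ true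
separate {zero}  C []       v∉C = contradiction (mem-⊥ C) v∉C
separate {suc n} C (b ∷ v) bv∉C with anySubset? (λ w → mem? C (true ∷ w))
... | yes (w , Cw) = go b bv∉C
  where
  lift : ∀ {d} → shorten₁ C ᗮ ∋ d → C ᗮ ∋ (w ∙ d ∷ d)
  lift {d} d⊥ (false ∷ c) Cc = d⊥ c Cc
  lift {d} d⊥ (true  ∷ c) Cc =
    trans (sym (∙-⊕ˡ w c d)) (d⊥ (w ⊕ᵥ c) (mem-⊕ C Cw Cc))

  go : ∀ b → ¬ C ∋ (b ∷ v) → ∃ λ d → C ᗮ ∋ d × (b ∷ v) ∙ d ≡ true
  go false v∉ with separate (shorten₁ C) v v∉
  ... | d , d⊥ , vd = _ , lift d⊥ , vd
  go true v∉ with separate (shorten₁ C) (w ⊕ᵥ v)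
                    (λ wv∈ → v∉ (subst (C ∋_) (⊕-cancel (true ∷ w) (true ∷ v)) (mem-⊕ C Cw wv∈)))
  ... | d , d⊥ , vd = _ , lift d⊥ , trans (sym (∙-⊕ˡ w v d)) vd
... | no ¬w = go b bv∉C
  where
  go : ∀ b → ¬ C ∋ (b ∷ v) → ∃ λ d → C ᗮ ∋ d × (b ∷ v) ∙ d ≡ true
  go true v∉ = ⁅ zero ⁆ , unit , cong not (∙-⊥ʳ v)
    where
    unit : C ᗮ ∋ ⁅ zero ⁆
    unit (false ∷ c) _  = ∙-⊥ʳ c
    unit (true  ∷ c) Cc = contradiction (c , Cc) ¬w
  go false v∉ with separate (shorten₁ C) v v∉
  ... | d , d⊥ , vd = false ∷ d , lift , vd
    where
    lift : C ᗮ ∋ (false ∷ d)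
    lift (false ∷ c) Cc = d⊥ c Cc
    lift (true  ∷ c) Cc = contradiction (c , Cc) ¬w

ᗮᗮ⁺ : (C : Code n) → ∀ {c} → C ∋ c → C ᗮ ᗮ ∋ c
ᗮᗮ⁺ C {c} Cc d d⊥ = trans (∙-comm d c) (d⊥ c Cc)

ᗮᗮ⁻ : (C : Code n) → ∀ {c} → C ᗮ ᗮ ∋ c → C ∋ c
ᗮᗮ⁻ C {c} c⊥⊥ with mem? C c
... | yes Cc = Cc
... | no ¬Cc with separate C c ¬Cc
... | d , d⊥ , cd = contradiction (trans (∙-comm d c) cd)
                      (λ eq → true≢false eq (c⊥⊥ d d⊥))

-- This is `C` plus the space of all vectors that vanish on `B`; its dual consists of the words of
-- `C ᗮ` supported on `B`.
agreeOn : Code n → Subset n → Code n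
agreeOn C B = record
  { Mem   = λ u → ∃ λ d → C ∋ d × B ∩ d ≡ B ∩ u
  ; mem?  = λ u → anySubset? (λ d → mem? C d ×-dec ((B ∩ d) ≟ᵥ (B ∩ u)))
  ; mem-⊥ = ⊥ , mem-⊥ C , refl
  ; mem-⊕ = λ {u} {u′} (d , Cd , eq) (d′ , Cd′ , eq′) → d ⊕ᵥ d′ , mem-⊕ C Cd Cd′ ,
      trans (distrib d d′) (trans (cong₂ _⊕ᵥ_ eq eq′) (sym (distrib u u′)))
  }
  where
  distrib : ∀ u v → B ∩ (u ⊕ᵥ v) ≡ (B ∩ u) ⊕ᵥ (B ∩ v)
  distrib u v = vec-ext λ x → trans (lookup-zipWith _∧_ x B (u ⊕ᵥ v))
    (trans (cong (B ! x ∧_) (⊕! u v x))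
    (trans (Bool.∧-distribˡ-xor (B ! x) (u ! x) (v ! x))
    (trans (cong₂ _xor_ (sym (lookup-zipWith _∧_ x B u)) (sym (lookup-zipWith _∧_ x B v)))
           (sym (⊕! (B ∩ u) (B ∩ v) x)))))

-- If `u` is outside `agreeOn C B`, a separating functional is the obstruction. It vanishes off `B`
-- because `agreeOn C B` contains the unit vectors there.
extend : (C : Code n) (B u : Vec Bool n) →
         (∃ λ d → C ∋ d × (∀ {x} → x ∈ B → d ! x ≡ u ! x)) ⊎
         (∃ λ f → C ᗮ ∋ f × f ⊆ B × u ∙ f ≡ true)
extend C B u with mem? (agreeOn C B) u
... | yes (d , Cd , eq) = inj₁ (d , Cd , λ {x} x∈B → agree x (∈⇒! x∈B))
  where
  agree : ∀ x → B ! x ≡ true → d ! x ≡ u ! x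
  agree x Bx with cong (_! x) eq
  ... | e rewrite lookup-zipWith _∧_ x B d | lookup-zipWith _∧_ x B u | Bx = e
... | no u∉ with separate (agreeOn C B) u u∉
... | f , f⊥ , uf = inj₂ (f , (λ c Cc → f⊥ c (c , Cc , refl)) , f⊆B , uf)
  where
  f⊆B : f ⊆ B
  f⊆B {x} x∈f with x ∈? B
  ... | yes x∈B = x∈B
  ... | no x∉B  = contradiction (trans (sym (∙-⁅⁆ x f)) (f⊥ ⁅ x ⁆ (⊥ , mem-⊥ C , vec-ext same)))
                                (true≢false (∈⇒! x∈f))
    where
    same : ∀ y → (B ∩ ⊥) ! y ≡ (B ∩ ⁅ x ⁆) ! y
    same y rewrite lookup-zipWith _∧_ y B ⊥ | lookup-zipWith _∧_ y B ⁅ x ⁆ | ⊥! y | ⁅⁆! x y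
      with x Fin.≟ y
    ... | no _     = refl
    ... | yes refl rewrite ∉⇒! x∉B = refl

-- Free sets and bases

Free : Code n → Subset n → Set
Free C X = ∀ c → C ∋ c → c ⊆ X → c ≡ ⊥

free? : (C : Code n) (X : Subset n) → Dec (Free C X)
free? C X = allSubsets? (λ c → mem? C c →-dec (c ⊆? X →-dec c ≟ᵥ ⊥))

notFree : (C : Code n) (X : Subset n) → ¬ Free C X → ∃ λ c → C ∋ c × c ⊆ X × c ≢ ⊥
notFree C X ¬free with anySubset? (λ c → mem? C c ×-dec (c ⊆? X ×-dec ¬? (c ≟ᵥ ⊥)))
... | yes w = w
... | no ¬w = contradiction free ¬free
  where
  free : Free C X
  free c Cc c⊆X = decidable-stable (c ≟ᵥ ⊥) (λ c≢⊥ → ¬w (c , Cc , (λ {_} → c⊆X) , c≢⊥))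

-- An obstruction to extending the unit vector at `b` would be a nonzero codeword inside `B`. When
-- `B` is a basis, the word found is the fundamental cocircuit of `b`.
coordinate : (C : Code n) {B : Subset n} → Free C B → ∀ {b} → b ∈ B →
             ∃ λ d → C ᗮ ∋ d × d ! b ≡ true × (∀ {x} → x ∈ B → x ≢ b → d ! x ≡ false)
coordinate C {B} free {b} b∈B with extend (C ᗮ) B ⁅ b ⁆
... | inj₁ (d , d⊥ , eq) = d , d⊥ , trans (eq b∈B) (∈⇒! (x∈⁅x⁆ b)) ,
        λ x∈B x≢b → trans (eq x∈B) (∉⇒! (x≢b ∘ x∈⁅y⁆⇒x≡y b))
... | inj₂ (f , f⊥⊥ , f⊆B , bf) = contradiction (free f (ᗮᗮ⁻ C f⊥⊥) f⊆B)
        (∃⇒≢⊥ b (trans (sym (∙-⁅⁆ b f)) bf))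

x∉p-x : (x : Fin n) (p : Subset n) → x ∉ p - x
x∉p-x zero    (true  ∷ p) ()
x∉p-x zero    (false ∷ p) ()
x∉p-x (suc x) (_ ∷ p) (there x∈) = x∉p-x x p x∈

-- `I` stays independent and `S` stays spanning: `Free (C ᗮ) (∁ S)` says that no cocircuit avoids
-- `S`. Each listed element of `S` outside `I` either joins `I` or leaves `S`, so the two sets
-- coincide at the end.
greedy : (C : Code n) (xs : List (Fin n)) (I S : Subset n) →
         I ⊆ S → Free C I → Free (C ᗮ) (∁ S) → (∀ {x} → x ∈ S → x ∉ I → x ∈ˡ xs) →
         ∃ λ B → Free C B × Free (C ᗮ) (∁ B) × B ⊆ S
greedy C List.[] I S I⊆S fI fS left = I , fI , (λ d d⊥ d⊆ → fS d d⊥ λ x∈d →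
  x∉p⇒x∈∁p λ x∈S → case x∈S (x∈∁p⇒x∉p (d⊆ x∈d))) , I⊆S
  where
  case : ∀ {x} {A : Set} → x ∈ S → x ∉ I → A
  case x∈S x∉I with left x∈S x∉I
  ... | ()
greedy C (x List.∷ xs) I S I⊆S fI fS left with x ∈? S | x ∈? I
... | no x∉S | _ = greedy C xs I S I⊆S fI fS left′
  where
  left′ : ∀ {y} → y ∈ S → y ∉ I → y ∈ˡ xs
  left′ y∈S y∉I with left y∈S y∉I
  ... | here refl = contradiction y∈S x∉S
  ... | there p   = p
... | yes _ | yes x∈I = greedy C xs I S I⊆S fI fS left′
  where
  left′ : ∀ {y} → y ∈ S → y ∉ I → y ∈ˡ xs
  left′ y∈S y∉I with left y∈S y∉I
  ... | here refl = contradiction x∈I y∉I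
  ... | there p   = p
... | yes x∈S | no x∉I with free? C (I ∪ ⁅ x ⁆)
... | yes fIx = greedy C xs (I ∪ ⁅ x ⁆) S I′⊆S fIx fS left′
  where
  I′⊆S : I ∪ ⁅ x ⁆ ⊆ S
  I′⊆S y∈ with x∈p∪q⁻ I ⁅ x ⁆ y∈
  ... | inj₁ y∈I = I⊆S y∈I
  ... | inj₂ y∈x rewrite x∈⁅y⁆⇒x≡y x y∈x = x∈S
  left′ : ∀ {y} → y ∈ S → y ∉ I ∪ ⁅ x ⁆ → y ∈ˡ xs
  left′ y∈S y∉ with left y∈S (λ y∈I → y∉ (x∈p∪q⁺ (inj₁ y∈I)))
  ... | here refl = contradiction (x∈p∪q⁺ (inj₂ (x∈⁅x⁆ x))) y∉
  ... | there p   = p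
... | no ¬fIx with notFree C (I ∪ ⁅ x ⁆) ¬fIx
-- The codeword `c` passes through `x` and otherwise stays in `I`. A dual word that avoids `S - x`
-- meets `c` at most in `x`, hence not at all, so `S - x` still spans.
... | c , Cc , c⊆ , c≢⊥ with greedy C xs I (S - x) I⊆S′ fI fS′ left′
  where
  x∈c : c ! x ≡ true
  x∈c with c ! x in eq
  ... | true  = refl
  ... | false = contradiction (fI c Cc c⊆I) c≢⊥
    where
    c⊆I : c ⊆ I
    c⊆I y∈c with x∈p∪q⁻ I ⁅ x ⁆ (c⊆ y∈c)
    ... | inj₁ y∈I = y∈I
    ... | inj₂ y∈x rewrite x∈⁅y⁆⇒x≡y x y∈x = contradiction y∈c (!⇒∉ eq)
  I⊆S′ : I ⊆ S - x
  I⊆S′ y∈I = x∈p∧x≢y⇒x∈p-y (I⊆S y∈I) λ { refl → x∉I y∈I }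
  fS′ : Free (C ᗮ) (∁ (S - x))
  fS′ d d⊥ d⊆ = fS d d⊥ d⊆∁S
    where
    only : ∀ y → y ≢ x → c ! y ≡ true → d ! y ≡ false
    only y y≢x cy with x∈p∪q⁻ I ⁅ x ⁆ (c⊆ (!⇒∈ cy))
    ... | inj₂ y∈x = contradiction (x∈⁅y⁆⇒x≡y x y∈x) y≢x
    ... | inj₁ y∈I = ∉⇒! λ y∈d → x∈∁p⇒x∉p (d⊆ y∈d) (I⊆S′ y∈I)
    dx : d ! x ≡ false
    dx = trans (sym (trans (∙-single {c = c} {d} x only) (cong (_∧ d ! x) x∈c))) (d⊥ c Cc)
    d⊆∁S : d ⊆ ∁ S
    d⊆∁S {y} y∈d = x∉p⇒x∈∁p λ y∈S → x∈∁p⇒x∉p (d⊆ y∈d)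
      (x∈p∧x≢y⇒x∈p-y y∈S λ { refl → !⇒∉ dx y∈d })
  left′ : ∀ {y} → y ∈ S - x → y ∉ I → y ∈ˡ xs
  left′ {y} y∈ y∉I with left (p─q⊆p S ⁅ x ⁆ y∈) y∉I
  ... | here refl = contradiction y∈ (x∉p-x x S)
  ... | there p   = p
... | B , fB , fB* , B⊆ = B , fB , fB* , p─q⊆p S ⁅ x ⁆ ∘ B⊆

baseIn : (C : Code n) (S : Subset n) → Free (C ᗮ) (∁ S) →
         ∃ λ B → Free C B × Free (C ᗮ) (∁ B) × B ⊆ S
baseIn C S fS = greedy C (List.allFin _) ⊥ S (λ x∈⊥ → contradiction x∈⊥ ∉⊥)
  (λ c _ c⊆⊥ → ⊆-antisym c⊆⊥ ⊥⊆) fS (λ {x} _ _ → ListMem.∈-allFin x)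

-- Moving vectors along maps of coordinates

pull : (Fin m → Fin n) → Vec Bool n → Vec Bool m
pull ι c = tabulate (λ i → c ! ι i)

pull! : (ι : Fin m → Fin n) (c : Vec Bool n) (i : Fin m) → pull ι c ! i ≡ c ! ι i
pull! ι c = lookup∘tabulate (λ i → c ! ι i)

pull-⊥ : (ι : Fin m → Fin n) → pull ι ⊥ ≡ ⊥
pull-⊥ ι = vec-ext λ i → trans (pull! ι ⊥ i) (trans (⊥! (ι i)) (sym (⊥! i)))

pull-⊕ : (ι : Fin m → Fin n) (c d : Vec Bool n) → pull ι (c ⊕ᵥ d) ≡ pull ι c ⊕ᵥ pull ι d
pull-⊕ ι c d = vec-ext λ i → trans (pull! ι (c ⊕ᵥ d) i) (trans (⊕! c d (ι i))
  (sym (trans (⊕! (pull ι c) (pull ι d) i) (cong₂ _xor_ (pull! ι c i) (pull! ι d i)))))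

-- The transpose of `pull ι`: summing over the fibres makes `push-∙` hold for every map `ι`.
push : (Fin m → Fin n) → Vec Bool m → Vec Bool n
push ι c = tabulate (λ x → sum (λ i → δ (ι i) x ∧ c ! i))

push! : (ι : Fin m → Fin n) (c : Vec Bool m) (x : Fin n) →
        push ι c ! x ≡ sum (λ i → δ (ι i) x ∧ c ! i)
push! ι c = lookup∘tabulate (λ x → sum (λ i → δ (ι i) x ∧ c ! i))

Injective : {A B : Set} → (A → B) → Set
Injective f = ∀ {x y} → f x ≡ f y → x ≡ y

Image : (Fin m → Fin n) → Fin n → Set
Image ι x = ∃ λ i → ι i ≡ x

push-ι : {ι : Fin m → Fin n} → Injective ι → (c : Vec Bool m) (i : Fin m) → push ι c ! ι i ≡ c ! i
push-ι {ι = ι} inj c i = trans (push! ι c (ι i))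
  (trans (sum-single {f = λ j → δ (ι j) (ι i) ∧ c ! j} i
           (λ j j≢i → cong (_∧ c ! j) (δ-≢ (j≢i ∘ inj))))
         (cong (_∧ c ! i) (δ-refl (ι i))))

push-out : (ι : Fin m → Fin n) (c : Vec Bool m) {x : Fin n} → ¬ Image ι x → push ι c ! x ≡ false
push-out ι c {x} x∉ = trans (push! ι c x)
  (sum-false {f = λ i → δ (ι i) x ∧ c ! i} (λ i → cong (_∧ c ! i) (δ-≢ λ eq → x∉ (i , eq))))

push-supp : (ι : Fin m → Fin n) (c : Vec Bool m) {x : Fin n} → push ι c ! x ≡ true → Image ι x
push-supp ι c {x} eq with Fin.any? (λ i → ι i Fin.≟ x)
... | yes w = w
... | no ¬w = contradiction (push-out ι c ¬w) (true≢false eq)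

push-∙ : (ι : Fin m → Fin n) (c : Vec Bool m) (u : Vec Bool n) → push ι c ∙ u ≡ c ∙ pull ι u
push-∙ ι c u = begin
  push ι c ∙ u
    ≡⟨ ∙-sum (push ι c) u ⟩
  sum (λ x → push ι c ! x ∧ u ! x)
    ≡⟨ sum-cong-≗ (λ x → trans (cong (_∧ u ! x) (push! ι c x))
                               (*-distribʳ-sum (u ! x) (λ i → δ (ι i) x ∧ c ! i))) ⟩
  sum (λ x → sum (λ i → (δ (ι i) x ∧ c ! i) ∧ u ! x))
    ≡⟨ ∑-comm (λ x i → (δ (ι i) x ∧ c ! i) ∧ u ! x) ⟩
  sum (λ i → sum (λ x → (δ (ι i) x ∧ c ! i) ∧ u ! x))
    ≡⟨ sum-cong-≗ (λ i → trans (sum-single {f = λ x → (δ (ι i) x ∧ c ! i) ∧ u ! x} (ι i)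
          (λ x x≢ → cong (λ b → (b ∧ c ! i) ∧ u ! x) (δ-≢ (x≢ ∘ sym))))
          (cong₂ _∧_ (cong (_∧ c ! i) (δ-refl (ι i))) (sym (pull! ι u i)))) ⟩
  sum (λ i → c ! i ∧ pull ι u ! i)
    ≡⟨ ∙-sum c (pull ι u) ⟨
  c ∙ pull ι u ∎
  where open ≡-Reasoning

∙-congˡ : {c c′ d : Vec Bool n} → (∀ x → d ! x ≡ true → c ! x ≡ c′ ! x) → c ∙ d ≡ c′ ∙ d
∙-congˡ {c = c} {c′} {d} h = trans (∙-sum c d) (trans (sum-cong-≗ at) (sym (∙-sum c′ d)))
  where
  at : ∀ x → c ! x ∧ d ! x ≡ c′ ! x ∧ d ! x
  at x with d ! x in eq
  ... | true  = cong (_∧ true) (h x eq)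
  ... | false = trans (Bool.∧-zeroʳ _) (sym (Bool.∧-zeroʳ _))

Supported : (Fin m → Fin n) → Subset n → Vec Bool n → Set
Supported ι X c = ∀ {x} → c ! x ≡ true → x ∈ X ⊎ Image ι x

-- Minors of codes

-- C′ is obtained from C by puncturing at X, shortening at all other elements
-- outside the image of ι, and relabelling along ι.
record Minor (C′ : Code m) (C : Code n) (ι : Fin m → Fin n) (X : Subset n) : Set where
  field
    lift : ∀ {c} → C′ ∋ c → ∃ λ c̃ → C ∋ c̃ × pull ι c̃ ≡ c × Supported ι X c̃
    proj : ∀ {c̃} → C ∋ c̃ → Supported ι X c̃ → C′ ∋ pull ι c̃

-- `X` is the contracted set and `Y` the deleted set; passing to the dual exchanges them.
record Split (ι : Fin m → Fin n) (X Y : Subset n) : Set where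
  field
    injective : Injective ι
    cover     : ∀ x → x ∈ X ⊎ x ∈ Y ⊎ Image ι x
    disjoint  : ∀ {x} → x ∈ X → x ∉ Y
    ι∉X       : ∀ i → ι i ∉ X
    ι∉Y       : ∀ i → ι i ∉ Y

flipSplit : {ι : Fin m → Fin n} {X Y : Subset n} → Split ι X Y → Split ι Y X
flipSplit S = record
  { injective = injective
  ; cover     = λ x → [ inj₂ ∘ inj₁ , [ inj₁ , inj₂ ∘ inj₂ ]′ ]′ (cover x)
  ; disjoint  = λ x∈Y x∈X → disjoint x∈X x∈Y
  ; ι∉X       = ι∉Y
  ; ι∉Y       = ι∉X
  }
  where open Split S

∙-minor : {ι : Fin m → Fin n} {X Y : Subset n} → Split ι X Y → ∀ {c d} →
          Supported ι X c → Supported ι Y d → c ∙ d ≡ pull ι c ∙ pull ι d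
∙-minor {ι = ι} S {c} {d} c⊆ d⊆ = trans (∙-congˡ {c = c} {push ι (pull ι c)} {d} at)
                                        (push-∙ ι (pull ι c) d)
  where
  open Split S
  at : ∀ x → d ! x ≡ true → c ! x ≡ push ι (pull ι c) ! x
  at x dx with d⊆ dx
  ... | inj₂ (i , refl) = sym (trans (push-ι injective (pull ι c) i) (pull! ι c i))
  ... | inj₁ x∈Y = trans (≢true cx) (sym (push-out ι (pull ι c) λ { (i , refl) → ι∉Y i x∈Y }))
    where
    cx : c ! x ≢ true
    cx eq with c⊆ eq
    ... | inj₁ x∈X        = disjoint x∈X x∈Y
    ... | inj₂ (i , refl) = ι∉Y i x∈Y

-- Puncturing and shortening are dual. A word `d` of `C′ ᗮ` has to be extended by zero on `X` and
-- arbitrarily on `Y`. An obstruction would be a codeword of `C` supported off `Y`, but its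
-- projection lies in `C′` and is orthogonal to `d`.
dualMinor : {C′ : Code m} {C : Code n} {ι : Fin m → Fin n} {X Y : Subset n} →
            Split ι X Y → Minor C′ C ι X → Minor (C′ ᗮ) (C ᗮ) ι Y
dualMinor {C′ = C′} {C} {ι} {X} {Y} S M = record { lift = lift′ ; proj = proj′ }
  where
  open Split S
  open Minor M

  proj′ : ∀ {d̃} → C ᗮ ∋ d̃ → Supported ι Y d̃ → C′ ᗮ ∋ pull ι d̃
  proj′ {d̃} d̃⊥ d̃⊆ c C′c with lift C′c
  ... | c̃ , Cc̃ , refl , c̃⊆ = trans (sym (∙-minor S {c̃} {d̃} c̃⊆ d̃⊆)) (d̃⊥ c̃ Cc̃)

  lift′ : ∀ {d} → C′ ᗮ ∋ d → ∃ λ d̃ → C ᗮ ∋ d̃ × pull ι d̃ ≡ d × Supported ι Y d̃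
  lift′ {d} d⊥ with extend (C ᗮ) (∁ Y) (push ι d)
  ... | inj₁ (d̃ , d̃⊥ , eq) = d̃ , d̃⊥ , vec-ext at , d̃⊆
    where
    at : ∀ i → pull ι d̃ ! i ≡ d ! i
    at i = trans (pull! ι d̃ i) (trans (eq (x∉p⇒x∈∁p (ι∉Y i))) (push-ι injective d i))
    d̃⊆ : Supported ι Y d̃
    d̃⊆ {x} d̃x with cover x
    ... | inj₂ p   = p
    ... | inj₁ x∈X = contradiction
      (trans (eq (x∉p⇒x∈∁p (disjoint x∈X))) (push-out ι d λ { (i , refl) → ι∉X i x∈X }))
      (true≢false d̃x)
  ... | inj₂ (f , f⊥⊥ , f⊆ , df) = contradiction
      (trans (trans (push-∙ ι d f) (∙-comm d (pull ι f))) (d⊥ _ (proj (ᗮᗮ⁻ C f⊥⊥) f⊆′)))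
      (true≢false df)
    where
    f⊆′ : Supported ι X f
    f⊆′ {x} fx with cover x
    ... | inj₁ x∈X        = inj₁ x∈X
    ... | inj₂ (inj₂ im)  = inj₂ im
    ... | inj₂ (inj₁ x∈Y) = contradiction x∈Y (x∈∁p⇒x∉p (f⊆ (!⇒∈ fx)))

-- The inner step contracts nothing, which fits `_≼_`: it contracts first, then deletes and
-- relabels.
composeMinor : {C₁ : Code k} {C₂ : Code m} {C₃ : Code n} {ι : Fin k → Fin m} {κ : Fin m → Fin n}
               {X Y : Subset n} → Split κ X Y →
               Minor C₁ C₂ ι ⊥ → Minor C₂ C₃ κ X → Minor C₁ C₃ (κ ∘ ι) X
composeMinor {C₁ = C₁} {ι = ι} {κ} {X} S M₁ M₂ = record
  { lift = λ C₁c → let (c′ , C₂c′ , eq , c′⊆) = M₁.lift C₁c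
                       (c̃ , C₃c̃ , eq′ , c̃⊆) = M₂.lift C₂c′
                   in c̃ , C₃c̃ , trans (pull-∘ c̃) (trans (cong (pull ι) eq′) eq) , supp c̃ eq′ c′⊆ c̃⊆
  ; proj = λ {c̃} C₃c̃ c̃⊆ → subst (C₁ ∋_) (sym (pull-∘ c̃)) (M₁.proj (M₂.proj C₃c̃ (weaken {c̃} c̃⊆)) (supp′ c̃ c̃⊆))
  }
  where
  open Split S
  module M₁ = Minor M₁
  module M₂ = Minor M₂
  pull-∘ : ∀ c̃ → pull (κ ∘ ι) c̃ ≡ pull ι (pull κ c̃)
  pull-∘ c̃ = tabulate-cong λ i → sym (pull! κ c̃ (ι i))
  supp : ∀ c̃ {c′} → pull κ c̃ ≡ c′ → Supported ι ⊥ c′ → Supported κ X c̃ → Supported (κ ∘ ι) X c̃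
  supp c̃ refl c′⊆ c̃⊆ cx with c̃⊆ cx
  ... | inj₁ x∈X = inj₁ x∈X
  ... | inj₂ (i , refl) with c′⊆ (trans (pull! κ c̃ i) cx)
  ... | inj₁ i∈⊥        = contradiction i∈⊥ ∉⊥
  ... | inj₂ (j , refl) = inj₂ (j , refl)
  weaken : ∀ {c̃} → Supported (κ ∘ ι) X c̃ → Supported κ X c̃
  weaken c̃⊆ cx with c̃⊆ cx
  ... | inj₁ x∈X      = inj₁ x∈X
  ... | inj₂ (i , eq) = inj₂ (ι i , eq)
  supp′ : ∀ c̃ → Supported (κ ∘ ι) X c̃ → Supported ι ⊥ (pull κ c̃)
  supp′ c̃ c̃⊆ {y} cy with c̃⊆ (trans (sym (pull! κ c̃ y)) cy)
  ... | inj₁ x∈X      = contradiction x∈X (ι∉X y)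
  ... | inj₂ (i , eq) = inj₂ (i , injective eq)

-- Restriction to a subset of the coordinates

embed : (p : Subset n) → Fin ∣ p ∣ → Fin n
embed (true  ∷ p) zero    = zero
embed (true  ∷ p) (suc i) = suc (embed p i)
embed (false ∷ p) i       = suc (embed p i)

embed-∈ : (p : Subset n) (i : Fin ∣ p ∣) → embed p i ∈ p
embed-∈ (true  ∷ p) zero    = here
embed-∈ (true  ∷ p) (suc i) = there (embed-∈ p i)
embed-∈ (false ∷ p) i       = there (embed-∈ p i)

embed-injective : (p : Subset n) → Injective (embed p)
embed-injective (true  ∷ p) {zero}  {zero}  eq = refl
embed-injective (true  ∷ p) {suc i} {suc j} eq =
  cong suc (embed-injective p (Fin.suc-injective eq))
embed-injective (false ∷ p) eq = embed-injective p (Fin.suc-injective eq)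

embed-surjective : (p : Subset n) {x : Fin n} → x ∈ p → Image (embed p) x
embed-surjective (true  ∷ p) here = zero , refl
embed-surjective (true  ∷ p) (there x∈p) with embed-surjective p x∈p
... | i , refl = suc i , refl
embed-surjective (false ∷ p) (there x∈p) with embed-surjective p x∈p
... | i , refl = i , refl

expand-embed : (p : Subset n) (c : Subset ∣ p ∣) (i : Fin ∣ p ∣) → expand p c ! embed p i ≡ c ! i
expand-embed (true  ∷ p) (_ ∷ c) zero    = refl
expand-embed (true  ∷ p) (_ ∷ c) (suc i) = expand-embed p c i
expand-embed (false ∷ p) c       i       = expand-embed p c i

expand-⊆ : (p : Subset n) (c : Subset ∣ p ∣) → expand p c ⊆ p
expand-⊆ (true  ∷ p) (true ∷ c) here       = here
expand-⊆ (true  ∷ p) (_ ∷ c)    (there x∈) = there (expand-⊆ p c x∈)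
expand-⊆ (false ∷ p) c          (there x∈) = there (expand-⊆ p c x∈)

expand-pull : (p : Subset n) {c : Subset n} → c ⊆ p → expand p (pull (embed p) c) ≡ c
expand-pull p {c} c⊆p = vec-ext at
  where
  at : ∀ x → expand p (pull (embed p) c) ! x ≡ c ! x
  at x with x ∈? p
  ... | no x∉p = trans (∉⇒! (x∉p ∘ expand-⊆ p _)) (sym (∉⇒! (x∉p ∘ c⊆p)))
  ... | yes x∈p with embed-surjective p x∈p
  ... | i , refl = trans (expand-embed p _ i) (pull! (embed p) c i)

pull-expand : (p : Subset n) (c : Subset ∣ p ∣) → pull (embed p) (expand p c) ≡ c
pull-expand p c = vec-ext λ i → trans (pull! (embed p) (expand p c) i) (expand-embed p c i)

expand-⊥ : (p : Subset n) → expand p ⊥ ≡ ⊥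
expand-⊥ []          = refl
expand-⊥ (true  ∷ p) = cong (false ∷_) (expand-⊥ p)
expand-⊥ (false ∷ p) = cong (false ∷_) (expand-⊥ p)

expand-⊕ : (p : Subset n) (c d : Subset ∣ p ∣) → expand p (c ⊕ᵥ d) ≡ expand p c ⊕ᵥ expand p d
expand-⊕ []          []      []      = refl
expand-⊕ (true  ∷ p) (_ ∷ c) (_ ∷ d) = cong (_ ∷_) (expand-⊕ p c d)
expand-⊕ (false ∷ p) c       d       = cong (false ∷_) (expand-⊕ p c d)

shorten : (p : Subset n) → Code n → Code ∣ p ∣
shorten p C = record
  { Mem   = λ c → C ∋ expand p c
  ; mem?  = λ c → mem? C (expand p c)
  ; mem-⊥ = subst (C ∋_) (sym (expand-⊥ p)) (mem-⊥ C)
  ; mem-⊕ = λ {c} {d} Cc Cd → subst (C ∋_) (sym (expand-⊕ p c d)) (mem-⊕ C Cc Cd)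
  }

shorten-minor : (p : Subset n) (C : Code n) → Minor (shorten p C) C (embed p) ⊥
shorten-minor p C = record
  { lift = λ {c} Cc → expand p c , Cc , pull-expand p c ,
             λ cx → inj₂ (embed-surjective p (expand-⊆ p c (!⇒∈ cx)))
  ; proj = λ {c̃} Cc̃ c̃⊆ → subst (C ∋_) (sym (expand-pull p (supp c̃⊆))) Cc̃
  }
  where
  supp : ∀ {c̃} → Supported (embed p) ⊥ c̃ → c̃ ⊆ p
  supp c̃⊆ {x} x∈ with c̃⊆ (∈⇒! x∈)
  ... | inj₁ x∈⊥        = contradiction x∈⊥ ∉⊥
  ... | inj₂ (i , refl) = embed-∈ p i

embed-split : (p : Subset n) → Split (embed (∁ p)) ⊥ p
embed-split p = record
  { injective = embed-injective (∁ p)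
  ; cover     = cover′
  ; disjoint  = λ x∈⊥ → contradiction x∈⊥ ∉⊥
  ; ι∉X       = λ _ → ∉⊥
  ; ι∉Y       = λ i → x∈∁p⇒x∉p (embed-∈ (∁ p) i)
  }
  where
  cover′ : ∀ x → x ∈ ⊥ ⊎ x ∈ p ⊎ Image (embed (∁ p)) x
  cover′ x with x ∈? p
  ... | yes x∈p = inj₂ (inj₁ x∈p)
  ... | no x∉p  = inj₂ (inj₂ (embed-surjective (∁ p) (x∉p⇒x∈∁p x∉p)))

-- Matroids represented by codes

-- `C` is the cycle space of `M`.
Rep : RawMatroid n → Code n → Set
Rep M C = ∀ X → Indep M X ⇔ Free C X

Rep-≐ : {M : RawMatroid n} {C D : Code n} → C ≐ D → Rep M C → Rep M D
Rep-≐ C≐D R X = mk⇔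
  (λ indep c Dc → Equivalence.to (R X) indep c (proj₂ C≐D Dc))
  (λ free → Equivalence.from (R X) (λ c Cc → free c (proj₁ C≐D Cc)))

⊆⊥⇒≡⊥ : {c : Subset n} → c ⊆ ⊥ → c ≡ ⊥
⊆⊥⇒≡⊥ c⊆⊥ = ⊆-antisym c⊆⊥ ⊥⊆

-- `coordinate` applied to the dual: the fundamental circuit of `e` is the fundamental cocircuit of
-- `e` for the dual basis `∁ B`.
circuitThrough : (C : Code n) {B : Subset n} → Free (C ᗮ) (∁ B) → ∀ {e} → e ∉ B →
                 ∃ λ c → C ∋ c × c ! e ≡ true × c ⊆ B ∪ ⁅ e ⁆
circuitThrough C {B} free {e} e∉B with coordinate (C ᗮ) free (x∉p⇒x∈∁p e∉B)
... | c , c⊥⊥ , ce , c0 = c , ᗮᗮ⁻ C c⊥⊥ , ce , c⊆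
  where
  c⊆ : c ⊆ B ∪ ⁅ e ⁆
  c⊆ {x} x∈c with x ∈? B | x Fin.≟ e
  ... | yes x∈B | _        = x∈p∪q⁺ (inj₁ x∈B)
  ... | no _    | yes refl = x∈p∪q⁺ (inj₂ (x∈⁅x⁆ x))
  ... | no x∉B  | no x≢e   = contradiction x∈c (!⇒∉ (c0 (x∉p⇒x∈∁p x∉B) x≢e))

rep-* : {M : RawMatroid n} {C : Code n} → Rep M C → Rep (M *) (C ᗮ)
rep-* {M = M} {C} R X = mk⇔ to from
  where
  to : Indep (M *) X → Free (C ᗮ) X
  to (B , (indB , maxB) , X⊆∁B) d d⊥ d⊆X = decidable-stable (d ≟ᵥ ⊥) λ d≢⊥ → at (≢⊥⇒∃ d≢⊥)
    where
    freeB : Free C B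
    freeB = Equivalence.to (R B) indB
    at : ¬ ∃ λ e → d ! e ≡ true
    at (e , de) with free? C (B ∪ ⁅ e ⁆)
    ... | yes free = e∉B (maxB _ (Equivalence.from (R _) free) (p⊆p∪q ⁅ e ⁆) (x∈p∪q⁺ (inj₂ (x∈⁅x⁆ e))))
      where
      e∉B : e ∉ B
      e∉B = x∈∁p⇒x∉p (X⊆∁B (d⊆X (!⇒∈ de)))
    ... | no ¬free with notFree C _ ¬free
    ... | c , Cc , c⊆ , c≢⊥ with c ! e in ce
    ... | false = c≢⊥ (freeB c Cc c⊆B)
      where
      c⊆B : c ⊆ B
      c⊆B x∈c with x∈p∪q⁻ B ⁅ e ⁆ (c⊆ x∈c)
      ... | inj₁ x∈B = x∈B
      ... | inj₂ x∈e rewrite x∈⁅y⁆⇒x≡y e x∈e = contradiction x∈c (!⇒∉ ce)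
    -- `c` lies in `B` together with `e`, and `d` avoids `B`, so they meet in `e` alone, against
    -- orthogonality.
    ... | true = true≢false (trans (∙-single {c = c} {d} e only) (cong₂ _∧_ ce de)) (d⊥ c Cc)
      where
      only : ∀ y → y ≢ e → c ! y ≡ true → d ! y ≡ false
      only y y≢e cy with x∈p∪q⁻ B ⁅ e ⁆ (c⊆ (!⇒∈ cy))
      ... | inj₁ y∈B = ∉⇒! λ y∈d → x∈∁p⇒x∉p (X⊆∁B (d⊆X y∈d)) y∈B
      ... | inj₂ y∈e = contradiction (x∈⁅y⁆⇒x≡y e y∈e) y≢e

  from : Free (C ᗮ) X → Indep (M *) X
  from free with baseIn C (∁ X) (λ d d⊥ d⊆ → free d d⊥ (subst (_ ∈_) (∁-involutive X) ∘ d⊆))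
    where
    ∁-involutive : ∀ {n} (p : Subset n) → ∁ (∁ p) ≡ p
    ∁-involutive p = vec-ext λ x → trans (lookup-map x not (∁ p))
      (trans (cong not (lookup-map x not p)) (Bool.not-involutive _))
  ... | B , fB , fB* , B⊆ = B , (Equivalence.from (R B) fB , max) , X⊆
    where
    X⊆ : X ⊆ ∁ B
    X⊆ x∈X = x∉p⇒x∈∁p λ x∈B → x∈∁p⇒x∉p (B⊆ x∈B) x∈X
    max : ∀ Y → Indep M Y → B ⊆ Y → Y ⊆ B
    max Y indY B⊆Y {e} e∈Y with e ∈? B
    ... | yes e∈B = e∈B
    -- `Y` would contain the fundamental circuit of the new element `e`.
    ... | no e∉B with circuitThrough C fB* e∉B
    ... | c , Cc , ce , c⊆ = contradiction (Equivalence.to (R Y) indY c Cc c⊆Y) (∃⇒≢⊥ e ce)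
      where
      c⊆Y : c ⊆ Y
      c⊆Y x∈c with x∈p∪q⁻ B ⁅ e ⁆ (c⊆ x∈c)
      ... | inj₁ x∈B = B⊆Y x∈B
      ... | inj₂ x∈e rewrite x∈⁅y⁆⇒x≡y e x∈e = e∈Y

-- `A` is used as a parity-check matrix: the code is the null space, since codewords record
-- dependencies among the columns. The row space is its dual.
rows : Vec (Vec Bool n) r → Code n
rows A = record
  { Mem   = λ c → ∀ i → A ! i ∙ c ≡ false
  ; mem?  = λ c → Fin.all? (λ i → A ! i ∙ c Bool.≟ false)
  ; mem-⊥ = λ i → ∙-⊥ʳ (A ! i)
  ; mem-⊕ = λ {c} {d} p q i → trans (∙-⊕ʳ (A ! i) c d) (cong₂ _xor_ (p i) (q i))
  }

·! : (A : Matrix₂ r n) (c : Vec Bool n) (i : Fin r) → (A · c) ! i ≡ A ! i ∙ c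
·! A c i = trans (lookup-map i _ A) (foldr-∙ (A ! i) c)
  where
  foldr-∙ : ∀ {n} (d c : Vec Bool n) → Vec.foldr _ _xor_ false (zipWith _∧_ d c) ≡ d ∙ c
  foldr-∙ []      []      = refl
  foldr-∙ (a ∷ d) (b ∷ c) = cong ((a ∧ b) xor_) (foldr-∙ d c)

rep-vectorMatroid : (A : Matrix₂ r n) → Rep (vectorMatroid A) (rows A)
rep-vectorMatroid A X = mk⇔
  (λ indep c Ac c⊆X → indep c c⊆X
    (vec-ext λ i → trans (·! A c i) (trans (Ac i) (sym (lookup-replicate i false)))))
  (λ free c c⊆X Ac → free c
    (λ i → trans (sym (·! A c i)) (trans (cong (_! i) Ac) (lookup-replicate i false))) c⊆X)

relabel : Permutation m n → Code n → Code m
relabel φ C = record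
  { Mem   = λ c → C ∋ pull (φ ⟨$⟩ˡ_) c
  ; mem?  = λ c → mem? C (pull (φ ⟨$⟩ˡ_) c)
  ; mem-⊥ = subst (C ∋_) (sym (pull-⊥ (φ ⟨$⟩ˡ_))) (mem-⊥ C)
  ; mem-⊕ = λ {c} {d} p q → subst (C ∋_) (sym (pull-⊕ (φ ⟨$⟩ˡ_) c d)) (mem-⊕ C p q)
  }

pull-∘ : (ι : Fin k → Fin m) (κ : Fin m → Fin n) (c : Vec Bool n) → pull ι (pull κ c) ≡ pull (κ ∘ ι) c
pull-∘ ι κ c = tabulate-cong λ i → pull! κ c (ι i)

pull-id : {ι : Fin n → Fin n} → (∀ i → ι i ≡ i) → (c : Vec Bool n) → pull ι c ≡ c
pull-id h c = vec-ext λ i → trans (pull! _ c i) (cong (c !_) (h i))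

pull-⊆ : (ι : Fin m → Fin n) (c d : Vec Bool n) → c ⊆ d → pull ι c ⊆ pull ι d
pull-⊆ ι c d c⊆d {x} x∈ = !⇒∈ (trans (pull! ι d x) (∈⇒! (c⊆d (!⇒∈ (trans (sym (pull! ι c x)) (∈⇒! x∈))))))

module _ (φ : Permutation m n) where

  pullʳˡ : ∀ c → pull (φ ⟨$⟩ʳ_) (pull (φ ⟨$⟩ˡ_) c) ≡ c
  pullʳˡ c = trans (pull-∘ (φ ⟨$⟩ʳ_) (φ ⟨$⟩ˡ_) c) (pull-id (λ _ → Perm.inverseˡ φ) c)

  pullˡʳ : ∀ c → pull (φ ⟨$⟩ˡ_) (pull (φ ⟨$⟩ʳ_) c) ≡ c
  pullˡʳ c = trans (pull-∘ (φ ⟨$⟩ˡ_) (φ ⟨$⟩ʳ_) c) (pull-id (λ _ → Perm.inverseʳ φ) c)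

  free-relabel : {C′ : Code m} {C : Code n} →
                 (∀ {c} → (C′ ∋ pull (φ ⟨$⟩ʳ_) c → C ∋ c) × (C ∋ c → C′ ∋ pull (φ ⟨$⟩ʳ_) c)) →
                 ∀ Y → Free C′ (pull (φ ⟨$⟩ʳ_) Y) ⇔ Free C Y
  free-relabel {C′} {C} h Y = mk⇔ to from
    where
    to : Free C′ (pull (φ ⟨$⟩ʳ_) Y) → Free C Y
    to free c Cc c⊆Y = trans (sym (pullˡʳ c)) (trans
      (cong (pull (φ ⟨$⟩ˡ_)) (free _ (proj₂ h Cc) (pull-⊆ (φ ⟨$⟩ʳ_) c Y c⊆Y))) (pull-⊥ (φ ⟨$⟩ˡ_)))
    from : Free C Y → Free C′ (pull (φ ⟨$⟩ʳ_) Y)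
    from free c C′c c⊆ = trans (sym (pullʳˡ c)) (trans
      (cong (pull (φ ⟨$⟩ʳ_)) (free (pull (φ ⟨$⟩ˡ_) c) (proj₁ h (subst (C′ ∋_) (sym (pullʳˡ c)) C′c)) ⊆Y))
      (pull-⊥ (φ ⟨$⟩ʳ_)))
      where
      ⊆Y : pull (φ ⟨$⟩ˡ_) c ⊆ Y
      ⊆Y {x} x∈ = subst (x ∈_) (pullˡʳ Y) (pull-⊆ (φ ⟨$⟩ˡ_) c (pull (φ ⟨$⟩ʳ_) Y) c⊆ x∈)

  relabel-minor : (C : Code n) → Minor (relabel φ C) C (φ ⟨$⟩ʳ_) ⊥
  relabel-minor C = record
    { lift = λ {c} Cc → _ , Cc , pullʳˡ c , λ {x} _ → inj₂ (φ ⟨$⟩ˡ x , Perm.inverseʳ φ)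
    ; proj = λ {c} Cc _ → subst (C ∋_) (sym (pullˡʳ c)) Cc
    }

  relabel-split : Split (φ ⟨$⟩ʳ_) ⊥ ⊥
  relabel-split = record
    { injective = λ {i} {j} eq → trans (sym (Perm.inverseˡ φ)) (trans (cong (φ ⟨$⟩ˡ_) eq) (Perm.inverseˡ φ))
    ; cover     = λ x → inj₂ (inj₂ (φ ⟨$⟩ˡ x , Perm.inverseʳ φ))
    ; disjoint  = λ x∈⊥ → contradiction x∈⊥ ∉⊥
    ; ι∉X       = λ _ → ∉⊥
    ; ι∉Y       = λ _ → ∉⊥
    }

rep-≅ : {M : RawMatroid m} {N : RawMatroid n} {C : Code n} →
        ((φ , _) : M ≅ N) → Rep N C → Rep M (relabel φ C)
rep-≅ {M = M} {N} {C} (φ , iso) R X = mk⇔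
  (λ indep → subst (Free (relabel φ C)) (pullʳˡ φ X) (Equivalence.from (rel Y)
     (Equivalence.to (R Y) (Equivalence.to (iso Y) (subst (Indep M) (sym (pullʳˡ φ X)) indep)))))
  (λ free → subst (Indep M) (pullʳˡ φ X) (Equivalence.from (iso Y) (Equivalence.from (R Y)
     (Equivalence.to (rel Y) (subst (Free (relabel φ C)) (sym (pullʳˡ φ X)) free)))))
  where
  Y = pull (φ ⟨$⟩ˡ_) X
  rel : ∀ Y → Free (relabel φ C) (pull (φ ⟨$⟩ʳ_) Y) ⇔ Free C Y
  rel = free-relabel φ {relabel φ C} {C} (λ {c} →
    (λ p → subst (C ∋_) (pullˡʳ φ c) p) , (λ p → subst (C ∋_) (sym (pullˡʳ φ c)) p))

rep-＼ : {M : RawMatroid n} {C : Code n} (D : Subset n) → Rep M C → Rep (M ＼ D) (shorten (∁ D) C)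
rep-＼ {M = M} {C} D R X = mk⇔
  (λ indep → to (Equivalence.to (R _) indep))
  (λ free → Equivalence.from (R _) (from free))
  where
  p = ∁ D
  expand-mono : ∀ {c} → c ⊆ X → expand p c ⊆ expand p X
  expand-mono {c} c⊆X {x} x∈ with embed-surjective p (expand-⊆ p c x∈)
  ... | i , refl = !⇒∈ (trans (expand-embed p X i) (∈⇒! (c⊆X (!⇒∈ (trans (sym (expand-embed p c i)) (∈⇒! x∈))))))
  to : Free C (expand p X) → Free (shorten p C) X
  to free c Cc c⊆X = trans (sym (pull-expand p c)) (trans
    (cong (pull (embed p)) (free (expand p c) Cc (expand-mono c⊆X))) (pull-⊥ (embed p)))
  from : Free (shorten p C) X → Free C (expand p X)
  from free c Cc c⊆ = trans (sym eq) (trans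
    (cong (expand p) (free (pull (embed p) c) (subst (C ∋_) (sym eq) Cc) ⊆X)) (expand-⊥ p))
    where
    eq = expand-pull p {c} (λ x∈c → expand-⊆ p X (c⊆ x∈c))
    ⊆X : pull (embed p) c ⊆ X
    ⊆X {x} x∈ = subst (x ∈_) (pull-expand p X) (pull-⊆ (embed p) c (expand p X) c⊆ x∈)

contract : (X : Subset n) → Code n → Code ∣ ∁ X ∣
contract X C = shorten (∁ X) (C ᗮ) ᗮ

rep-／ : {M : RawMatroid n} {C : Code n} (X : Subset n) → Rep M C → Rep (M ／ X) (contract X C)
rep-／ {M = M} {C} X R = rep-* {M = M * ＼ X} {shorten (∁ X) (C ᗮ)} (rep-＼ {M = M *} {C ᗮ} X (rep-* {M = M} {C} R))

Minor-≐ : {C′ : Code m} {C D : Code n} {ι : Fin m → Fin n} {X : Subset n} →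
          C ≐ D → Minor C′ C ι X → Minor C′ D ι X
Minor-≐ C≐D M = record
  { lift = λ C′c → let (c̃ , Cc̃ , p) = Minor.lift M C′c in c̃ , proj₁ C≐D Cc̃ , p
  ; proj = λ Dc̃ → Minor.proj M (proj₂ C≐D Dc̃)
  }

≐-Minor : {C′ D′ : Code m} {C : Code n} {ι : Fin m → Fin n} {X : Subset n} →
          C′ ≐ D′ → Minor C′ C ι X → Minor D′ C ι X
≐-Minor C≐D M = record
  { lift = λ D′c → Minor.lift M (proj₂ C≐D D′c)
  ; proj = λ Cc̃ s → proj₁ C≐D (Minor.proj M Cc̃ s)
  }

ᗮᗮ : (C : Code n) → (C ᗮ ᗮ) ≐ C
ᗮᗮ C = ᗮᗮ⁻ C , ᗮᗮ⁺ C

contract-minor : (X : Subset n) (C : Code n) → Minor (contract X C) C (embed (∁ X)) X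
contract-minor X C = Minor-≐ (ᗮᗮ C) (dualMinor (embed-split X) (shorten-minor (∁ X) (C ᗮ)))

module _ (X : Subset n) (D : Subset ∣ ∁ X ∣) where

  embed₂ : Fin ∣ ∁ D ∣ → Fin n
  embed₂ = embed (∁ X) ∘ embed (∁ D)

  minor₂ : (C : Code n) → Minor (shorten (∁ D) (contract X C)) C embed₂ X
  minor₂ C = composeMinor {C₂ = contract X C} (flipSplit (embed-split X)) (shorten-minor (∁ D) (contract X C)) (contract-minor X C)

  rep₂ : {M : RawMatroid n} {C : Code n} → Rep M C → Rep (M ／ X ＼ D) (shorten (∁ D) (contract X C))
  rep₂ {M} {C} R = rep-＼ {M = M ／ X} {contract X C} D (rep-／ {M = M} {C} X R)

  embed₂-injective : Injective embed₂
  embed₂-injective = embed-injective (∁ D) ∘ embed-injective (∁ X)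

splitOff : {ι : Fin m → Fin n} {X : Subset n} → Injective ι → (∀ i → ι i ∉ X) → ∃ λ Y → Split ι X Y
splitOff {ι = ι} {X} inj ι∉X = Y , record
  { injective = inj
  ; cover     = cover′
  ; disjoint  = λ {x} x∈X x∈Y → proj₁ (Y-sound x∈Y) x∈X
  ; ι∉X       = ι∉X
  ; ι∉Y       = λ i i∈Y → proj₂ (Y-sound i∈Y) (i , refl)
  }
  where
  P? : ∀ x → Dec (x ∉ X × ¬ Image ι x)
  P? x = ¬? (x ∈? X) ×-dec ¬? (Fin.any? λ i → ι i Fin.≟ x)
  Y : Subset _
  Y = tabulate (λ x → does (P? x))
  Y-sound : ∀ {x} → x ∈ Y → x ∉ X × ¬ Image ι x
  Y-sound {x} x∈Y = at (P? x) (trans (sym (lookup∘tabulate (λ x → does (P? x)) x)) (∈⇒! x∈Y))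
    where
    at : (d : Dec (x ∉ X × ¬ Image ι x)) → does d ≡ true → x ∉ X × ¬ Image ι x
    at (yes p) _ = p
  cover′ : ∀ x → x ∈ X ⊎ x ∈ Y ⊎ Image ι x
  cover′ x with x ∈? X | Fin.any? (λ i → ι i Fin.≟ x)
  ... | yes x∈X | _     = inj₁ x∈X
  ... | no _    | yes p = inj₂ (inj₂ p)
  ... | no x∉X  | no ¬p = inj₂ (inj₁ (!⇒∈ (trans (lookup∘tabulate (λ x → does (P? x)) x) (at (P? x)))))
    where
    at : (d : Dec (x ∉ X × ¬ Image ι x)) → does d ≡ true
    at (yes _) = refl
    at (no ¬q) = contradiction (x∉X , ¬p) ¬q

≼⇒Minor : {M : RawMatroid m} {N : RawMatroid n} {C : Code n} → M ≼ N → Rep N C →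
          ∃ λ C′ → Rep M C′ × ∃ λ ι → ∃₂ λ X Y → Split ι X Y × Minor C′ C ι X
≼⇒Minor {M = M} {N} {C} (X , D , φ , iso) R =
  relabel φ C″ , rep-≅ {M = M} {N ／ X ＼ D} {C″} (φ , iso) (rep₂ X D {N} {C} R) , _ , X , proj₁ splitOff′ , proj₂ splitOff′ ,
  composeMinor {C₂ = C″} (proj₂ (splitOff (embed₂-injective X D) ε∉X)) (relabel-minor φ C″) (minor₂ X D C)
  where
  C″ = shorten (∁ D) (contract X C)
  ε∉X : ∀ i → embed₂ X D i ∉ X
  ε∉X i = x∈∁p⇒x∉p (embed-∈ (∁ X) _)
  splitOff′ = splitOff {ι = embed₂ X D ∘ (φ ⟨$⟩ʳ_)} {X}
    (Split.injective (relabel-split φ) ∘ embed₂-injective X D) (λ i → ε∉X _)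

-- `C′` and `shorten (∁ D) (contract X C)` are minors of `C` with the same contracted set and the
-- same surviving elements, so they differ only in the labels. Matching the two embeddings of the
-- survivors gives the isomorphism.
Minor⇒≼ : {M : RawMatroid m} {N : RawMatroid n} {C′ : Code m} {C : Code n}
          {ι : Fin m → Fin n} {X Y : Subset n} →
          Rep M C′ → Rep N C → Split ι X Y → Minor C′ C ι X → M ≼ N
Minor⇒≼ {m = m} {M = M} {N} {C′} {C} {ι} {X} {Y} RM RN S Mi = X , D , φ , λ Z → mk⇔
  (λ indep → Equivalence.from (rep₂ X D {N} {C} RN Z) (Equivalence.to (free Z) (Equivalence.to (RM _) indep)))
  (λ indep → Equivalence.from (RM _) (Equivalence.from (free Z) (Equivalence.to (rep₂ X D {N} {C} RN Z) indep)))
  where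
  open Split S
  ε₁ = embed (∁ X)
  -- `_≼_` expects the deleted set in the labels that remain after the contraction.
  D = pull ε₁ Y
  ε = embed₂ X D

  D! : ∀ j → D ! j ≡ Y ! ε₁ j
  D! = pull! ε₁ Y

  to′ : ∀ i → Image ε (ι i)
  to′ i with embed-surjective (∁ X) (x∉p⇒x∈∁p (ι∉X i))
  ... | j , eq with embed-surjective (∁ D)
                     (x∉p⇒x∈∁p (!⇒∉ (trans (D! j) (trans (cong (Y !_) eq) (∉⇒! (ι∉Y i))))))
  ... | k , refl = k , eq

  from′ : ∀ k → Image ι (ε k)
  from′ k with cover (ε k)
  ... | inj₁ k∈X = contradiction k∈X (x∈∁p⇒x∉p (embed-∈ (∁ X) _))
  ... | inj₂ (inj₁ k∈Y) = contradiction (!⇒∈ (trans (D! _) (∈⇒! k∈Y))) (x∈∁p⇒x∉p (embed-∈ (∁ D) k))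
  ... | inj₂ (inj₂ im)  = im

  φ : Permutation m ∣ ∁ D ∣
  φ = permutation (proj₁ ∘ to′) (proj₁ ∘ from′)
    (λ k → embed₂-injective X D (trans (proj₂ (to′ _)) (proj₂ (from′ k))))
    (λ i → injective (trans (proj₂ (from′ _)) (proj₂ (to′ i))))

  ε∘φ : ∀ i → ε (φ ⟨$⟩ʳ i) ≡ ι i
  ε∘φ i = proj₂ (to′ i)

  C″ : Code ∣ ∁ D ∣
  C″ = shorten (∁ D) (contract X C)

  pull-ι : ∀ c̃ → pull ι c̃ ≡ pull (φ ⟨$⟩ʳ_) (pull ε c̃)
  pull-ι c̃ = sym (trans (pull-∘ (φ ⟨$⟩ʳ_) ε c̃) (tabulate-cong λ i → cong (c̃ !_) (ε∘φ i)))

  same : ∀ {c} → (C′ ∋ pull (φ ⟨$⟩ʳ_) c → C″ ∋ c) × (C″ ∋ c → C′ ∋ pull (φ ⟨$⟩ʳ_) c)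
  same {c} = (λ C′c → go₁ (Minor.lift Mi C′c)) , (λ C″c → go₂ (Minor.lift (minor₂ X D C) C″c))
    where
    go₁ : (∃ λ c̃ → C ∋ c̃ × pull ι c̃ ≡ pull (φ ⟨$⟩ʳ_) c × Supported ι X c̃) → C″ ∋ c
    go₁ (c̃ , Cc̃ , eq , s) = subst (C″ ∋_) eq′ (Minor.proj (minor₂ X D C) Cc̃ s′)
      where
      s′ : Supported ε X c̃
      s′ cx with s cx
      ... | inj₁ x∈X        = inj₁ x∈X
      ... | inj₂ (i , refl) = inj₂ (to′ i)
      eq′ : pull ε c̃ ≡ c
      eq′ = trans (sym (pullˡʳ φ (pull ε c̃))) (trans (cong (pull (φ ⟨$⟩ˡ_)) (trans (sym (pull-ι c̃)) eq)) (pullˡʳ φ c))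
    go₂ : (∃ λ c̃ → C ∋ c̃ × pull ε c̃ ≡ c × Supported ε X c̃) → C′ ∋ pull (φ ⟨$⟩ʳ_) c
    go₂ (c̃ , Cc̃ , refl , s) = subst (C′ ∋_) (pull-ι c̃) (Minor.proj Mi Cc̃ s′)
      where
      s′ : Supported ι X c̃
      s′ cx with s cx
      ... | inj₁ x∈X        = inj₁ x∈X
      ... | inj₂ (k , refl) = inj₂ (from′ k)

  free : ∀ Z → Free C′ (pull (φ ⟨$⟩ʳ_) Z) ⇔ Free C″ Z
  free = free-relabel φ {C′} {C″} same

-- Connectivity and uniformity

∈-allBoolVecs : (c : Vec Bool n) → c ∈ᵛ allBoolVecs n
∈-allBoolVecs []          = VecAny.here refl
∈-allBoolVecs (false ∷ c) = VecMem.∈-++⁺ˡ (VecMem.∈-map⁺ (false ∷_) (∈-allBoolVecs c))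
∈-allBoolVecs (true  ∷ c) = VecMem.∈-++⁺ʳ (Vec.map (false ∷_) (allBoolVecs _))
  (VecMem.∈-++⁺ˡ (VecMem.∈-map⁺ (true ∷_) (∈-allBoolVecs c)))

module _ (M : RawMatroid n) where

  private
    indep⊆? : (X I : Subset n) → Dec (Indep M I × I ⊆ X)
    indep⊆? X I = indep? M I ×-dec I ⊆? X

    candidates = Vec.toList (allBoolVecs n)

  ∣indep∣≤rank : {I X : Subset n} → Indep M I → I ⊆ X → ∣ I ∣ ≤ rank M X
  ∣indep∣≤rank {I} {X} indep I⊆X = All.lookup (xs≤max 0 _) (ListMem.∈-map⁺ ∣_∣
    (ListMem.∈-filter⁺ (indep⊆? X) (VecMem.∈-toList⁺ (∈-allBoolVecs I)) (indep , λ {_} → I⊆X)))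

  rank<⁺ : {X : Subset n} {v : ℕ} → Indep M ⊥ → (∀ I → Indep M I → I ⊆ X → ∣ I ∣ < v) → rank M X < v
  rank<⁺ {X} {v} indep-⊥ h = max<v⁺ (subst (_< v) (∣⊥∣≡0 n) (h ⊥ indep-⊥ ⊥⊆)) (All.tabulate at)
    where
    at : ∀ {k} → k ∈ˡ List.map ∣_∣ (List.filter (indep⊆? X) candidates) → k < v
    at k∈ with ListMem.∈-map⁻ ∣_∣ k∈
    ... | I , I∈ , refl with ListMem.∈-filter⁻ (indep⊆? X) {xs = candidates} I∈
    ... | _ , indep , I⊆X = h I indep I⊆X

module _ {M : RawMatroid n} (isM : IsMatroid M) {C : Code n} (R : Rep M C) where

  open IsMatroid isM

  rank-mono : {X : Subset n} → rank M X ≤ rank M ⊤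
  rank-mono {X} = ℕ.≤-pred (rank<⁺ M indep-⊥ λ I indep _ → s≤s (∣indep∣≤rank M indep ⊆⊤))

  -- A nonzero codeword is a dependent set, so its rank is below its size, while the complement has
  -- at most the rank of `M`.
  codeword-separation : ∀ {c} → C ∋ c → c ≢ ⊥ → ∣ c ∣ ≤ ∣ ∁ c ∣ → IsSeparation M ∣ c ∣ c
  codeword-separation {c} Cc c≢⊥ le = ℕ.≤-refl , le ,
    subst (rank M c + rank M (∁ c) <_) (ℕ.+-comm ∣ c ∣ (rank M ⊤)) (ℕ.+-mono-<-≤ rank-c rank-mono)
    where
    rank-c : rank M c < ∣ c ∣
    rank-c = rank<⁺ M indep-⊥ λ I indep I⊆c → lt indep I⊆c
      where
      lt : ∀ {I} → Indep M I → I ⊆ c → ∣ I ∣ < ∣ c ∣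
      lt {I} indep I⊆c with c ⊆? I
      ... | yes c⊆I = contradiction (Equivalence.to (R I) indep c Cc c⊆I) c≢⊥
      ... | no c⊈I with Fin.any? (λ x → (x ∈? c) ×-dec ¬? (x ∈? I))
      ... | yes w = p⊂q⇒∣p∣<∣q∣ (I⊆c , w)
      ... | no ¬w = contradiction (λ {x} → sub x) c⊈I
        where
        sub : ∀ x → x ∈ c → x ∈ I
        sub x x∈c = decidable-stable (x ∈? I) (λ x∉I → ¬w (x , x∈c , x∉I))

  -- The complement of a nonzero dual word does not span: an independent set that avoids `d` stays
  -- independent when an element of `d` is added, since a codeword through this element would meet
  -- `d` just once.
  cocodeword-separation : ∀ {d} → C ᗮ ∋ d → d ≢ ⊥ → ∣ d ∣ ≤ ∣ ∁ d ∣ → IsSeparation M ∣ d ∣ d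
  cocodeword-separation {d} d⊥ d≢⊥ le = ℕ.≤-refl , le ,
    subst (rank M d + rank M (∁ d) <_) (ℕ.+-comm ∣ d ∣ (rank M ⊤)) (ℕ.+-mono-≤-< rank-d rank-∁d)
    where
    rank-d : rank M d ≤ ∣ d ∣
    rank-d = ℕ.≤-pred (rank<⁺ M indep-⊥ λ I _ I⊆d → s≤s (p⊆q⇒∣p∣≤∣q∣ I⊆d))
    rank-∁d : rank M (∁ d) < rank M ⊤
    rank-∁d with ≢⊥⇒∃ d≢⊥
    ... | e , de = rank<⁺ M indep-⊥ λ I indep I⊆∁d → ℕ.<-≤-trans
          (p⊂q⇒∣p∣<∣q∣ (p⊆p∪q ⁅ e ⁆ , e , x∈p∪q⁺ (inj₂ (x∈⁅x⁆ e)) ,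
             λ e∈I → x∈∁p⇒x∉p (I⊆∁d e∈I) (!⇒∈ de)))
          (∣indep∣≤rank M (Equivalence.from (R (I ∪ ⁅ e ⁆)) (free (Equivalence.to (R I) indep) I⊆∁d)) ⊆⊤)
      where
      free : ∀ {I} → Free C I → I ⊆ ∁ d → Free C (I ∪ ⁅ e ⁆)
      free {I} freeI I⊆∁d c Cc c⊆ = freeI c Cc c⊆I
        where
        only : ∀ y → y ≢ e → c ! y ≡ true → d ! y ≡ false
        only y y≢e cy with x∈p∪q⁻ I ⁅ e ⁆ (c⊆ (!⇒∈ cy))
        ... | inj₁ y∈I = ∉⇒! (x∈∁p⇒x∉p (I⊆∁d y∈I))
        ... | inj₂ y∈e = contradiction (x∈⁅y⁆⇒x≡y e y∈e) y≢e
        ce : c ! e ≡ false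
        ce = trans (sym (trans (cong (c ! e ∧_) de) (Bool.∧-identityʳ _)))
                   (trans (sym (∙-single {c = c} {d} e only)) (d⊥ c Cc))
        c⊆I : c ⊆ I
        c⊆I {y} y∈c with x∈p∪q⁻ I ⁅ e ⁆ (c⊆ y∈c)
        ... | inj₁ y∈I = y∈I
        ... | inj₂ y∈e rewrite x∈⁅y⁆⇒x≡y e y∈e = contradiction y∈c (!⇒∉ ce)

-- This is what the classification takes from 3-connectivity. The comparison with `∣ ∁ c ∣` is the
-- size condition of a separation; it has force only when there are at most three elements.
NoLight : Code n → Set
NoLight C = ∀ {c} → C ∋ c → c ≢ ⊥ → ∣ c ∣ ≤ ∣ ∁ c ∣ → 2 < ∣ c ∣

≢⊥⇒1≤∣∣ : {c : Subset n} → c ≢ ⊥ → 1 ≤ ∣ c ∣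
≢⊥⇒1≤∣∣ {c = c} c≢⊥ with ≢⊥⇒∃ c≢⊥
... | x , cx = subst (_≤ ∣ c ∣) (∣⁅x⁆∣≡1 x) (p⊆q⇒∣p∣≤∣q∣ {q = c} λ y∈ → subst (_∈ c) (sym (x∈⁅y⁆⇒x≡y x y∈)) (!⇒∈ cx))

connected⇒noLight : {M : RawMatroid n} → IsMatroid M → {C : Code n} → Rep M C →
                    IsConnected 3 M → NoLight C × NoLight (C ᗮ)
connected⇒noLight isM {C} R con =
  (λ Cc c≢⊥ le → ℕ.≰⇒> λ lt → con _ (≢⊥⇒1≤∣∣ c≢⊥) (s≤s lt) _
     (codeword-separation isM {C} R Cc c≢⊥ le)) ,
  (λ d⊥ d≢⊥ le → ℕ.≰⇒> λ lt → con _ (≢⊥⇒1≤∣∣ d≢⊥) (s≤s lt) _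
     (cocodeword-separation isM {C} R d⊥ d≢⊥ le))

-- On `p` and `q` the two words form an identity matrix. This certifies that they are independent,
-- and `p` and `q` later serve as elements of the excluded minor.
record Plane (C : Code n) : Set where
  field
    {a b} : Vec Bool n
    a∈    : C ∋ a
    b∈    : C ∋ b
    {p q} : Fin n
    a!p   : a ! p ≡ true
    a!q   : a ! q ≡ false
    b!p   : b ! p ≡ false
    b!q   : b ! q ≡ true

  Off : Fin n → Set
  Off x = a ! x ≡ false × b ! x ≡ false

open Plane using (Off)

-- A matroid represented by C has a minor U₂,₂ ⊕ U₀,₂ exactly when C and its
-- dual contain two-dimensional subcodes with disjoint supports.
Bad : Code n → Set
Bad C = ∃₂ λ (P : Plane C) (Q : Plane (C ᗮ)) → ∀ x → Off P x ⊎ Off Q x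

plane-mono : {C D : Code n} → (∀ {c} → C ∋ c → D ∋ c) → Plane C → Plane D
plane-mono C⊆D P = record { Plane P hiding (a∈; b∈) ; a∈ = C⊆D (Plane.a∈ P) ; b∈ = C⊆D (Plane.b∈ P) }

bad-ᗮ : {C : Code n} → Bad (C ᗮ) → Bad C
bad-ᗮ {C = C} (P , Q , off) = plane-mono (ᗮᗮ⁻ C) Q , P , λ x → [ inj₂ , inj₁ ]′ (off x)

plane-lift : {C′ : Code m} {C : Code n} {ι : Fin m → Fin n} {X : Subset n} →
             Minor C′ C ι X → (P′ : Plane C′) →
             ∃ λ (P : Plane C) → (∀ i → Off P′ i → Off P (ι i)) × (∀ {x} → x ∉ X → ¬ Image ι x → Off P x)
plane-lift {ι = ι} {X} Mi P′ with Minor.lift Mi (Plane.a∈ P′) | Minor.lift Mi (Plane.b∈ P′)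
... | a , a∈ , refl , a⊆ | b , b∈ , refl , b⊆ = record
  { a∈ = a∈ ; b∈ = b∈
  ; a!p = trans (sym (pull! ι a _)) P′.a!p
  ; a!q = trans (sym (pull! ι a _)) P′.a!q
  ; b!p = trans (sym (pull! ι b _)) P′.b!p
  ; b!q = trans (sym (pull! ι b _)) P′.b!q
  } , (λ i (ai , bi) → trans (sym (pull! ι a i)) ai , trans (sym (pull! ι b i)) bi) ,
      λ x∉X x∉ι → off {a} a⊆ x∉X x∉ι , off {b} b⊆ x∉X x∉ι
  where
  module P′ = Plane P′
  off : ∀ {c} → Supported ι X c → ∀ {x} → x ∉ X → ¬ Image ι x → c ! x ≡ false
  off s x∉X x∉ι = ≢true λ cx → [ x∉X , x∉ι ]′ (s cx)

-- The first plane lifts to words that vanish on the deleted elements and the second to dual words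
-- that vanish on the contracted ones, so the supports stay disjoint.
bad-lift : {C′ : Code m} {C : Code n} {ι : Fin m → Fin n} {X Y : Subset n} →
           Split ι X Y → Minor C′ C ι X → Bad C′ → Bad C
bad-lift {ι = ι} {X} {Y} S Mi (P′ , Q′ , off)
  with plane-lift Mi P′ | plane-lift (dualMinor S Mi) Q′
... | P , P-ι , P-out | Q , Q-ι , Q-out = P , Q , at
  where
  open Split S
  at : ∀ x → Off P x ⊎ Off Q x
  at x with cover x
  ... | inj₁ x∈X = inj₂ (Q-out (disjoint x∈X) λ { (i , refl) → ι∉X i x∈X })
  ... | inj₂ (inj₁ x∈Y) = inj₁ (P-out (λ x∈X → disjoint x∈X x∈Y) λ { (i , refl) → ι∉Y i x∈Y })
  ... | inj₂ (inj₂ (i , refl)) with off i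
  ... | inj₁ o = inj₁ (P-ι i o)
  ... | inj₂ o = inj₂ (Q-ι i o)

pattern 0F = zero
pattern 1F = suc zero
pattern 2F = suc (suc zero)
pattern 3F = suc (suc (suc zero))
pattern 4F = suc (suc (suc (suc zero)))

singleton∈ : (C : Code n) (x : Fin n) → ¬ Free C ⁅ x ⁆ → C ∋ ⁅ x ⁆
singleton∈ C x ¬free with notFree C ⁅ x ⁆ ¬free
... | c , Cc , c⊆ , c≢⊥ with ≢⊥⇒∃ c≢⊥
... | y , cy with x∈⁅y⁆⇒x≡y x (c⊆ (!⇒∈ cy))
... | refl = subst (C ∋_) (⊆-antisym c⊆ λ z∈ → subst (_∈ c) (sym (x∈⁅y⁆⇒x≡y x z∈)) (!⇒∈ cy)) Cc

U₂₂⊕U₀₂ : RawMatroid 4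
U₂₂⊕U₀₂ = U 2 2 ⊕ U 0 2

-- The two loops are codewords and span the first plane; the two coloops span the second.
U⇒bad : {C : Code 4} → Rep U₂₂⊕U₀₂ C → Bad C
U⇒bad {C} R with coordinate C free₀₁ {0F} here | coordinate C free₀₁ {1F} (there here)
  where
  free₀₁ : Free C (true ∷ true ∷ false ∷ false ∷ [])
  free₀₁ = Equivalence.to (R _) (s≤s (s≤s z≤n) , z≤n)
... | d , d⊥ , d0 , dx | d′ , d′⊥ , d′1 , d′x =
  record { a∈ = e₂ ; b∈ = e₃ ; p = 2F ; q = 3F ; a!p = refl ; a!q = refl ; b!p = refl ; b!q = refl } ,
  record { a∈ = d⊥ ; b∈ = d′⊥ ; p = 0F ; q = 1F ; a!p = d0 ; a!q = dx (there here) (λ ())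
         ; b!p = d′x here (λ ()) ; b!q = d′1 } ,
  λ { 0F → inj₁ (refl , refl) ; 1F → inj₁ (refl , refl)
    ; 2F → inj₂ (zeroAt d d⊥ 2F e₂ , zeroAt d′ d′⊥ 2F e₂)
    ; 3F → inj₂ (zeroAt d d⊥ 3F e₃ , zeroAt d′ d′⊥ 3F e₃) }
  where
  e₂ : C ∋ ⁅ 2F ⁆
  e₂ = singleton∈ C 2F λ free → λ₀ (proj₂ (Equivalence.from (R ⁅ 2F ⁆) free))
    where
    λ₀ : ¬ 1 ≤ 0
    λ₀ ()
  e₃ : C ∋ ⁅ 3F ⁆
  e₃ = singleton∈ C 3F λ free → λ₀ (proj₂ (Equivalence.from (R ⁅ 3F ⁆) free))
    where
    λ₀ : ¬ 1 ≤ 0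
    λ₀ ()
  zeroAt : ∀ d → C ᗮ ∋ d → ∀ x → C ∋ ⁅ x ⁆ → d ! x ≡ false
  zeroAt d d⊥ x x∈ = trans (sym (∙-⁅⁆ x d)) (d⊥ ⁅ x ⁆ x∈)

U-code : Code 4
U-code = rows (⁅ 0F ⁆ ∷ ⁅ 1F ⁆ ∷ [])

rep-U : Rep U₂₂⊕U₀₂ U-code
rep-U X@(x₀ ∷ x₁ ∷ x₂ ∷ x₃ ∷ []) = mk⇔ to from
  where
  to : Indep U₂₂⊕U₀₂ X → Free U-code X
  to (_ , le) c@(c₀ ∷ c₁ ∷ c₂ ∷ c₃ ∷ []) c∈ c⊆X = vec-ext
    λ { 0F → trans (sym (∙-⁅⁆ 0F c)) (c∈ 0F) ; 1F → trans (sym (∙-⁅⁆ 1F c)) (c∈ 1F)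
      ; 2F → ≢true λ e → out₂ le (∈⇒! (c⊆X {2F} (!⇒∈ e)))
      ; 3F → ≢true λ e → out₃ x₂ le (∈⇒! (c⊆X {3F} (!⇒∈ e))) }
    where
    out₂ : ∣ x₂ ∷ x₃ ∷ [] ∣ ≤ 0 → x₂ ≢ true
    out₂ () refl
    out₃ : ∀ x₂ → ∣ x₂ ∷ x₃ ∷ [] ∣ ≤ 0 → x₃ ≢ true
    out₃ true  () refl
    out₃ false () refl
  from : Free U-code X → Indep U₂₂⊕U₀₂ X
  from free = ∣p∣≤n (x₀ ∷ x₁ ∷ []) ,
    subst₂ (λ a b → ∣ a ∷ b ∷ [] ∣ ≤ 0) (sym (zeroAt 2F (λ { 0F → refl ; 1F → refl })))
      (sym (zeroAt 3F (λ { 0F → refl ; 1F → refl }))) z≤n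
    where
    zeroAt : ∀ x → U-code ∋ ⁅ x ⁆ → X ! x ≡ false
    zeroAt x x∈ = ≢true λ Xx → ∃⇒≢⊥ x (∈⇒! (x∈⁅x⁆ x)) (free ⁅ x ⁆ x∈
      λ y∈ → subst (_∈ X) (sym (x∈⁅y⁆⇒x≡y x y∈)) (!⇒∈ Xx))

-- Contract the support of `P` except `P.p` and `P.q`, which become loops; keep `Q.p` and `Q.q`, and
-- delete the rest. A codeword on the elements not deleted meets `Q.a` at most in `Q.p` and `Q.b` at
-- most in `Q.q`, so it avoids both, and these two become coloops.
bad⇒U : {M : RawMatroid n} {C : Code n} → Rep M C → Bad C → U₂₂⊕U₀₂ ≼ M
bad⇒U {n} {M = M} {C} R (P , Q , off) = Minor⇒≼ {M = U₂₂⊕U₀₂} {M} {U-code} {C} rep-U R (proj₂ (splitOff ι-injective ι∉X)) minor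
  where
  module P = Plane P
  module Q = Plane Q
  onP : ∀ {x} → P.a ! x ≡ true ⊎ P.b ! x ≡ true → Off Q x
  onP {x} h with off x
  ... | inj₂ o = o
  ... | inj₁ (ax , bx) = [ (λ e → contradiction ax (true≢false e)) , (λ e → contradiction bx (true≢false e)) ]′ h
  onQ : ∀ {x} → Q.a ! x ≡ true ⊎ Q.b ! x ≡ true → Off P x
  onQ {x} h with off x
  ... | inj₁ o = o
  ... | inj₂ (ax , bx) = [ (λ e → contradiction ax (true≢false e)) , (λ e → contradiction bx (true≢false e)) ]′ h
  offPp = onQ (inj₁ Q.a!p)
  offPq = onQ (inj₂ Q.b!q)
  offQp = onP (inj₁ P.a!p)
  offQq = onP (inj₂ P.b!q)
  ι : Fin 4 → Fin n
  ι 0F = Q.p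
  ι 1F = Q.q
  ι 2F = P.p
  ι 3F = P.q
  -- The values of the four words tell the four chosen elements apart.
  code : Fin n → Vec Bool 4
  code x = Q.a ! x ∷ Q.b ! x ∷ P.a ! x ∷ P.b ! x ∷ []
  code-ι : ∀ i → code (ι i) ≡ ⁅ i ⁆
  code-ι 0F rewrite Q.a!p | Q.b!p | proj₁ offPp | proj₂ offPp = refl
  code-ι 1F rewrite Q.a!q | Q.b!q | proj₁ offPq | proj₂ offPq = refl
  code-ι 2F rewrite P.a!p | P.b!p | proj₁ offQp | proj₂ offQp = refl
  code-ι 3F rewrite P.a!q | P.b!q | proj₁ offQq | proj₂ offQq = refl
  ι-injective : Injective ι
  ι-injective {i} {j} eq = sym (x∈⁅y⁆⇒x≡y i (subst (j ∈_) (trans (sym (code-ι j)) (trans (cong code (sym eq)) (code-ι i))) (x∈⁅x⁆ j)))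
  X = (P.a ∪ P.b) ─ (⁅ P.p ⁆ ∪ ⁅ P.q ⁆)
  ∈X⇒P : ∀ {x} → x ∈ X → P.a ! x ≡ true ⊎ P.b ! x ≡ true
  ∈X⇒P x∈X with x∈p∪q⁻ P.a P.b (p─q⊆p _ _ x∈X)
  ... | inj₁ x∈ = inj₁ (∈⇒! x∈)
  ... | inj₂ x∈ = inj₂ (∈⇒! x∈)
  ∉─ : ∀ {n} (p q : Subset n) {x} → x ∈ q → x ∉ p ─ q
  ∉─ (_ ∷ p) (true ∷ q) here ()
  ∉─ (_ ∷ p) (_ ∷ q) (there x∈q) (there x∈) = ∉─ p q x∈q x∈
  ι∉X : ∀ i → ι i ∉ X
  ι∉X 0F p∈X = true≢false Q.a!p (proj₁ (onP (∈X⇒P p∈X)))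
  ι∉X 1F q∈X = true≢false Q.b!q (proj₂ (onP (∈X⇒P q∈X)))
  ι∉X 2F = ∉─ (P.a ∪ P.b) _ (x∈p∪q⁺ (inj₁ (x∈⁅x⁆ _)))
  ι∉X 3F = ∉─ (P.a ∪ P.b) _ (x∈p∪q⁺ (inj₂ (x∈⁅x⁆ _)))
  supp : ∀ {x} → P.a ! x ≡ true ⊎ P.b ! x ≡ true → x ∈ X ⊎ Image ι x
  supp {x} h with x Fin.≟ P.p | x Fin.≟ P.q
  ... | yes refl | _ = inj₂ (2F , refl)
  ... | _ | yes refl = inj₂ (3F , refl)
  ... | no x≢p | no x≢q = inj₁ (x∈p∧x∉q⇒x∈p─q
        (x∈p∪q⁺ ([ inj₁ ∘ !⇒∈ , inj₂ ∘ !⇒∈ ]′ h))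
        λ x∈ → [ (λ x∈p → x≢p (x∈⁅y⁆⇒x≡y P.p x∈p)) , (λ x∈q → x≢q (x∈⁅y⁆⇒x≡y P.q x∈q)) ]′ (x∈p∪q⁻ ⁅ P.p ⁆ ⁅ P.q ⁆ x∈))
  pull-a : pull ι P.a ≡ ⁅ 2F ⁆
  pull-a = vec-ext λ { 0F → proj₁ offPp ; 1F → proj₁ offPq ; 2F → P.a!p ; 3F → P.a!q }
  pull-b : pull ι P.b ≡ ⁅ 3F ⁆
  pull-b = vec-ext λ { 0F → proj₂ offPp ; 1F → proj₂ offPq ; 2F → P.b!p ; 3F → P.b!q }
  Lifted : Vec Bool 4 → Set
  Lifted c = ∃ λ c̃ → C ∋ c̃ × pull ι c̃ ≡ c × Supported ι X c̃
  lift-⊥ : Lifted ⊥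
  lift-⊥ = ⊥ , mem-⊥ C , pull-⊥ ι , λ {x} e → contradiction (⊥! x) (true≢false e)
  lift-a : Lifted ⁅ 2F ⁆
  lift-a = P.a , P.a∈ , pull-a , supp ∘ inj₁
  lift-b : Lifted ⁅ 3F ⁆
  lift-b = P.b , P.b∈ , pull-b , supp ∘ inj₂
  lift-⊕ : ∀ {c d} → Lifted c → Lifted d → Lifted (c ⊕ᵥ d)
  lift-⊕ (c̃ , Cc , refl , cs) (d̃ , Cd , refl , ds) = c̃ ⊕ᵥ d̃ , mem-⊕ C Cc Cd , pull-⊕ ι c̃ d̃ , supp⊕
    where
    supp⊕ : Supported ι X (c̃ ⊕ᵥ d̃)
    supp⊕ {x} e with c̃ ! x in cx | d̃ ! x in dx
    ... | true  | _     = cs cx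
    ... | false | true  = ds dx
    ... | false | false = contradiction (trans (⊕! c̃ d̃ x) (cong₂ _xor_ cx dx)) (true≢false e)
  lift′ : ∀ c → U-code ∋ c → Lifted c
  lift′ (c₀ ∷ c₁ ∷ c₂ ∷ c₃ ∷ []) c∈ with c₀ | c₁ | ∙-⁅⁆ 0F (c₀ ∷ c₁ ∷ c₂ ∷ c₃ ∷ []) | ∙-⁅⁆ 1F (c₀ ∷ c₁ ∷ c₂ ∷ c₃ ∷ []) | c∈ 0F | c∈ 1F
  lift′ (_ ∷ _ ∷ false ∷ false ∷ []) _ | false | false | _ | _ | _ | _ = lift-⊥
  lift′ (_ ∷ _ ∷ true  ∷ false ∷ []) _ | false | false | _ | _ | _ | _ = lift-a
  lift′ (_ ∷ _ ∷ false ∷ true  ∷ []) _ | false | false | _ | _ | _ | _ = lift-b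
  lift′ (_ ∷ _ ∷ true  ∷ true  ∷ []) _ | false | false | _ | _ | _ | _ = lift-⊕ lift-a lift-b
  at : ∀ {c̃} → Supported ι X c̃ → ∀ {d x} → (∀ {y} → Off Q y → d ! y ≡ false) → d ! x ≡ true →
       (d ! Q.p ≡ true → Q.p ≡ x) → (d ! Q.q ≡ true → Q.q ≡ x) →
       c̃ ∙ d ≡ c̃ ! x
  at {c̃} s {d} {x} offd dx hp hq = trans (∙-single {c = c̃} {d} x only) (trans (cong (c̃ ! x ∧_) dx) (Bool.∧-identityʳ _))
    where
    only : ∀ y → y ≢ x → c̃ ! y ≡ true → d ! y ≡ false
    only y y≢x cy with s cy
    ... | inj₁ y∈X = offd (onP (∈X⇒P y∈X))
    ... | inj₂ (0F , refl) = ≢true (y≢x ∘ hp)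
    ... | inj₂ (1F , refl) = ≢true (y≢x ∘ hq)
    ... | inj₂ (2F , refl) = offd offQp
    ... | inj₂ (3F , refl) = offd offQq
  minor : Minor U-code C ι X
  minor = record
    { lift = λ {c} → lift′ c
    ; proj = λ {c̃} Cc̃ s → λ
      { 0F → trans (∙-⁅⁆ 0F (pull ι c̃)) (trans (sym (at {c̃} s {Q.a} {Q.p} proj₁ Q.a!p (λ _ → refl)
                (λ e → contradiction Q.a!q (true≢false e)))) (Q.a∈ c̃ Cc̃))
      ; 1F → trans (∙-⁅⁆ 1F (pull ι c̃)) (trans (sym (at {c̃} s {Q.b} {Q.q} proj₂ Q.b!q
                (λ e → contradiction Q.b!p (true≢false e)) (λ _ → refl))) (Q.b∈ c̃ Cc̃)) }
    }

-- Linear combinations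

comb : Vec Bool r → (Fin r → Vec Bool n) → Vec Bool n
comb x d = tabulate (λ z → x ∙ tabulate (λ i → d i ! z))

comb! : (x : Vec Bool r) (d : Fin r → Vec Bool n) (z : Fin n) → comb x d ! z ≡ x ∙ tabulate (λ i → d i ! z)
comb! x d = lookup∘tabulate (λ z → x ∙ tabulate (λ i → d i ! z))

∙-tabulate : (x : Vec Bool r) (f : Fin r → Bool) → x ∙ tabulate f ≡ sum (λ i → x ! i ∧ f i)
∙-tabulate x f = trans (∙-sum x (tabulate f)) (sum-cong-≗ λ i → cong (x ! i ∧_) (lookup∘tabulate f i))

comb-∙ : (x : Vec Bool r) (d : Fin r → Vec Bool n) (c : Vec Bool n) →
         comb x d ∙ c ≡ x ∙ tabulate (λ i → d i ∙ c)
comb-∙ x d c = begin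
  comb x d ∙ c
    ≡⟨ ∙-sum (comb x d) c ⟩
  sum (λ z → comb x d ! z ∧ c ! z)
    ≡⟨ sum-cong-≗ (λ z → trans (cong (_∧ c ! z) (trans (comb! x d z) (∙-tabulate x (λ i → d i ! z))))
                               (*-distribʳ-sum (c ! z) (λ i → x ! i ∧ d i ! z))) ⟩
  sum (λ z → sum (λ i → (x ! i ∧ d i ! z) ∧ c ! z))
    ≡⟨ ∑-comm (λ z i → (x ! i ∧ d i ! z) ∧ c ! z) ⟩
  sum (λ i → sum (λ z → (x ! i ∧ d i ! z) ∧ c ! z))
    ≡⟨ sum-cong-≗ (λ i → trans (sum-cong-≗ (λ z → Bool.∧-assoc (x ! i) (d i ! z) (c ! z)))
         (trans (sym (*-distribˡ-sum (x ! i) (λ z → d i ! z ∧ c ! z))) (cong (x ! i ∧_) (sym (∙-sum (d i) c))))) ⟩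
  sum (λ i → x ! i ∧ d i ∙ c)
    ≡⟨ ∙-tabulate x (λ i → d i ∙ c) ⟨
  x ∙ tabulate (λ i → d i ∙ c) ∎
  where open ≡-Reasoning

∙-δ : (x : Vec Bool r) (f : Fin r → Bool) (i : Fin r) → (∀ j → f j ≡ δ j i) → x ∙ tabulate f ≡ x ! i
∙-δ x f i h = trans (∙-tabulate x f) (trans
  (sum-cong-≗ λ j → trans (Bool.∧-comm (x ! j) (f j)) (cong (_∧ x ! j) (h j))) (sum-δ (x !_) i))

∙-zero : (x : Vec Bool r) (f : Fin r → Bool) → (∀ i → f i ≡ false) → x ∙ tabulate f ≡ false
∙-zero x f h = trans (∙-tabulate x f) (sum-false λ i → trans (cong (x ! i ∧_) (h i)) (Bool.∧-zeroʳ (x ! i)))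

-- Standard matrices

-- A standard representation [ I | A ] of C ᗮ: the rows are d, the columns of
-- the identity part are the elements b, and those of A are the elements e.
record Frame (C : Code n) (r s : ℕ) : Set where
  field
    b           : Fin r → Fin n
    e           : Fin s → Fin n
    b-injective : Injective b
    e-injective : Injective e
    b≢e         : ∀ i j → b i ≢ e j
    cover       : ∀ x → Image b x ⊎ Image e x
    d           : Fin r → Vec Bool n
    d-b         : ∀ i j → d i ! b j ≡ δ i j
    d-sound     : ∀ {c} → C ∋ c → ∀ i → d i ∙ c ≡ false
    d-complete  : ∀ {c} → (∀ i → d i ∙ c ≡ false) → C ∋ c

  col : Fin n → Vec Bool r
  col x = tabulate (λ i → d i ! x)

  col! : ∀ x i → col x ! i ≡ d i ! x
  col! x = lookup∘tabulate (λ i → d i ! x)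

  A : Fin s → Vec Bool r
  A j = col (e j)

  comb-b : ∀ x i → comb x d ! b i ≡ x ! i
  comb-b x i = trans (comb! x d (b i)) (∙-δ x _ i (λ j → d-b j i))

  comb∈ : ∀ x → C ᗮ ∋ comb x d
  comb∈ x c Cc = trans (∙-comm c (comb x d)) (trans (comb-∙ x d c) (∙-zero x _ (d-sound Cc)))

  pull-b : ∀ i → pull b (d i) ≡ ⁅ i ⁆
  pull-b i = vec-ext λ j → trans (pull! b (d i) j) (trans (d-b i j) (sym (⁅⁆! i j)))

  module _ {m} (e′ : Fin m → Fin n) where

    -- The selection `e′` may omit nonbasic elements, so forbidden configurations can be looked for
    -- in submatrices.
    word : Vec Bool m → Vec Bool n
    word y = push e′ y ⊕ᵥ push b (comb y (col ∘ e′))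

    word∈ : ∀ y → C ∋ word y
    word∈ y = d-complete λ i → begin
      d i ∙ word y
        ≡⟨ ∙-comm (d i) (word y) ⟩
      word y ∙ d i
        ≡⟨ ∙-⊕ˡ (push e′ y) (push b (comb y (col ∘ e′))) (d i) ⟩
      push e′ y ∙ d i xor push b (comb y (col ∘ e′)) ∙ d i
        ≡⟨ cong₂ _xor_ (push-∙ e′ y (d i)) (trans (push-∙ b (comb y (col ∘ e′)) (d i)) (trans (cong (comb y (col ∘ e′) ∙_) (pull-b i))
             (trans (∙-comm (comb y (col ∘ e′)) ⁅ i ⁆) (∙-⁅⁆ i (comb y (col ∘ e′)))))) ⟩
      y ∙ pull e′ (d i) xor comb y (col ∘ e′) ! i
        ≡⟨ cong (y ∙ pull e′ (d i) xor_) (trans (comb! y (col ∘ e′) i) (cong (y ∙_) (tabulate-cong λ j → col! (e′ j) i))) ⟩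
      y ∙ pull e′ (d i) xor y ∙ pull e′ (d i)
        ≡⟨ Bool.xor-same (y ∙ pull e′ (d i)) ⟩
      false ∎
      where open ≡-Reasoning

    module _ (e′-injective : Injective e′) (b≢e′ : ∀ i j → b i ≢ e′ j) where

      word-e : ∀ y j → word y ! e′ j ≡ y ! j
      word-e y j = trans (⊕! (push e′ y) (push b (comb y (col ∘ e′))) (e′ j)) (trans (cong₂ _xor_ (push-ι e′-injective y j)
        (push-out b (comb y (col ∘ e′)) λ (i , eq) → b≢e′ i j eq)) (Bool.xor-identityʳ _))

      word-b : ∀ y i → word y ! b i ≡ comb y (col ∘ e′) ! i
      word-b y i = trans (⊕! (push e′ y) (push b (comb y (col ∘ e′))) (b i)) (cong₂ _xor_
        (push-out e′ y λ (j , eq) → b≢e′ i j (sym eq)) (push-ι b-injective (comb y (col ∘ e′)) i))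

      word-out : ∀ y {x} → ¬ Image b x → ¬ Image e′ x → word y ! x ≡ false
      word-out y {x} x∉b x∉e = trans (⊕! (push e′ y) (push b (comb y (col ∘ e′))) x)
        (cong₂ _xor_ (push-out e′ y x∉e) (push-out b (comb y (col ∘ e′)) x∉b))

  dual-word : Fin s → Vec Bool n
  dual-word j = word e ⁅ j ⁆

  comb-⁅⁆ : ∀ {k} j (B : Fin s → Vec Bool k) → comb ⁅ j ⁆ B ≡ B j
  comb-⁅⁆ j B = vec-ext λ i → trans (comb! ⁅ j ⁆ B i) (trans (∙-⁅⁆ j _) (lookup∘tabulate _ j))

  dual-word-b : ∀ j i → dual-word j ! b i ≡ d i ! e j
  dual-word-b j i = trans (word-b e e-injective b≢e ⁅ j ⁆ i) (trans (cong (_! i) (comb-⁅⁆ j (col ∘ e))) (col! (e j) i))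

  -- `dual-word j` meets the nonbasic elements only in `e j`, so orthogonality to it determines the
  -- value at `e j` from the values on the basis.
  expansion : ∀ {f} → (∀ j → dual-word j ∙ f ≡ false) → f ≡ comb (pull b f) d
  expansion {f} h = vec-ext at
    where
    at-b : ∀ i → f ! b i ≡ comb (pull b f) d ! b i
    at-b i = sym (trans (comb-b (pull b f) i) (pull! b f i))
    at-e : ∀ j → f ! e j ≡ comb (pull b f) d ! e j
    at-e j = xor-≡ (begin
      f ! e j xor comb (pull b f) d ! e j
        ≡⟨ cong₂ _xor_ (sym (trans (∙-⁅⁆ j (pull e f)) (pull! e f j)))
             (trans (comb! (pull b f) d (e j)) (trans (∙-comm (pull b f) (col (e j)))
               (cong (_∙ pull b f) (sym (comb-⁅⁆ j (col ∘ e)))))) ⟩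
      ⁅ j ⁆ ∙ pull e f xor comb ⁅ j ⁆ (col ∘ e) ∙ pull b f
        ≡⟨ cong₂ _xor_ (sym (push-∙ e ⁅ j ⁆ f)) (sym (push-∙ b (comb ⁅ j ⁆ (col ∘ e)) f)) ⟩
      push e ⁅ j ⁆ ∙ f xor push b (comb ⁅ j ⁆ (col ∘ e)) ∙ f
        ≡⟨ ∙-⊕ˡ (push e ⁅ j ⁆) (push b (comb ⁅ j ⁆ (col ∘ e))) f ⟨
      dual-word j ∙ f
        ≡⟨ h j ⟩
      false ∎)
      where open ≡-Reasoning
    at : ∀ x → f ! x ≡ comb (pull b f) d ! x
    at x with cover x
    ... | inj₁ (i , refl) = at-b i
    ... | inj₂ (j , refl) = at-e j

-- The matrix is transposed, and the fundamental circuits `dual-word j` become the rows.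
dualFrame : {C : Code n} → Frame C r s → Frame (C ᗮ) s r
dualFrame {C = C} F = record
  { b           = e
  ; e           = b
  ; b-injective = e-injective
  ; e-injective = b-injective
  ; b≢e         = λ j i eq → b≢e i j (sym eq)
  ; cover       = λ x → [ inj₂ , inj₁ ]′ (cover x)
  ; d           = dual-word
  ; d-b         = λ j j′ → trans (word-e e e-injective b≢e ⁅ j ⁆ j′) (⁅⁆! j j′)
  ; d-sound     = λ f⊥ j → f⊥ (dual-word j) (word∈ e ⁅ j ⁆)
  ; d-complete  = λ {f} h → subst (C ᗮ ∋_) (sym (expansion h)) (comb∈ (pull b f))
  }
  where open Frame F

frame : (C : Code n) → ∃₂ λ r s → Frame C r s
frame C with baseIn C ⊤ (λ d _ d⊆ → ⊆⊥⇒≡⊥ (λ x∈d → contradiction ∈⊤ (x∈∁p⇒x∉p (d⊆ x∈d))))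
... | B , fB , fB* , _ = ∣ B ∣ , ∣ ∁ B ∣ , record
  { b           = embed B
  ; e           = embed (∁ B)
  ; b-injective = embed-injective B
  ; e-injective = embed-injective (∁ B)
  ; b≢e         = λ i j eq → x∈∁p⇒x∉p (embed-∈ (∁ B) j) (subst (_∈ B) eq (embed-∈ B i))
  ; cover       = cover′
  ; d           = d′
  ; d-b         = d-b′
  ; d-sound     = λ {c} Cc i → trans (∙-comm (d′ i) c) (d′⊥ i c Cc)
  ; d-complete  = λ {c} h → ᗮᗮ⁻ C (λ f f⊥ → trans (cong (_∙ c) (expand-f f f⊥))
                    (trans (comb-∙ (pull (embed B) f) d′ c) (∙-zero (pull (embed B) f) _ h)))
  }
  where
  d′ : Fin ∣ B ∣ → Vec Bool _
  d′ i = proj₁ (coordinate C fB (embed-∈ B i))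
  d′⊥ : ∀ i → C ᗮ ∋ d′ i
  d′⊥ i = proj₁ (proj₂ (coordinate C fB (embed-∈ B i)))
  d-b′ : ∀ i j → d′ i ! embed B j ≡ δ i j
  d-b′ i j with i Fin.≟ j | coordinate C fB (embed-∈ B i)
  ... | yes refl | _ , _ , di , _ = di
  ... | no i≢j   | _ , _ , _ , d0 = d0 (embed-∈ B j) (i≢j ∘ sym ∘ embed-injective B)
  cover′ : ∀ x → Image (embed B) x ⊎ Image (embed (∁ B)) x
  cover′ x with x ∈? B
  ... | yes x∈B = inj₁ (embed-surjective B x∈B)
  ... | no x∉B  = inj₂ (embed-surjective (∁ B) (x∉p⇒x∈∁p x∉B))
  expand-f : ∀ f → C ᗮ ∋ f → f ≡ comb (pull (embed B) f) d′
  expand-f f f⊥ = ⊕-zero (fB* _ (mem-⊕ (C ᗮ) f⊥ comb⊥) (λ {x} → sub {x}))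
    where
    x = pull (embed B) f
    comb⊥ : C ᗮ ∋ comb x d′
    comb⊥ c Cc = trans (∙-comm c (comb x d′)) (trans (comb-∙ x d′ c)
      (∙-zero x _ λ i → trans (∙-comm (d′ i) c) (d′⊥ i c Cc)))
    sub : f ⊕ᵥ comb x d′ ⊆ ∁ B
    sub {z} z∈ = x∉p⇒x∈∁p λ z∈B → at (embed-surjective B z∈B) (∈⇒! z∈)
      where
      at : Image (embed B) z → (f ⊕ᵥ comb x d′) ! z ≢ true
      at (i , refl) eq = true≢false eq (trans (⊕! f (comb x d′) (embed B i))
        (trans (cong₂ _xor_ (sym (pull! (embed B) f i)) (trans (comb! x d′ _) (∙-δ x _ i λ j → d-b′ j i)))
               (Bool.xor-same (x ! i))))

-- An identity submatrix, the same certificate of independence as in `Plane`.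
Pivoted : Vec Bool k → Vec Bool k → Set
Pivoted a b = ∃₂ λ p q → a ! p ≡ true × a ! q ≡ false × b ! p ≡ false × b ! q ≡ true

-- In terms of the standard matrix [ I | A ], the word with information part y
-- and the coword with information part x have disjoint supports.
Orth : (Fin m → Vec Bool r) → Vec Bool r → Vec Bool m → Set
Orth A x y = (∀ i → x ! i ∧ comb y A ! i ≡ false) × (∀ j → y ! j ∧ x ∙ A j ≡ false)

BadMatrix : (Fin m → Vec Bool r) → Set
BadMatrix A = ∃₂ λ y y′ → Pivoted y y′ × ∃₂ λ x x′ → Pivoted x x′ ×
  (Orth A x y × Orth A x y′) × (Orth A x′ y × Orth A x′ y′)

offOrOff : ∀ {a a′ b b′} → b ∧ a ≡ false → b ∧ a′ ≡ false → b′ ∧ a ≡ false → b′ ∧ a′ ≡ false →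
       (a ≡ false × a′ ≡ false) ⊎ (b ≡ false × b′ ≡ false)
offOrOff {b = false} {false} _ _ _ _ = inj₂ (refl , refl)
offOrOff {b = true} p q _ _ = inj₁ (p , q)
offOrOff {b = false} {true} _ _ p q = inj₁ (p , q)

-- The words of the first plane vanish on the omitted columns, so the supports are disjoint there
-- whatever the dual words do.
badMatrix⇒bad : {C : Code n} (F : Frame C r s) (e′ : Fin m → Fin n) → Injective e′ →
                (∀ i j → Frame.b F i ≢ e′ j) → BadMatrix (Frame.col F ∘ e′) → Bad C
badMatrix⇒bad {C = C} F e′ e′-inj b≢e′
  (y , y′ , (p , q , yp , yq , y′p , y′q) , x , x′ , (u , v , xu , xv , x′u , x′v) ,
   (o₁ , o₂) , (o₃ , o₄)) = P , Q , off
  where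
  open Frame F hiding (A)
  w! = word-e e′ e′-inj b≢e′
  P : Plane C
  P = record { a∈ = word∈ e′ y ; b∈ = word∈ e′ y′ ; p = e′ p ; q = e′ q
             ; a!p = trans (w! y p) yp ; a!q = trans (w! y q) yq
             ; b!p = trans (w! y′ p) y′p ; b!q = trans (w! y′ q) y′q }
  Q : Plane (C ᗮ)
  Q = record { a∈ = comb∈ x ; b∈ = comb∈ x′ ; p = b u ; q = b v
             ; a!p = trans (comb-b x u) xu ; a!q = trans (comb-b x v) xv
             ; b!p = trans (comb-b x′ u) x′u ; b!q = trans (comb-b x′ v) x′v }
  at-b : ∀ {x y} i → Orth (col ∘ e′) x y → comb x d ! b i ∧ word e′ y ! b i ≡ false
  at-b {x} {y} i o = trans (cong₂ _∧_ (comb-b x i) (word-b e′ e′-inj b≢e′ y i)) (proj₁ o i)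
  at-e : ∀ {x y} j → Orth (col ∘ e′) x y → comb x d ! e′ j ∧ word e′ y ! e′ j ≡ false
  at-e {x} {y} j o = trans (cong₂ _∧_ (comb! x d (e′ j)) (w! y j)) (trans (Bool.∧-comm (x ∙ col (e′ j)) (y ! j)) (proj₂ o j))
  off : ∀ z → Off P z ⊎ Off Q z
  off z with Fin.any? (λ i → b i Fin.≟ z) | Fin.any? (λ j → e′ j Fin.≟ z)
  ... | yes (i , refl) | _ = offOrOff (at-b {x} {y} i o₁) (at-b {x} {y′} i o₂) (at-b {x′} {y} i o₃) (at-b {x′} {y′} i o₄)
  ... | no _ | yes (j , refl) = offOrOff (at-e {x} {y} j o₁) (at-e {x} {y′} j o₂) (at-e {x′} {y} j o₃) (at-e {x′} {y′} j o₄)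
  ... | no z∉b | no z∉e = inj₁ (word-out e′ e′-inj b≢e′ y z∉b z∉e , word-out e′ e′-inj b≢e′ y′ z∉b z∉e)

permuteFrame : {C : Code n} → Permutation k r → Permutation l s → Frame C r s → Frame C k l
permuteFrame ρ κ F = record
  { b           = b ∘ (ρ ⟨$⟩ʳ_)
  ; e           = e ∘ (κ ⟨$⟩ʳ_)
  ; b-injective = Split.injective (relabel-split ρ) ∘ b-injective
  ; e-injective = Split.injective (relabel-split κ) ∘ e-injective
  ; b≢e         = λ i j → b≢e _ _
  ; cover       = λ x → cover′ (cover x)
  ; d           = d ∘ (ρ ⟨$⟩ʳ_)
  ; d-b         = d-b′
  ; d-sound     = λ Cc i → d-sound Cc _
  ; d-complete  = λ {c} h → d-complete λ i → subst (λ j → d j ∙ c ≡ false) (Perm.inverseʳ ρ) (h (ρ ⟨$⟩ˡ i))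
  }
  where
  open Frame F
  cover′ : ∀ {x} → Image b x ⊎ Image e x → Image (b ∘ (ρ ⟨$⟩ʳ_)) x ⊎ Image (e ∘ (κ ⟨$⟩ʳ_)) x
  cover′ (inj₁ (i , refl)) = inj₁ (ρ ⟨$⟩ˡ i , cong b (Perm.inverseʳ ρ))
  cover′ (inj₂ (j , refl)) = inj₂ (κ ⟨$⟩ˡ j , cong e (Perm.inverseʳ κ))
  d-b′ : ∀ i j → d (ρ ⟨$⟩ʳ i) ! b (ρ ⟨$⟩ʳ j) ≡ δ i j
  d-b′ i j with i Fin.≟ j
  ... | yes refl = trans (d-b _ _) (δ-refl (ρ ⟨$⟩ʳ i))
  ... | no i≢j   = trans (d-b _ _) (δ-≢ (i≢j ∘ Split.injective (relabel-split ρ)))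

module _ {C : Code n} (F : Frame C r s) (i₀ : Fin r) (j₀ : Fin s) (pivot : Frame.d F i₀ ! Frame.e F j₀ ≡ true) where

  open Frame F

  private
    b′ : Fin r → Fin n
    b′ = updateAt b i₀ (λ _ → e j₀)

    e′ : Fin s → Fin n
    e′ = updateAt e j₀ (λ _ → b i₀)

    d′ : Fin r → Vec Bool n
    d′ i with i Fin.≟ i₀ | d i ! e j₀
    ... | yes _ | _     = d i
    ... | no _  | false = d i
    ... | no _  | true  = d i ⊕ᵥ d i₀

  b′-i₀ : b′ i₀ ≡ e j₀
  b′-i₀ = updateAt-updates i₀ b

  b′-≢ : ∀ {i} → i ≢ i₀ → b′ i ≡ b i
  b′-≢ {i} i≢ = updateAt-minimal i i₀ b i≢

  e′-j₀ : e′ j₀ ≡ b i₀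
  e′-j₀ = updateAt-updates j₀ e

  e′-≢ : ∀ {j} → j ≢ j₀ → e′ j ≡ e j
  e′-≢ {j} j≢ = updateAt-minimal j j₀ e j≢

  d′-i₀ : d′ i₀ ≡ d i₀
  d′-i₀ with i₀ Fin.≟ i₀
  ... | yes _ = refl
  ... | no ¬p = contradiction refl ¬p

  d′-≢ : ∀ {i} → i ≢ i₀ → ∀ x → d′ i ! x ≡ d i ! x xor (d i ! e j₀ ∧ d i₀ ! x)
  d′-≢ {i} i≢ x with i Fin.≟ i₀ | d i ! e j₀
  ... | yes p | _     = contradiction p i≢
  ... | no _  | false = sym (Bool.xor-identityʳ _)
  ... | no _  | true  = ⊕! (d i) (d i₀) x

  d′-∙ : ∀ {i} → i ≢ i₀ → ∀ c → d′ i ∙ c ≡ d i ∙ c xor (d i ! e j₀ ∧ d i₀ ∙ c)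
  d′-∙ {i} i≢ c with i Fin.≟ i₀ | d i ! e j₀
  ... | yes p | _     = contradiction p i≢
  ... | no _  | false = sym (Bool.xor-identityʳ _)
  ... | no _  | true  = ∙-⊕ˡ (d i) (d i₀) c

  -- Basis exchange of `b i₀` and `e j₀`: adding row `i₀` to the other rows with a one in column
  -- `e j₀` turns this column into a unit vector.
  pivotFrame : Frame C r s
  pivotFrame = record
    { b           = b′
    ; e           = e′
    ; b-injective = λ {i} {j} → b′-inj i j
    ; e-injective = λ {i} {j} → e′-inj i j
    ; b≢e         = b′≢e′
    ; cover       = λ x → cover′ x (cover x)
    ; d           = d′
    ; d-b         = d-b′
    ; d-sound     = sound
    ; d-complete  = complete
    }
    where
    b′-inj : ∀ i j → b′ i ≡ b′ j → i ≡ j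
    b′-inj i j eq with i Fin.≟ i₀ | j Fin.≟ i₀
    ... | yes refl | yes refl = refl
    ... | yes refl | no j≢ = contradiction (trans (sym (b′-≢ j≢)) (trans (sym eq) b′-i₀)) (b≢e j j₀)
    ... | no i≢ | yes refl = contradiction (trans (sym (b′-≢ i≢)) (trans eq b′-i₀)) (b≢e i j₀)
    ... | no i≢ | no j≢ = b-injective (trans (sym (b′-≢ i≢)) (trans eq (b′-≢ j≢)))
    e′-inj : ∀ i j → e′ i ≡ e′ j → i ≡ j
    e′-inj i j eq with i Fin.≟ j₀ | j Fin.≟ j₀
    ... | yes refl | yes refl = refl
    ... | yes refl | no j≢ = contradiction (trans (sym e′-j₀) (trans eq (e′-≢ j≢))) (b≢e i₀ j)
    ... | no i≢ | yes refl = contradiction (trans (sym e′-j₀) (trans (sym eq) (e′-≢ i≢))) (b≢e i₀ i)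
    ... | no i≢ | no j≢ = e-injective (trans (sym (e′-≢ i≢)) (trans eq (e′-≢ j≢)))
    b′≢e′ : ∀ i j → b′ i ≢ e′ j
    b′≢e′ i j eq with i Fin.≟ i₀ | j Fin.≟ j₀
    ... | yes refl | yes refl = b≢e i₀ j₀ (trans (sym e′-j₀) (trans (sym eq) b′-i₀))
    ... | yes refl | no j≢ = j≢ (sym (e-injective (trans (sym b′-i₀) (trans eq (e′-≢ j≢)))))
    ... | no i≢ | yes refl = i≢ (b-injective (trans (sym (b′-≢ i≢)) (trans eq e′-j₀)))
    ... | no i≢ | no j≢ = b≢e i j (trans (sym (b′-≢ i≢)) (trans eq (e′-≢ j≢)))
    cover′ : ∀ x → Image b x ⊎ Image e x → Image b′ x ⊎ Image e′ x
    cover′ x (inj₁ (i , refl)) with i Fin.≟ i₀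
    ... | yes refl = inj₂ (j₀ , e′-j₀)
    ... | no i≢    = inj₁ (i , b′-≢ i≢)
    cover′ x (inj₂ (j , refl)) with j Fin.≟ j₀
    ... | yes refl = inj₁ (i₀ , b′-i₀)
    ... | no j≢    = inj₂ (j , e′-≢ j≢)
    d-b′ : ∀ i j → d′ i ! b′ j ≡ δ i j
    d-b′ i j = go (i Fin.≟ i₀) (j Fin.≟ i₀)
      where
      go : Dec (i ≡ i₀) → Dec (j ≡ i₀) → d′ i ! b′ j ≡ δ i j
      go (yes refl) (yes refl) = trans (cong₂ _!_ d′-i₀ b′-i₀) (trans pivot (sym (δ-refl i₀)))
      go (yes refl) (no j≢) = trans (cong₂ _!_ d′-i₀ (b′-≢ j≢)) (d-b i j)
      go (no i≢) (yes refl) = trans (cong (d′ i !_) b′-i₀) (trans (d′-≢ i≢ (e j₀))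
          (trans (cong (λ t → d i ! e j₀ xor (d i ! e j₀ ∧ t)) pivot)
          (trans (cong (d i ! e j₀ xor_) (Bool.∧-identityʳ _)) (trans (Bool.xor-same (d i ! e j₀)) (sym (δ-≢ i≢))))))
      go (no i≢) (no j≢) = trans (cong (d′ i !_) (b′-≢ j≢)) (trans (d′-≢ i≢ (b j))
          (trans (cong₂ (λ t u → t xor (d i ! e j₀ ∧ u)) (d-b i j) (trans (d-b i₀ j) (δ-≢ (j≢ ∘ sym))))
          (trans (cong (δ i j xor_) (Bool.∧-zeroʳ _)) (Bool.xor-identityʳ _))))
    sound : ∀ {c} → C ∋ c → ∀ i → d′ i ∙ c ≡ false
    sound {c} Cc i = go (i Fin.≟ i₀)
      where
      go : Dec (i ≡ i₀) → d′ i ∙ c ≡ false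
      go (yes refl) = trans (cong (_∙ c) d′-i₀) (d-sound Cc i)
      go (no i≢) = trans (d′-∙ i≢ c) (cong₂ (λ t u → t xor u) (d-sound Cc i)
          (trans (cong (d i ! e j₀ ∧_) (d-sound Cc i₀)) (Bool.∧-zeroʳ _)))
    complete : ∀ {c} → (∀ i → d′ i ∙ c ≡ false) → C ∋ c
    complete {c} h = d-complete λ i → go i (i Fin.≟ i₀)
      where
      at₀ : d i₀ ∙ c ≡ false
      at₀ = trans (cong (_∙ c) (sym d′-i₀)) (h i₀)
      go : ∀ i → Dec (i ≡ i₀) → d i ∙ c ≡ false
      go i (yes refl) = at₀
      go i (no i≢) = trans (sym (trans (cong (d i ∙ c xor_) (trans (cong (d i ! e j₀ ∧_) at₀) (Bool.∧-zeroʳ _)))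
                          (Bool.xor-identityʳ _))) (trans (sym (d′-∙ i≢ c)) (h i))

-- Embedding simple codes

infix 4 _⊴_

_⊴_ : Code m → Code n → Set
C′ ⊴ C = ∃ λ ι → ∃₂ λ X Y → Split ι X Y × Minor C′ C ι X

⊴-ᗮ : {C′ : Code m} {C : Code n} → C′ ⊴ C → C′ ᗮ ⊴ C ᗮ
⊴-ᗮ (ι , X , Y , S , Mi) = ι , Y , X , flipSplit S , dualMinor S Mi

≐-⊴ : {C D : Code m} {C′ : Code n} → C ≐ D → C ⊴ C′ → D ⊴ C′
≐-⊴ eq (ι , X , Y , S , Mi) = ι , X , Y , S , ≐-Minor eq Mi

column : Vec (Vec Bool n) k → Fin n → Vec Bool k
column W y = tabulate (λ i → W ! i ! y)

Simple : Code n → Set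
Simple C = ∀ c → C ∋ c → c ≢ ⊥ → 2 < ∣ c ∣

∣p∪q∣≤∣p∣+∣q∣ : (p q : Subset n) → ∣ p ∪ q ∣ ≤ ∣ p ∣ + ∣ q ∣
∣p∪q∣≤∣p∣+∣q∣ []          []          = z≤n
∣p∪q∣≤∣p∣+∣q∣ (false ∷ p) (false ∷ q) = ∣p∪q∣≤∣p∣+∣q∣ p q
∣p∪q∣≤∣p∣+∣q∣ (false ∷ p) (true ∷ q)
  = subst (suc ∣ p ∪ q ∣ ≤_) (sym (ℕ.+-suc ∣ p ∣ ∣ q ∣)) (s≤s (∣p∪q∣≤∣p∣+∣q∣ p q))
∣p∪q∣≤∣p∣+∣q∣ (true ∷ p)  (false ∷ q) = s≤s (∣p∪q∣≤∣p∣+∣q∣ p q)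
∣p∪q∣≤∣p∣+∣q∣ (true ∷ p)  (true ∷ q)  = s≤s (ℕ.≤-trans (∣p∪q∣≤∣p∣+∣q∣ p q)
  (ℕ.+-monoʳ-≤ ∣ p ∣ (ℕ.n≤1+n ∣ q ∣)))

∣⁅x⁆⊕⁅y⁆∣≤2 : (x y : Fin n) → ∣ ⁅ x ⁆ ⊕ᵥ ⁅ y ⁆ ∣ ≤ 2
∣⁅x⁆⊕⁅y⁆∣≤2 x y = ℕ.≤-trans (p⊆q⇒∣p∣≤∣q∣ {p = ⁅ x ⁆ ⊕ᵥ ⁅ y ⁆} {⁅ x ⁆ ∪ ⁅ y ⁆} sub)
  (ℕ.≤-trans (∣p∪q∣≤∣p∣+∣q∣ ⁅ x ⁆ ⁅ y ⁆) (ℕ.≤-reflexive (cong₂ _+_ (∣⁅x⁆∣≡1 x) (∣⁅x⁆∣≡1 y))))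
  where
  sub : ⁅ x ⁆ ⊕ᵥ ⁅ y ⁆ ⊆ ⁅ x ⁆ ∪ ⁅ y ⁆
  sub {z} z∈ with z ∈? ⁅ x ⁆ | z ∈? ⁅ y ⁆
  ... | yes p | _     = x∈p∪q⁺ (inj₁ p)
  ... | no _  | yes p = x∈p∪q⁺ (inj₂ p)
  ... | no p  | no q  = contradiction
    (trans (⊕! ⁅ x ⁆ ⁅ y ⁆ z) (cong₂ _xor_ (∉⇒! p) (∉⇒! q))) (true≢false (∈⇒! z∈))

module _ {C : Code n} (F : Frame C r s) (simple : Simple C) where

  open Frame F

  col≢⊥ : ∀ x → col x ≢ ⊥
  col≢⊥ x eq = ℕ.<⇒≱ (simple ⁅ x ⁆ x∈C (∃⇒≢⊥ x (∈⇒! (x∈⁅x⁆ x)))) (ℕ.≤-trans (ℕ.≤-reflexive (∣⁅x⁆∣≡1 x)) (s≤s z≤n))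
    where
    x∈C : C ∋ ⁅ x ⁆
    x∈C = d-complete λ i → trans (∙-comm (d i) ⁅ x ⁆) (trans (∙-⁅⁆ x (d i))
      (trans (sym (col! x i)) (trans (cong (_! i) eq) (⊥! i))))

  col-injective : Injective col
  col-injective {x} {y} eq with x Fin.≟ y
  ... | yes x≡y = x≡y
  ... | no x≢y = contradiction (∣⁅x⁆⊕⁅y⁆∣≤2 x y) (ℕ.<⇒≱ (simple (⁅ x ⁆ ⊕ᵥ ⁅ y ⁆) xy∈C (∃⇒≢⊥ x xy!x)))
    where
    xy∈C : C ∋ (⁅ x ⁆ ⊕ᵥ ⁅ y ⁆)
    xy∈C = d-complete λ i → trans (∙-comm (d i) (⁅ x ⁆ ⊕ᵥ ⁅ y ⁆)) (trans (∙-⊕ˡ ⁅ x ⁆ ⁅ y ⁆ (d i))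
      (trans (cong₂ _xor_ (trans (∙-⁅⁆ x (d i)) (sym (col! x i))) (trans (∙-⁅⁆ y (d i)) (sym (col! y i))))
      (trans (cong (λ v → col x ! i xor v ! i) (sym eq)) (Bool.xor-same (col x ! i)))))
    xy!x : (⁅ x ⁆ ⊕ᵥ ⁅ y ⁆) ! x ≡ true
    xy!x = trans (⊕! ⁅ x ⁆ ⁅ y ⁆ x) (cong₂ _xor_ (∈⇒! (x∈⁅x⁆ x)) (∉⇒! (x≢y ∘ x∈⁅y⁆⇒x≡y y)))

supported⇒push : {ι : Fin m → Fin n} → Injective ι → ∀ {c̃} → Supported ι ⊥ c̃ → push ι (pull ι c̃) ≡ c̃
supported⇒push {ι = ι} inj {c̃} s = vec-ext at
  where
  at : ∀ x → push ι (pull ι c̃) ! x ≡ c̃ ! x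
  at x with Fin.any? (λ i → ι i Fin.≟ x)
  ... | yes (i , refl) = trans (push-ι inj (pull ι c̃) i) (pull! ι c̃ i)
  ... | no ¬p = trans (push-out ι (pull ι c̃) ¬p) (sym (≢true λ e → [ ∉⊥ , ¬p ]′ (s e)))

module _ {C : Code n} (F : Frame C r s) (simple : Simple C) (W : Vec (Vec Bool m) k)
         (t : Fin r → Vec Bool k) (t-injective : ∀ x → comb x t ≡ ⊥ → x ≡ ⊥) where

  open Frame F

  -- The vectors `t i` define an injective linear map, and `syndrome` shows that it carries the
  -- syndrome of a word to that of its pushforward. Hence both vanish together, and `C` arises from
  -- `rows W` by deletion.
  restrictTo : (ι : Fin n → Fin m) → (∀ x → column W (ι x) ≡ comb (col x) t) →
               Injective ι × Minor C (rows W) ι ⊥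
  restrictTo ι h = ι-injective , record
    { lift = λ {c} Cc → push ι c , push∈ Cc ,
             vec-ext (λ z → trans (pull! ι (push ι c) z) (push-ι ι-injective c z)) ,
             λ e → inj₂ (push-supp ι c e)
    ; proj = pull∈
    }
    where
    comb-injective : ∀ {u v} → comb u t ≡ comb v t → u ≡ v
    comb-injective {u} {v} eq = ⊕-zero (t-injective (u ⊕ᵥ v) (vec-ext λ i → trans (comb! (u ⊕ᵥ v) t i)
      (trans (∙-⊕ˡ u v _) (trans (cong₂ _xor_ (sym (comb! u t i)) (sym (comb! v t i)))
      (trans (cong (λ w → comb u t ! i xor w ! i) (sym eq)) (trans (Bool.xor-same (comb u t ! i)) (sym (⊥! i))))))))
    ι-injective : Injective ι
    ι-injective {x} {y} eq = col-injective F simple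
      (comb-injective (trans (sym (h x)) (trans (cong (column W) eq) (h y))))
    syndrome : ∀ i c → W ! i ∙ push ι c ≡ comb (tabulate λ j → d j ∙ c) t ! i
    syndrome i c = begin
      W ! i ∙ push ι c
        ≡⟨ ∙-comm (W ! i) (push ι c) ⟩
      push ι c ∙ W ! i
        ≡⟨ push-∙ ι c (W ! i) ⟩
      c ∙ pull ι (W ! i)
        ≡⟨ cong (c ∙_) (vec-ext row) ⟩
      c ∙ comb ti d
        ≡⟨ ∙-comm c (comb ti d) ⟩
      comb ti d ∙ c
        ≡⟨ comb-∙ ti d c ⟩
      ti ∙ tabulate (λ j → d j ∙ c)
        ≡⟨ ∙-comm ti _ ⟩
      tabulate (λ j → d j ∙ c) ∙ ti
        ≡⟨ comb! (tabulate λ j → d j ∙ c) t i ⟨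
      comb (tabulate λ j → d j ∙ c) t ! i ∎
      where
      open ≡-Reasoning
      ti = tabulate (λ j → t j ! i)
      row : ∀ x → pull ι (W ! i) ! x ≡ comb ti d ! x
      row x = trans (pull! ι (W ! i) x) (trans (sym (lookup∘tabulate (λ i → W ! i ! ι x) i))
        (trans (cong (_! i) (h x)) (trans (comb! (col x) t i) (trans (∙-comm (col x) ti) (sym (comb! ti d x))))))
    synd : Vec Bool n → Vec Bool r
    synd c = tabulate (λ j → d j ∙ c)
    synd! : ∀ c j → synd c ! j ≡ d j ∙ c
    synd! c = lookup∘tabulate (λ j → d j ∙ c)
    push∈ : ∀ {c} → C ∋ c → rows W ∋ push ι c
    push∈ {c} Cc i = trans (syndrome i c) (trans (cong (λ u → comb u t ! i) synd≡⊥)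
      (trans (comb! ⊥ t i) (∙-⊥ˡ (tabulate (λ j → t j ! i)))))
      where
      synd≡⊥ : synd c ≡ ⊥
      synd≡⊥ = vec-ext λ j → trans (synd! c j) (trans (d-sound Cc j) (sym (⊥! j)))
    pull∈ : ∀ {c̃} → rows W ∋ c̃ → Supported ι ⊥ c̃ → C ∋ pull ι c̃
    pull∈ {c̃} Wc̃ supp = d-complete λ j → trans (sym (synd! (pull ι c̃) j)) (trans (cong (_! j) synd≡⊥) (⊥! j))
      where
      synd≡⊥ : synd (pull ι c̃) ≡ ⊥
      synd≡⊥ = t-injective _ (vec-ext λ i → trans (sym (syndrome i (pull ι c̃)))
        (trans (cong (W ! i ∙_) (supported⇒push ι-injective supp)) (trans (Wc̃ i) (sym (⊥! i)))))

  restrict : (∀ x → ∃ λ y → column W y ≡ comb (col x) t) → C ⊴ rows W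
  restrict h = let (inj , Mi) = restrictTo (proj₁ ∘ h) (proj₂ ∘ h)
                   (Y , S) = splitOff inj (λ _ → ∉⊥)
               in _ , ⊥ , Y , S , Mi

-- Contracting `o`, whose column is the first unit vector, is projection from that point and removes
-- the first row. A word of the smaller code lifts by setting its coordinate at `o` so that the
-- first row is satisfied as well.
cone : {C : Code m} (V : Vec (Vec Bool n) (suc k)) {ι : Fin m → Fin n} (o : Fin n) →
       Vec.head V ! o ≡ true → (∀ i → Vec.tail V ! i ! o ≡ false) → (∀ i → ι i ≢ o) →
       Minor C (rows (Vec.tail V)) ι ⊥ → Minor C (rows V) ι ⁅ o ⁆
cone {C = C} (w ∷ W) {ι} o wo Wo ι≢o Mi = record { lift = λ Cc → lift′ (Minor.lift Mi Cc) ; proj = proj′ }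
  where
  toggle : Vec Bool _ → Vec Bool _
  toggle c = c ⊕ᵥ ⁅ o ⁆
  ∙-toggle : ∀ u c → u ∙ toggle c ≡ u ∙ c xor u ! o
  ∙-toggle u c = trans (∙-⊕ʳ u c ⁅ o ⁆) (cong (u ∙ c xor_) (trans (∙-comm u ⁅ o ⁆) (∙-⁅⁆ o u)))
  W-toggle : ∀ i c → W ! i ∙ toggle c ≡ W ! i ∙ c
  W-toggle i c = trans (∙-toggle (W ! i) c) (trans (cong (W ! i ∙ c xor_) (Wo i)) (Bool.xor-identityʳ _))
  toggle-≢ : ∀ c {x} → o ≢ x → toggle c ! x ≡ c ! x
  toggle-≢ c {x} o≢x = trans (⊕! c ⁅ o ⁆ x) (trans (cong (c ! x xor_) (trans (⁅⁆! o x) (δ-≢ o≢x))) (Bool.xor-identityʳ _))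
  pull-toggle : ∀ c → pull ι (toggle c) ≡ pull ι c
  pull-toggle c = tabulate-cong λ i → toggle-≢ c (ι≢o i ∘ sym)
  Lifted : Vec Bool _ → Set
  Lifted c = ∃ λ c̃ → rows (w ∷ W) ∋ c̃ × pull ι c̃ ≡ c × Supported ι ⁅ o ⁆ c̃
  lift′ : ∀ {c} → (∃ λ c̃ → rows W ∋ c̃ × pull ι c̃ ≡ c × Supported ι ⊥ c̃) → Lifted c
  lift′ (c̃ , Wc̃ , eq , s) with w ∙ c̃ in wc
  ... | false = c̃ , (λ { zero → wc ; (suc i) → Wc̃ i }) , eq , λ e → inj₂ ([ (λ x∈ → contradiction x∈ ∉⊥) , (λ p → p) ]′ (s e))
  ... | true  = toggle c̃ , (λ { zero → trans (∙-toggle w c̃) (cong₂ _xor_ wc wo) ; (suc i) → trans (W-toggle i c̃) (Wc̃ i) }) ,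
                trans (pull-toggle c̃) eq , supp
    where
    supp : Supported ι ⁅ o ⁆ (toggle c̃)
    supp {x} e with o Fin.≟ x
    ... | yes refl = inj₁ (x∈⁅x⁆ o)
    ... | no o≢x = inj₂ ([ (λ x∈ → contradiction x∈ ∉⊥) , (λ p → p) ]′ (s (trans (sym (toggle-≢ c̃ o≢x)) e)))
  proj′ : ∀ {c̃} → rows (w ∷ W) ∋ c̃ → Supported ι ⁅ o ⁆ c̃ → C ∋ pull ι c̃
  proj′ {c̃} h s with c̃ ! o in co
  ... | false = Minor.proj Mi (h ∘ suc) supp
    where
    supp : Supported ι ⊥ c̃
    supp e with s e
    ... | inj₂ p = inj₂ p
    ... | inj₁ x∈ rewrite x∈⁅y⁆⇒x≡y o x∈ = contradiction co (true≢false e)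
  ... | true = subst (C ∋_) (pull-toggle c̃) (Minor.proj Mi (λ i → trans (W-toggle i c̃) (h (suc i))) supp)
    where
    supp : Supported ι ⊥ (toggle c̃)
    supp {x} e with o Fin.≟ x
    ... | yes refl = contradiction (trans (⊕! c̃ ⁅ o ⁆ o) (cong₂ _xor_ co (∈⇒! (x∈⁅x⁆ o)))) (true≢false e)
    ... | no o≢x with s (trans (sym (toggle-≢ c̃ o≢x)) e)
    ... | inj₂ p = inj₂ p
    ... | inj₁ x∈ = contradiction (sym (x∈⁅y⁆⇒x≡y o x∈)) o≢x

AG-matrix : Matrix₂ 5 (2 ^ 4)
AG-matrix = Vec.transpose (Vec.map (true ∷_) (allBoolVecs 4))

-- All vectors of GF(2)⁴: the points of PG(3,2) and, in column `0F`, the zero vector. That column is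
-- the point of AG(4,2) to be contracted.
PG-matrix : Matrix₂ 4 (2 ^ 4)
PG-matrix = Vec.tail AG-matrix

abstract
  PG-column : ∀ u → ∃ λ y → column PG-matrix y ≡ u
  PG-column = toWitness {a? = allSubsets? λ u → Fin.any? λ y → column PG-matrix y ≟ᵥ u} _

  AG-column : ∀ u → u ! 0F ≡ true → ∃ λ y → column AG-matrix y ≡ u
  AG-column = toWitness {a? = allSubsets? λ u → (u ! 0F Bool.≟ true) →-dec Fin.any? λ y → column AG-matrix y ≟ᵥ u} _

rank≤4⇒⊴AG : {C : Code n} → Frame C r s → Simple C → r ≤ 4 → C ⊴ rows AG-matrix
rank≤4⇒⊴AG {r = r} {C = C} F simple r≤4 =
  ι , ⁅ 0F ⁆ , proj₁ split , proj₂ split , Mi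
  where
  open Frame F
  t : Fin r → Vec Bool 4
  t i = ⁅ Fin.inject≤ i r≤4 ⁆
  comb-t : ∀ x i → comb x t ! Fin.inject≤ i r≤4 ≡ x ! i
  comb-t x i = trans (comb! x t (Fin.inject≤ i r≤4))
    (∙-δ x (λ j → t j ! Fin.inject≤ i r≤4) i λ j → trans (⁅⁆! (Fin.inject≤ j r≤4) (Fin.inject≤ i r≤4)) (δ-inject j))
    where
    δ-inject : ∀ j → δ (Fin.inject≤ j r≤4) (Fin.inject≤ i r≤4) ≡ δ j i
    δ-inject j with j Fin.≟ i
    ... | yes refl = δ-refl (Fin.inject≤ i r≤4)
    ... | no j≢i   = δ-≢ (j≢i ∘ Fin.inject≤-injective r≤4 r≤4 j i)
  t-injective : ∀ x → comb x t ≡ ⊥ → x ≡ ⊥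
  t-injective x eq = vec-ext λ i → trans (sym (comb-t x i)) (trans (cong (_! Fin.inject≤ i r≤4) eq)
    (trans (⊥! (Fin.inject≤ i r≤4)) (sym (⊥! i))))
  ι : Fin _ → Fin (2 ^ 4)
  ι x = proj₁ (PG-column (comb (col x) t))
  Re = restrictTo F simple PG-matrix t t-injective ι (λ x → proj₂ (PG-column (comb (col x) t)))
  ι≢0 : ∀ x → ι x ≢ 0F
  ι≢0 x eq = col≢⊥ F simple x (t-injective (col x) (trans (sym (proj₂ (PG-column (comb (col x) t)))) (cong (column PG-matrix) eq)))
  ι∉ : ∀ x → ι x ∉ ⁅ 0F ⁆
  ι∉ x = ι≢0 x ∘ x∈⁅y⁆⇒x≡y 0F
  Mi : Minor C (rows AG-matrix) ι ⁅ 0F ⁆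
  Mi = cone AG-matrix 0F refl (λ { 0F → refl ; 1F → refl ; 2F → refl ; 3F → refl }) ι≢0 (proj₂ Re)
  split = splitOff (proj₁ Re) ι∉

-- Rank and corank at least six

pivoted? : (a b : Vec Bool k) → Dec (Pivoted a b)
pivoted? a b = Fin.any? λ p → Fin.any? λ q →
  (a ! p Bool.≟ true) ×-dec (a ! q Bool.≟ false) ×-dec (b ! p Bool.≟ false) ×-dec (b ! q Bool.≟ true)

orth? : (A : Fin m → Vec Bool r) (x : Vec Bool r) (y : Vec Bool m) → Dec (Orth A x y)
orth? A x y = Fin.all? (λ i → x ! i ∧ comb y A ! i Bool.≟ false) ×-dec Fin.all? (λ j → y ! j ∧ x ∙ A j Bool.≟ false)

badMatrix? : (A : Fin m → Vec Bool r) → Dec (BadMatrix A)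
badMatrix? A = anySubset? λ y → anySubset? λ y′ → pivoted? y y′ ×-dec
  anySubset? λ x → anySubset? λ x′ → pivoted? x x′ ×-dec
    ((orth? A x y ×-dec orth? A x y′) ×-dec (orth? A x′ y ×-dec orth? A x′ y′))

badMatrix-rows : (A : Fin m → Vec Bool r) {ρ : Fin k → Fin r} → Injective ρ →
                 BadMatrix (pull ρ ∘ A) → BadMatrix A
badMatrix-rows A {ρ} inj (y , y′ , yy′ , x , x′ , (p , q , xp , xq , x′p , x′q) , (o₁ , o₂) , (o₃ , o₄)) =
  y , y′ , yy′ , push ρ x , push ρ x′ ,
  (ρ p , ρ q , trans (push-ι inj x p) xp , trans (push-ι inj x q) xq , trans (push-ι inj x′ p) x′p , trans (push-ι inj x′ q) x′q) ,
  (up {x} {y} o₁ , up {x} {y′} o₂) , (up {x′} {y} o₃ , up {x′} {y′} o₄)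
  where
  up : ∀ {x y} → Orth (pull ρ ∘ A) x y → Orth A (push ρ x) y
  up {x} {y} (r₁ , r₂) = rows′ , λ j → trans (cong (y ! j ∧_) (push-∙ ρ x (A j))) (r₂ j)
    where
    rows′ : ∀ i → push ρ x ! i ∧ comb y A ! i ≡ false
    rows′ i with Fin.any? (λ k → ρ k Fin.≟ i)
    ... | no ¬p = cong (_∧ comb y A ! i) (push-out ρ x ¬p)
    ... | yes (k , refl) = trans (cong₂ _∧_ (push-ι inj x k) (trans (comb! y A (ρ k))
          (trans (cong (y ∙_) (tabulate-cong λ j → sym (pull! ρ (A j) k))) (sym (comb! y (pull ρ ∘ A) k))))) (r₁ k)

BadMatrix-≗ : {A B : Fin m → Vec Bool r} → (∀ j → A j ≡ B j) → BadMatrix A → BadMatrix B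
BadMatrix-≗ {A = A} {B} eq (y , y′ , yy′ , x , x′ , xx′ , (o₁ , o₂) , (o₃ , o₄)) =
  y , y′ , yy′ , x , x′ , xx′ , (up {x} {y} o₁ , up {x} {y′} o₂) , (up {x′} {y} o₃ , up {x′} {y′} o₄)
  where
  up : ∀ {x y} → Orth A x y → Orth B x y
  up {x} {y} (r₁ , r₂) =
    (λ i → trans (cong (x ! i ∧_) (trans (comb! y B i)
       (trans (cong (y ∙_) (tabulate-cong λ j → cong (_! i) (sym (eq j)))) (sym (comb! y A i))))) (r₁ i)) ,
    (λ j → trans (cong (λ v → y ! j ∧ x ∙ v) (sym (eq j))) (r₂ j))

abstract
  -- Two rows vanish on both columns; their unit vectors span the second plane and the two columns
  -- give the first.
  badTwo : (u : Vec Bool 3) → ¬ 2 ≤ ∣ u ∣ → BadMatrix (lookup (⊥ ∷ u ∷ []))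
  badTwo = toWitness {a? = allSubsets? λ u → ¬? (2 ≤? ∣ u ∣) →-dec badMatrix? (lookup (⊥ ∷ u ∷ []))} _

  -- The zero column and the sum of the two equal columns give words that vanish on the three rows;
  -- the second plane consists of vectors orthogonal to `u`.
  badThree : (u : Vec Bool 3) → BadMatrix (lookup (⊥ ∷ u ∷ u ∷ []))
  badThree = toWitness {a? = allSubsets? λ u → badMatrix? (lookup (⊥ ∷ u ∷ u ∷ []))} _

-- Numbers the four vectors with at most one zero. The default value belongs to 011 and also catches
-- the sparse vectors, to which the index is never applied.
denseIndex : Vec Bool 3 → Fin 4
denseIndex (true  ∷ true  ∷ true  ∷ []) = 0F
denseIndex (true  ∷ true  ∷ false ∷ []) = 1F
denseIndex (true  ∷ false ∷ true  ∷ []) = 2F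
denseIndex _                            = 3F

abstract
  denseIndex-injective : (u v : Vec Bool 3) → 2 ≤ ∣ u ∣ → 2 ≤ ∣ v ∣ → denseIndex u ≡ denseIndex v → u ≡ v
  denseIndex-injective = toWitness {a? = allSubsets? λ u → allSubsets? λ v → (2 ≤? ∣ u ∣) →-dec (2 ≤? ∣ v ∣) →-dec
    (denseIndex u Fin.≟ denseIndex v) →-dec u ≟ᵥ v} _

distinct₂ : {a b : Fin s} → a ≢ b → Injective (lookup (a ∷ b ∷ []))
distinct₂ a≢b {0F} {0F} _  = refl
distinct₂ a≢b {0F} {1F} eq = contradiction eq a≢b
distinct₂ a≢b {1F} {0F} eq = contradiction (sym eq) a≢b
distinct₂ a≢b {1F} {1F} _  = refl

distinct₃ : {a b c : Fin s} → a ≢ b → a ≢ c → b ≢ c → Injective (lookup (a ∷ b ∷ c ∷ []))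
distinct₃ a≢b a≢c b≢c {0F} {0F} _  = refl
distinct₃ a≢b a≢c b≢c {0F} {1F} eq = contradiction eq a≢b
distinct₃ a≢b a≢c b≢c {0F} {2F} eq = contradiction eq a≢c
distinct₃ a≢b a≢c b≢c {1F} {0F} eq = contradiction (sym eq) a≢b
distinct₃ a≢b a≢c b≢c {1F} {1F} _  = refl
distinct₃ a≢b a≢c b≢c {1F} {2F} eq = contradiction eq b≢c
distinct₃ a≢b a≢c b≢c {2F} {0F} eq = contradiction (sym eq) a≢c
distinct₃ a≢b a≢c b≢c {2F} {1F} eq = contradiction (sym eq) b≢c
distinct₃ a≢b a≢c b≢c {2F} {2F} _  = refl

module _ {C : Code n} (F : Frame C r s) (¬bad : ¬ Bad C) where

  open Frame F

  ¬badMatrix : (κ : Fin m → Fin s) → Injective κ → ¬ BadMatrix (A ∘ κ)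
  ¬badMatrix κ inj = ¬bad ∘ badMatrix⇒bad F (e ∘ κ) (inj ∘ e-injective) (λ i j → b≢e i (κ j))

  module _ {ρ : Fin 3 → Fin r} (ρ-injective : Injective ρ) {j₀ : Fin s} (zero₀ : pull ρ (A j₀) ≡ ⊥) where

    dense : ∀ {j} → j ≢ j₀ → 2 ≤ ∣ pull ρ (A j) ∣
    dense {j} j≢ = decidable-stable (2 ≤? _) λ ¬2≤ →
      ¬badMatrix (lookup (j₀ ∷ j ∷ [])) (distinct₂ (j≢ ∘ sym))
        (badMatrix-rows _ ρ-injective (BadMatrix-≗ (λ { 0F → sym zero₀ ; 1F → refl }) (badTwo _ ¬2≤)))

    distinct : ∀ {j k} → j ≢ j₀ → k ≢ j₀ → j ≢ k → pull ρ (A j) ≢ pull ρ (A k)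
    distinct {j} {k} j≢ k≢ j≢k eq =
      ¬badMatrix (lookup (j₀ ∷ j ∷ k ∷ [])) (distinct₃ (j≢ ∘ sym) (k≢ ∘ sym) j≢k)
        (badMatrix-rows _ ρ-injective (BadMatrix-≗ (λ { 0F → sym zero₀ ; 1F → refl ; 2F → eq }) (badThree _)))

-- Six columns would leave five besides `j₀` for the four values of `denseIndex`.
threeZeros : {C : Code n} (F : Frame C r s) → ¬ Bad C → {ρ : Fin 3 → Fin r} → Injective ρ → ∀ {j₀} →
             pull ρ (Frame.A F j₀) ≡ ⊥ → s ≤ 5
threeZeros {s = suc s} F ¬bad {ρ} ρ-inj {j₀} zero₀ = ℕ.≮⇒≥ λ { (s≤s 5≤s) → clash 5≤s }
  where
  open Frame F
  clash : ¬ 5 ≤ s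
  clash 5≤s = collision (Fin.pigeonhole (ℕ.n<1+n 4) (λ k → denseIndex (pull ρ (A (κ k)))))
    where
    κ : Fin 5 → Fin (suc s)
    κ k = Fin.punchIn j₀ (Fin.inject≤ k 5≤s)
    κ≢ : ∀ k → κ k ≢ j₀
    κ≢ k = Fin.punchInᵢ≢i j₀ _
    κ-injective : Injective κ
    κ-injective {k} {l} eq = Fin.inject≤-injective 5≤s 5≤s k l (Fin.punchIn-injective j₀ _ _ eq)
    collision : ¬ ∃₂ λ k l → k Fin.< l × denseIndex (pull ρ (A (κ k))) ≡ denseIndex (pull ρ (A (κ l)))
    collision (k , l , k<l , eq) = distinct F ¬bad ρ-inj zero₀ (κ≢ k) (κ≢ l) (Fin.<⇒≢ k<l ∘ κ-injective)
      (denseIndex-injective _ _ (dense F ¬bad ρ-inj zero₀ (κ≢ k)) (dense F ¬bad ρ-inj zero₀ (κ≢ l)) eq)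

-- Row `i` is to be the pivot row. Pivoting there in one column adds its entries to the other
-- column, and the sum is zero in the three further rows where the two agree.
FourAgree : Vec Bool k → Vec Bool k → Set
FourAgree u v = ∃₂ λ i i₁ → ∃₂ λ i₂ i₃ → (i ≢ i₁ × i ≢ i₂ × i ≢ i₃) × (i₁ ≢ i₂ × i₁ ≢ i₃ × i₂ ≢ i₃) ×
  (u ! i ≡ true × v ! i ≡ true) × (u ! i₁ ≡ v ! i₁ × u ! i₂ ≡ v ! i₂ × u ! i₃ ≡ v ! i₃)

ThreeZero : Vec Bool k → Set
ThreeZero u = ∃₂ λ i₁ i₂ → ∃ λ i₃ → (i₁ ≢ i₂ × i₁ ≢ i₃ × i₂ ≢ i₃) ×
  (u ! i₁ ≡ false × u ! i₂ ≡ false × u ! i₃ ≡ false)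

_≢?_ : (i j : Fin k) → Dec (i ≢ j)
i ≢? j = ¬? (i Fin.≟ j)

-- Each condition is tested as soon as its indices are chosen, which keeps the search short; `map′`
-- restores the order of the definition.
fourAgree? : (u v : Vec Bool k) → Dec (FourAgree u v)
fourAgree? u v = map′
  (λ (i , (p , q) , i₁ , i≢i₁ , e₁ , i₂ , (i≢i₂ , i₁≢i₂) , e₂ , i₃ , (i≢i₃ , i₁≢i₃ , i₂≢i₃) , e₃) →
     i , i₁ , i₂ , i₃ , (i≢i₁ , i≢i₂ , i≢i₃) , (i₁≢i₂ , i₁≢i₃ , i₂≢i₃) , (p , q) , (e₁ , e₂ , e₃))
  (λ (i , i₁ , i₂ , i₃ , (i≢i₁ , i≢i₂ , i≢i₃) , (i₁≢i₂ , i₁≢i₃ , i₂≢i₃) , (p , q) , (e₁ , e₂ , e₃)) →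
     i , (p , q) , i₁ , i≢i₁ , e₁ , i₂ , (i≢i₂ , i₁≢i₂) , e₂ , i₃ , (i≢i₃ , i₁≢i₃ , i₂≢i₃) , e₃)
  (Fin.any? λ i → ((u ! i Bool.≟ true) ×-dec (v ! i Bool.≟ true)) ×-dec
   Fin.any? λ i₁ → i ≢? i₁ ×-dec (u ! i₁ Bool.≟ v ! i₁) ×-dec
   Fin.any? λ i₂ → (i ≢? i₂ ×-dec i₁ ≢? i₂) ×-dec (u ! i₂ Bool.≟ v ! i₂) ×-dec
   Fin.any? λ i₃ → (i ≢? i₃ ×-dec i₁ ≢? i₃ ×-dec i₂ ≢? i₃) ×-dec (u ! i₃ Bool.≟ v ! i₃))

threeZero? : (u : Vec Bool k) → Dec (ThreeZero u)
threeZero? u = map′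
  (λ (i₁ , z₁ , i₂ , i₁≢i₂ , z₂ , i₃ , (i₁≢i₃ , i₂≢i₃) , z₃) → i₁ , i₂ , i₃ , (i₁≢i₂ , i₁≢i₃ , i₂≢i₃) , (z₁ , z₂ , z₃))
  (λ (i₁ , i₂ , i₃ , (i₁≢i₂ , i₁≢i₃ , i₂≢i₃) , (z₁ , z₂ , z₃)) → i₁ , z₁ , i₂ , i₁≢i₂ , z₂ , i₃ , (i₁≢i₃ , i₂≢i₃) , z₃)
  (Fin.any? λ i₁ → (u ! i₁ Bool.≟ false) ×-dec
   Fin.any? λ i₂ → i₁ ≢? i₂ ×-dec (u ! i₂ Bool.≟ false) ×-dec
   Fin.any? λ i₃ → (i₁ ≢? i₃ ×-dec i₂ ≢? i₃) ×-dec (u ! i₃ Bool.≟ false))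

abstract
  heavyOrThreeZero : (u : Vec Bool 6) → 4 ≤ ∣ u ∣ ⊎ ThreeZero u
  heavyOrThreeZero = toWitness {a? = allSubsets? λ u → (4 ≤? ∣ u ∣) ⊎-dec threeZero? u} _

  -- The vectors agree in at least four rows, and two sets of at least four rows out of six share
  -- one, which serves as the pivot row.
  close⇒fourAgree : (u v : Vec Bool 6) → 4 ≤ ∣ u ∣ → 4 ≤ ∣ v ∣ → ∣ u ⊕ᵥ v ∣ ≤ 2 → FourAgree u v
  close⇒fourAgree = toWitness {a? = allSubsets? λ u → allSubsets? λ v → (4 ≤? ∣ u ∣) →-dec (4 ≤? ∣ v ∣) →-dec
    (∣ u ⊕ᵥ v ∣ ≤? 2) →-dec fourAgree? u v} _

  -- The complements of pairwise distant heavy vectors are disjoint sets of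
  -- size one or two, and at most one of them is a singleton.
  fourHeavy : (u₀ : Vec Bool 6) → 4 ≤ ∣ u₀ ∣ → (u₁ : Vec Bool 6) → 4 ≤ ∣ u₁ ∣ → ¬ ∣ u₀ ⊕ᵥ u₁ ∣ ≤ 2 →
              (u₂ : Vec Bool 6) → 4 ≤ ∣ u₂ ∣ → ¬ ∣ u₀ ⊕ᵥ u₂ ∣ ≤ 2 → ¬ ∣ u₁ ⊕ᵥ u₂ ∣ ≤ 2 →
              (u₃ : Vec Bool 6) → 4 ≤ ∣ u₃ ∣ →
              ∣ u₀ ⊕ᵥ u₃ ∣ ≤ 2 ⊎ ∣ u₁ ⊕ᵥ u₃ ∣ ≤ 2 ⊎ ∣ u₂ ⊕ᵥ u₃ ∣ ≤ 2
  fourHeavy = toWitness {a? =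
    allSubsets? λ u₀ → (4 ≤? ∣ u₀ ∣) →-dec
    allSubsets? λ u₁ → (4 ≤? ∣ u₁ ∣) →-dec ¬? (∣ u₀ ⊕ᵥ u₁ ∣ ≤? 2) →-dec
    allSubsets? λ u₂ → (4 ≤? ∣ u₂ ∣) →-dec ¬? (∣ u₀ ⊕ᵥ u₂ ∣ ≤? 2) →-dec ¬? (∣ u₁ ⊕ᵥ u₂ ∣ ≤? 2) →-dec
    allSubsets? λ u₃ → (4 ≤? ∣ u₃ ∣) →-dec
      ((∣ u₀ ⊕ᵥ u₃ ∣ ≤? 2) ⊎-dec (∣ u₁ ⊕ᵥ u₃ ∣ ≤? 2) ⊎-dec (∣ u₂ ⊕ᵥ u₃ ∣ ≤? 2))} _

closePair : (u : Fin 4 → Vec Bool 6) → (∀ k → 4 ≤ ∣ u k ∣) → ∃₂ λ k l → k ≢ l × ∣ u k ⊕ᵥ u l ∣ ≤ 2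
closePair u heavy with ∣ u 0F ⊕ᵥ u 1F ∣ ≤? 2 | ∣ u 0F ⊕ᵥ u 2F ∣ ≤? 2 | ∣ u 1F ⊕ᵥ u 2F ∣ ≤? 2
... | yes p | _     | _     = 0F , 1F , (λ ()) , p
... | no _  | yes p | _     = 0F , 2F , (λ ()) , p
... | no _  | no _  | yes p = 1F , 2F , (λ ()) , p
... | no p  | no q  | no t
  with fourHeavy (u 0F) (heavy 0F) (u 1F) (heavy 1F) p (u 2F) (heavy 2F) q t (u 3F) (heavy 3F)
... | inj₁ w        = 0F , 3F , (λ ()) , w
... | inj₂ (inj₁ w) = 1F , 3F , (λ ()) , w
... | inj₂ (inj₂ w) = 2F , 3F , (λ ()) , w

¬rank,corank≥6 : {C : Code n} → Frame C r s → ¬ Bad C → 6 ≤ r → ¬ 6 ≤ s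
¬rank,corank≥6 {r = r} {s} {C = C} F ¬bad 6≤r 6≤s = pair (closePair u heavy)
  where
  open Frame F
  ρ : Fin 6 → Fin r
  ρ i = Fin.inject≤ i 6≤r
  ρ-inj : Injective ρ
  ρ-inj = Fin.inject≤-injective 6≤r 6≤r _ _
  κ : Fin 4 → Fin s
  κ k = Fin.inject≤ k (ℕ.≤-trans (ℕ.m≤m+n 4 2) 6≤s)
  u : Fin 4 → Vec Bool 6
  u k = pull ρ (A (κ k))
  ρ₃-inj : ∀ {i₁ i₂ i₃} → i₁ ≢ i₂ × i₁ ≢ i₃ × i₂ ≢ i₃ → Injective (ρ ∘ lookup (i₁ ∷ i₂ ∷ i₃ ∷ []))
  ρ₃-inj (p , q , t) {x} {y} eq = distinct₃ p q t {x} {y} (ρ-inj eq)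
  heavy : ∀ k → 4 ≤ ∣ u k ∣
  heavy k with heavyOrThreeZero (u k)
  ... | inj₁ h = h
  ... | inj₂ (i₁ , i₂ , i₃ , dist , z₁ , z₂ , z₃) = contradiction
        (threeZeros F ¬bad {ρ ∘ lookup (i₁ ∷ i₂ ∷ i₃ ∷ [])} (ρ₃-inj dist) {κ k}
          (vec-ext λ { 0F → trans (sym (pull! ρ (A (κ k)) i₁)) z₁
                     ; 1F → trans (sym (pull! ρ (A (κ k)) i₂)) z₂
                     ; 2F → trans (sym (pull! ρ (A (κ k)) i₃)) z₃ }))
        (ℕ.<⇒≱ 6≤s)
  pair : ¬ ∃₂ λ k l → k ≢ l × ∣ u k ⊕ᵥ u l ∣ ≤ 2
  pair (k , l , k≢l , close) with close⇒fourAgree (u k) (u l) (heavy k) (heavy l) close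
  ... | i , i₁ , i₂ , i₃ , (i≢i₁ , i≢i₂ , i≢i₃) , dist , (uki , uli) , e₁ , e₂ , e₃ = ℕ.<⇒≱ 6≤s
        (threeZeros F′ ¬bad {ρ ∘ lookup (i₁ ∷ i₂ ∷ i₃ ∷ [])} (ρ₃-inj dist) {κ l}
          (vec-ext λ { 0F → new i≢i₁ e₁ ; 1F → new i≢i₂ e₂ ; 2F → new i≢i₃ e₃ }))
    where
    u! : ∀ k i → u k ! i ≡ d (ρ i) ! e (κ k)
    u! k i = trans (pull! ρ (A (κ k)) i) (col! (e (κ k)) (ρ i))
    pivot : d (ρ i) ! e (κ k) ≡ true
    pivot = trans (sym (u! k i)) uki
    F′ : Frame C r s
    F′ = pivotFrame F (ρ i) (κ k) pivot
    κl≢κk : κ l ≢ κ k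
    κl≢κk eq = k≢l (sym (Fin.inject≤-injective _ _ l k eq))
    new : ∀ {i′} → i ≢ i′ → u k ! i′ ≡ u l ! i′ → Frame.A F′ (κ l) ! ρ i′ ≡ false
    new {i′} i≢i′ eq = trans (Frame.col! F′ _ (ρ i′)) (trans (cong (Frame.d F′ (ρ i′) !_) (e′-≢ F (ρ i) (κ k) pivot κl≢κk))
      (trans (d′-≢ F (ρ i) (κ k) pivot (i≢i′ ∘ sym ∘ ρ-inj) (e (κ l)))
      (trans (cong₂ (λ a c → a xor (d (ρ i′) ! e (κ k) ∧ c)) 
        (trans (sym (u! l i′)) (trans (sym eq) (u! k i′))) (trans (sym (u! l i)) uli))
      (trans (cong (d (ρ i′) ! e (κ k) xor_) (Bool.∧-identityʳ _)) (Bool.xor-same (d (ρ i′) ! e (κ k)))))))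

-- Rank five

P₁₀-matrix : Matrix₂ 5 10
P₁₀-matrix =
    (I ∷ O ∷ O ∷ O ∷ O ∷ I ∷ O ∷ O ∷ I ∷ I ∷ [])
  ∷ (O ∷ I ∷ O ∷ O ∷ O ∷ I ∷ I ∷ O ∷ O ∷ I ∷ [])
  ∷ (O ∷ O ∷ I ∷ O ∷ O ∷ O ∷ I ∷ I ∷ O ∷ I ∷ [])
  ∷ (O ∷ O ∷ O ∷ I ∷ O ∷ O ∷ O ∷ I ∷ I ∷ O ∷ [])
  ∷ (O ∷ O ∷ O ∷ O ∷ I ∷ I ∷ I ∷ I ∷ O ∷ O ∷ [])
  ∷ []
  where
  I = true
  O = false

IsColumn : Vec (Vec Bool n) k → Vec Bool k → Set
IsColumn W v = ∃ λ y → column W y ≡ v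

isColumn? : (W : Vec (Vec Bool n) k) (v : Vec Bool k) → Dec (IsColumn W v)
isColumn? W v = Fin.any? λ y → column W y ≟ᵥ v

types : Fin 4 → Vec Bool 3
types = lookup ((true ∷ true ∷ true ∷ []) ∷ (true ∷ true ∷ false ∷ []) ∷ (true ∷ false ∷ true ∷ []) ∷ (false ∷ true ∷ true ∷ []) ∷ [])

-- The first two basis elements and the first column form a triangle; modulo
-- that triangle the other columns are determined by ¬ Bad.
triangleColumns : (p q : Vec Bool 4) → Fin 5 → Vec Bool 5
triangleColumns p q zero    = true ∷ true ∷ false ∷ false ∷ false ∷ []
triangleColumns p q (suc k) = p ! k ∷ q ! k ∷ types k

Odd : Vec Bool k → Set
Odd u = ⊤ ∙ u ≡ true

odd? : (u : Vec Bool k) → Dec (Odd u)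
odd? u = ⊤ ∙ u Bool.≟ true

row : (Fin s → Vec Bool r) → Fin r → Vec Bool s
row A i = tabulate (λ j → A j ! i)

-- A row with a single one, or the sum of two equal rows, gives a dual word of weight two, that is,
-- a series pair.
LightRow : (Fin s → Vec Bool r) → Set
LightRow A = ∃ λ i → (∃ λ j → row A i ≡ ⁅ j ⁆) ⊎ (∃ λ i′ → i ≢ i′ × row A i ≡ row A i′)

lightRow? : (A : Fin s → Vec Bool r) → Dec (LightRow A)
lightRow? A = Fin.any? λ i → (Fin.any? λ j → row A i ≟ᵥ ⁅ j ⁆) ⊎-dec (Fin.any? λ i′ → i ≢? i′ ×-dec row A i ≟ᵥ row A i′)

-- The planes missing the line spanned by the first two coordinates are the
-- graphs of the linear maps from the last three coordinates to that line.
BadGraph : (Fin m → Vec Bool 5) → Set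
BadGraph A = ∃ λ y → (comb y A ! 0F ≡ false × comb y A ! 1F ≡ false) × ∃ λ y′ → (comb y′ A ! 0F ≡ false × comb y′ A ! 1F ≡ false) ×
  Pivoted y y′ × (∃ λ h → Orth A (true ∷ false ∷ h) y × Orth A (true ∷ false ∷ h) y′) ×
                 (∃ λ h → Orth A (false ∷ true ∷ h) y × Orth A (false ∷ true ∷ h) y′)

badGraph? : (A : Fin m → Vec Bool 5) → Dec (BadGraph A)
badGraph? A = anySubset? λ y → ((comb y A ! 0F Bool.≟ false) ×-dec (comb y A ! 1F Bool.≟ false)) ×-dec
  anySubset? λ y′ → ((comb y′ A ! 0F Bool.≟ false) ×-dec (comb y′ A ! 1F Bool.≟ false)) ×-dec pivoted? y y′ ×-dec
  (anySubset? λ h → orth? A (true ∷ false ∷ h) y ×-dec orth? A (true ∷ false ∷ h) y′) ×-dec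
  (anySubset? λ h → orth? A (false ∷ true ∷ h) y ×-dec orth? A (false ∷ true ∷ h) y′)

badGraph⇒badMatrix : {A : Fin m → Vec Bool 5} → BadGraph A → BadMatrix A
badGraph⇒badMatrix (y , _ , y′ , _ , yy′ , (h , o₁ , o₂) , (h′ , o₃ , o₄)) =
  y , y′ , yy′ , true ∷ false ∷ h , false ∷ true ∷ h′ , (0F , 1F , refl , refl , refl , refl) , (o₁ , o₂) , (o₃ , o₄)

-- The columns 1, 4, 9 of P₁₀ form a triangle; by the symmetry of P₁₀ a few
-- choices for the images of the remaining basis elements suffice.
candidate : Fin 6 → Fin 7 → Vec (Vec Bool 5) 5
candidate i j = Vec.map (column P₁₀-matrix) (pairs ! i Vec.++ triples ! j)
  where
  c₁ c₂ c₃ c₄ c₅ c₆ c₇ c₈ c₉ : Fin 10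
  c₁ = Fin.# 0
  c₂ = Fin.# 1
  c₃ = Fin.# 2
  c₄ = Fin.# 3
  c₅ = Fin.# 4
  c₆ = Fin.# 5
  c₇ = Fin.# 6
  c₈ = Fin.# 7
  c₉ = Fin.# 8
  pairs : Vec (Vec (Fin 10) 2) 6
  pairs = (c₁ ∷ c₄ ∷ []) ∷ (c₄ ∷ c₁ ∷ []) ∷ (c₁ ∷ c₉ ∷ []) ∷ (c₉ ∷ c₁ ∷ []) ∷ (c₄ ∷ c₉ ∷ []) ∷ (c₉ ∷ c₄ ∷ []) ∷ []
  triples : Vec (Vec (Fin 10) 3) 7
  triples = (c₂ ∷ c₃ ∷ c₅ ∷ []) ∷ (c₂ ∷ c₃ ∷ c₇ ∷ []) ∷ (c₂ ∷ c₇ ∷ c₃ ∷ []) ∷ (c₂ ∷ c₃ ∷ c₆ ∷ []) ∷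
            (c₂ ∷ c₃ ∷ c₈ ∷ []) ∷ (c₂ ∷ c₈ ∷ c₃ ∷ []) ∷ (c₈ ∷ c₂ ∷ c₃ ∷ []) ∷ []

EmbedsBy : (Fin s → Vec Bool r) → Vec (Vec Bool n) k → Vec (Vec Bool k) r → Set
EmbedsBy A W t = (∀ j → IsColumn W (comb (A j) (lookup t))) × (∀ i → IsColumn W (t ! i)) ×
  (∀ x → comb x (lookup t) ≡ ⊥ → x ≡ ⊥)

embedsBy? : (A : Fin s → Vec Bool r) (W : Vec (Vec Bool n) k) (t : Vec (Vec Bool k) r) → Dec (EmbedsBy A W t)
embedsBy? A W t = Fin.all? (λ j → isColumn? W (comb (A j) (lookup t))) ×-dec Fin.all? (λ i → isColumn? W (t ! i)) ×-dec
  allSubsets? (λ x → (comb x (lookup t) ≟ᵥ ⊥) →-dec x ≟ᵥ ⊥)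

-- Odd rows make the dual affine, because the rows of the matrix are the columns of its transpose.
-- Light rows and bad graphs lead to contradictions.
data TriangleCase (p q : Vec Bool 4) : Set where
  oddRows  : (∀ i → Odd (row (triangleColumns p q) i)) → TriangleCase p q
  lightRow : LightRow (triangleColumns p q) → TriangleCase p q
  badGraph : BadGraph (triangleColumns p q ∘ suc) → TriangleCase p q
  embedded : ∀ i j → EmbedsBy (triangleColumns p q) P₁₀-matrix (candidate i j) → TriangleCase p q

triangleCase? : ∀ p q → Dec (TriangleCase p q)
triangleCase? p q = map′
  [ oddRows , [ lightRow , [ badGraph , (λ (i , j , emb) → embedded i j emb) ]′ ]′ ]′
  (λ { (oddRows x) → inj₁ x ; (lightRow x) → inj₂ (inj₁ x) ; (badGraph x) → inj₂ (inj₂ (inj₁ x))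
     ; (embedded i j emb) → inj₂ (inj₂ (inj₂ (i , j , emb))) })
  (Fin.all? (λ i → odd? (row (triangleColumns p q) i)) ⊎-dec lightRow? (triangleColumns p q) ⊎-dec
    badGraph? (triangleColumns p q ∘ suc) ⊎-dec
    Fin.any? λ i → Fin.any? λ j → embedsBy? (triangleColumns p q) P₁₀-matrix (candidate i j))

abstract
  triangleCase : ∀ p q → TriangleCase p q
  triangleCase = toWitness {a? = allSubsets? λ p → allSubsets? λ q → triangleCase? p q} _

module _ {C : Code n} (F : Frame C r s) where

  open Frame F

  col-b : ∀ i → col (b i) ≡ ⁅ i ⁆
  col-b i = vec-ext λ k → trans (col! (b i) k) (trans (d-b k i) (trans (δ-sym k i) (sym (⁅⁆! i k))))
    where
    δ-sym : ∀ {n} (i j : Fin n) → δ i j ≡ δ j i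
    δ-sym i j with i Fin.≟ j
    ... | yes refl = sym (δ-refl i)
    ... | no i≢j   = sym (δ-≢ (i≢j ∘ sym))

  comb-unit : ∀ i (t : Fin r → Vec Bool k) → comb ⁅ i ⁆ t ≡ t i
  comb-unit i t = vec-ext λ z → trans (comb! ⁅ i ⁆ t z) (trans (∙-⁅⁆ i _) (lookup∘tabulate _ i))

  embedsBy⇒⊴ : Simple C → {W : Vec (Vec Bool m) k} {t : Vec (Vec Bool k) r} → EmbedsBy A W t → C ⊴ rows W
  embedsBy⇒⊴ simple {W} {t} (cols , units , inj) = restrict F simple W (lookup t) inj λ x → at (cover x)
    where
    at : ∀ {x} → Image b x ⊎ Image e x → IsColumn W (comb (col x) (lookup t))
    at (inj₁ (i , refl)) = subst (λ v → IsColumn W (comb v (lookup t))) (sym (col-b i))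
      (subst (IsColumn W) (sym (comb-unit i (lookup t))) (units i))
    at (inj₂ (j , refl)) = cols j

  dual-A : ∀ i → Frame.A (dualFrame F) i ≡ row A i
  dual-A i = tabulate-cong λ j → trans (dual-word-b j i) (sym (col! (e j) i))

  permute-A : (ρ : Permutation k r) (κ : Permutation l s) →
              ∀ j → Frame.A (permuteFrame ρ κ F) j ≡ pull (ρ ⟨$⟩ʳ_) (A (κ ⟨$⟩ʳ j))
  permute-A ρ κ j = tabulate-cong λ i → sym (col! (e (κ ⟨$⟩ʳ j)) (ρ ⟨$⟩ʳ i))

lightRow⇒⊥ : {C : Code n} (F : Frame C r s) → Simple (C ᗮ) → ¬ LightRow (Frame.A F)
lightRow⇒⊥ F simple* (i , inj₁ (j , eq)) = Frame.b≢e F i j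
  (col-injective (dualFrame F) simple* (trans (dual-A F i) (trans eq (sym (col-b (dualFrame F) j)))))
lightRow⇒⊥ F simple* (i , inj₂ (i′ , i≢i′ , eq)) = i≢i′ (Frame.b-injective F
  (col-injective (dualFrame F) simple* (trans (dual-A F i) (trans eq (sym (dual-A F i′))))))

-- A change of basis that makes the first coordinate the parity of a vector, so odd vectors become
-- points of AG(4,2).
parityImage : Vec (Vec Bool 5) 5
parityImage = (true ∷ ⊥) ∷ (true ∷ ⁅ 0F ⁆) ∷ (true ∷ ⁅ 1F ⁆) ∷ (true ∷ ⁅ 2F ⁆) ∷ (true ∷ ⁅ 3F ⁆) ∷ []

abstract
  parityImage-injective : ∀ x → comb x (lookup parityImage) ≡ ⊥ → x ≡ ⊥
  parityImage-injective = toWitness {a? = allSubsets? λ x → (comb x (lookup parityImage) ≟ᵥ ⊥) →-dec x ≟ᵥ ⊥} _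

  parityImage-odd : ∀ x → Odd x → comb x (lookup parityImage) ! 0F ≡ true
  parityImage-odd = toWitness {a? = allSubsets? λ x → odd? x →-dec (comb x (lookup parityImage) ! 0F Bool.≟ true)} _

affine⇒⊴AG : {C : Code n} (F : Frame C 5 s) → Simple C → (∀ j → Odd (Frame.A F j)) → C ⊴ rows AG-matrix
affine⇒⊴AG F simple odd = restrict F simple AG-matrix (lookup parityImage) parityImage-injective
  λ x → AG-column (comb (col x) (lookup parityImage)) (parityImage-odd (col x) (at (cover x)))
  where
  open Frame F
  at : ∀ {x} → Image b x ⊎ Image e x → Odd (col x)
  at (inj₁ (i , refl)) = trans (cong (⊤ ∙_) (col-b F i)) (trans (∙-comm ⊤ ⁅ i ⁆) (trans (∙-⁅⁆ i ⊤) (lookup-replicate i true)))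
  at (inj₂ (j , refl)) = odd j

-- Rank five with a triangle

triple : Fin n → Fin n → Fin n → Vec Bool n
triple x y z = ⁅ x ⁆ ⊕ᵥ (⁅ y ⁆ ⊕ᵥ ⁅ z ⁆)

-- If `z` were `x` or `y`, the triple would collapse to a unit vector, which `Simple` rules out.
Triangle : Code n → Set
Triangle C = ∃₂ λ x y → ∃ λ z → x ≢ y × C ∋ triple x y z

triangle? : (C : Code n) → Dec (Triangle C)
triangle? C = Fin.any? λ x → Fin.any? λ y → Fin.any? λ z → x ≢? y ×-dec mem? C (triple x y z)

module _ {C : Code n} (F : Frame C r s) where

  open Frame F

  private
    ∙-triple : ∀ x y z i → d i ∙ triple x y z ≡ d i ! x xor (d i ! y xor d i ! z)
    ∙-triple x y z i = trans (∙-⊕ʳ (d i) ⁅ x ⁆ (⁅ y ⁆ ⊕ᵥ ⁅ z ⁆)) (cong₂ _xor_ (unit x)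
      (trans (∙-⊕ʳ (d i) ⁅ y ⁆ ⁅ z ⁆) (cong₂ _xor_ (unit y) (unit z))))
      where
      unit : ∀ x → d i ∙ ⁅ x ⁆ ≡ d i ! x
      unit x = trans (∙-comm (d i) ⁅ x ⁆) (∙-⁅⁆ x (d i))

    col⊕! : ∀ x y i → (col x ⊕ᵥ col y) ! i ≡ d i ! x xor d i ! y
    col⊕! x y i = trans (⊕! (col x) (col y) i) (cong₂ _xor_ (col! x i) (col! y i))

  triangle⇒col : ∀ {x y z} → C ∋ triple x y z → col z ≡ col x ⊕ᵥ col y
  triangle⇒col {x} {y} {z} xyz = vec-ext λ i → trans (col! z i) (sym (trans (col⊕! x y i)
    (xor-≡ (trans (Bool.xor-assoc (d i ! x) (d i ! y) (d i ! z)) (trans (sym (∙-triple x y z i)) (d-sound xyz i))))))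

  col⇒triangle : ∀ {x y z} → x ≢ y → col x ⊕ᵥ col y ≡ col z → Triangle C
  col⇒triangle {x} {y} {z} x≢y eq = x , y , z , x≢y , d-complete λ i → trans (∙-triple x y z i)
    (trans (sym (Bool.xor-assoc (d i ! x) (d i ! y) (d i ! z))) (trans
      (cong (_xor d i ! z) (trans (sym (col⊕! x y i)) (trans (cong (_! i) eq) (col! z i)))) (Bool.xor-same (d i ! z))))

  -- A basic `x` is forced into position `i` by its entry there; otherwise one pivot suffices. The
  -- other positions are kept, so that two elements can be brought in one after the other.
  bring : ∀ x i → d i ! x ≡ true → ∃ λ (F′ : Frame C r s) → Frame.b F′ i ≡ x × (∀ {k} → k ≢ i → Frame.b F′ k ≡ b k)
  bring x i dx with cover x
  ... | inj₁ (k , refl) with δ-sound {i = i} {k} (trans (sym (d-b i k)) dx)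
  ... | refl = F , refl , λ _ → refl
  bring x i dx | inj₂ (j , refl) = pivotFrame F i j dx , b′-i₀ F i j dx , b′-≢ F i j dx

-- Bring `x` and then `y` into the basis; the third element is their sum. The second pivot needs a
-- row other than that of `x`: without one, `y` would be a loop or parallel to `x`.
triangleFrame : {C : Code n} (F : Frame C r s) → Simple C → Triangle C →
                ∃ λ (F′ : Frame C r s) → ∃₂ λ i i′ → ∃ λ j → i ≢ i′ × Frame.A F′ j ≡ ⁅ i ⁆ ⊕ᵥ ⁅ i′ ⁆
triangleFrame {C = C} F simple (x , y , z , x≢y , xyz) with ≢⊥⇒∃ (col≢⊥ F simple x)
... | i , colx!i with bring F x i (trans (sym (Frame.col! F x i)) colx!i)
... | F′ , refl , _ with Fin.any? (λ i′ → (i′ ≢? i) ×-dec (Frame.d F′ i′ ! y Bool.≟ true))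
... | no ¬w = contradiction (col≢⊥ F′ simple y) λ y≢⊥ → case (Frame.col F′ y ! i) refl y≢⊥
  where
  open Frame F′
  away : ∀ {k} → k ≢ i → col y ! k ≡ false
  away {k} k≢i = trans (col! y k) (≢true λ e → ¬w (k , k≢i , e))
  case : ∀ b → col y ! i ≡ b → ¬ col y ≢ ⊥
  case false yi y≢⊥ = y≢⊥ (vec-ext λ k → trans (at k (k Fin.≟ i)) (sym (⊥! k)))
    where
    at : ∀ k → Dec (k ≡ i) → col y ! k ≡ false
    at k (yes refl) = yi
    at k (no k≢i)   = away k≢i
  case true yi _ = x≢y (col-injective F′ simple (trans (col-b F′ i) (vec-ext λ k → at k (k Fin.≟ i))))
    where
    at : ∀ k → Dec (k ≡ i) → ⁅ i ⁆ ! k ≡ col y ! k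
    at k (yes refl) = trans (∈⇒! (x∈⁅x⁆ i)) (sym yi)
    at k (no k≢i)   = trans (∉⇒! (k≢i ∘ x∈⁅y⁆⇒x≡y i)) (sym (away k≢i))
... | yes (i′ , i′≢i , yi′) with bring F′ y i′ yi′
... | F″ , refl , same = F″ , i , i′ , j-of (cover z)
  where
  open Frame F″
  colz : col z ≡ ⁅ i ⁆ ⊕ᵥ ⁅ i′ ⁆
  colz = trans (triangle⇒col F″ xyz) (cong₂ _⊕ᵥ_
    (trans (cong col (sym (same (i′≢i ∘ sym)))) (col-b F″ i)) (col-b F″ i′))
  j-of : Image b z ⊎ Image e z → ∃ λ j → i ≢ i′ × A j ≡ ⁅ i ⁆ ⊕ᵥ ⁅ i′ ⁆
  j-of (inj₂ (j , refl)) = j , i′≢i ∘ sym , colz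
  j-of (inj₁ (k , refl)) = contradiction (trans (at i (cong₂ _xor_ (∈⇒! (x∈⁅x⁆ i)) (∉⇒! (i′≢i ∘ sym ∘ x∈⁅y⁆⇒x≡y i′))))
                                          (sym (at i′ (cong₂ _xor_ (∉⇒! (i′≢i ∘ x∈⁅y⁆⇒x≡y i)) (∈⇒! (x∈⁅x⁆ i′)))))) (i′≢i ∘ sym)
    where
    at : ∀ l → ⁅ i ⁆ ! l xor ⁅ i′ ⁆ ! l ≡ true → l ≡ k
    at l e = x∈⁅y⁆⇒x≡y k (!⇒∈ (trans (cong (_! l) (trans (sym (col-b F″ k)) colz)) (trans (⊕! ⁅ i ⁆ ⁅ i′ ⁆ l) e)))

abstract
  pairRows : Fin 5 → Fin 5 → Permutation 5 5
  -- The place of `i′` is first computed under the swap of `0F` and `i`; applying this swap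
  -- afterwards sends `1F` to `i′` and `0F` to `i`.
  pairRows i i′ = Perm.transpose 1F (Perm.transpose 0F i ⟨$⟩ʳ i′) Perm.∘ₚ Perm.transpose 0F i

  pairRows-correct : ∀ i i′ → i ≢ i′ → pull (pairRows i i′ ⟨$⟩ʳ_) (⁅ i ⁆ ⊕ᵥ ⁅ i′ ⁆) ≡ true ∷ true ∷ ⊥
  pairRows-correct = toWitness {a? = Fin.all? λ i → Fin.all? λ i′ → i ≢? i′ →-dec
    (pull (pairRows i i′ ⟨$⟩ʳ_) (⁅ i ⁆ ⊕ᵥ ⁅ i′ ⁆) ≟ᵥ (true ∷ true ∷ ⊥))} _

  swap-0 : Fin 5 → Permutation 5 5
  swap-0 = Perm.transpose 0F

  swap-0-correct : (j : Fin 5) → swap-0 j ⟨$⟩ʳ 0F ≡ j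
  swap-0-correct = toWitness {a? = Fin.all? λ j → (swap-0 j ⟨$⟩ʳ 0F) Fin.≟ j} _

  types-injective : ∀ i j → types i ≡ types j → i ≡ j
  types-injective = toWitness {a? = Fin.all? λ i → Fin.all? λ j → (types i ≟ᵥ types j) →-dec i Fin.≟ j} _

  dense⇒type : ∀ u → 2 ≤ ∣ u ∣ → ∃ λ i → types i ≡ u
  dense⇒type = toWitness {a? = allSubsets? λ u → (2 ≤? ∣ u ∣) →-dec Fin.any? λ i → types i ≟ᵥ u} _

  allTypes : ∀ u₀ → 2 ≤ ∣ u₀ ∣ → ∀ u₁ → 2 ≤ ∣ u₁ ∣ → u₀ ≢ u₁ → ∀ u₂ → 2 ≤ ∣ u₂ ∣ → u₀ ≢ u₂ → u₁ ≢ u₂ →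
             ∀ u₃ → 2 ≤ ∣ u₃ ∣ → u₀ ≢ u₃ → u₁ ≢ u₃ → u₂ ≢ u₃ →
             ∀ i → ∃ λ k → lookup (u₀ ∷ u₁ ∷ u₂ ∷ u₃ ∷ []) k ≡ types i
  allTypes = toWitness {a? =
    allSubsets? λ u₀ → (2 ≤? ∣ u₀ ∣) →-dec
    allSubsets? λ u₁ → (2 ≤? ∣ u₁ ∣) →-dec ¬? (u₀ ≟ᵥ u₁) →-dec
    allSubsets? λ u₂ → (2 ≤? ∣ u₂ ∣) →-dec ¬? (u₀ ≟ᵥ u₂) →-dec ¬? (u₁ ≟ᵥ u₂) →-dec
    allSubsets? λ u₃ → (2 ≤? ∣ u₃ ∣) →-dec ¬? (u₀ ≟ᵥ u₃) →-dec ¬? (u₁ ≟ᵥ u₃) →-dec ¬? (u₂ ≟ᵥ u₃) →-dec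
    Fin.all? λ i → Fin.any? λ k → lookup (u₀ ∷ u₁ ∷ u₂ ∷ u₃ ∷ []) k ≟ᵥ types i} _

sortTypes : (u : Fin 4 → Vec Bool 3) → (∀ k → 2 ≤ ∣ u k ∣) → (∀ {k l} → k ≢ l → u k ≢ u l) →
            ∃ λ (τ : Permutation 4 4) → ∀ i → u (τ ⟨$⟩ʳ i) ≡ types i
sortTypes u dense distinct = permutation τ τ⁻¹ left right , u-τ
  where
  find : ∀ i → ∃ λ k → lookup (u 0F ∷ u 1F ∷ u 2F ∷ u 3F ∷ []) k ≡ types i
  find = allTypes (u 0F) (dense 0F) (u 1F) (dense 1F) (distinct λ ()) (u 2F) (dense 2F) (distinct λ ()) (distinct λ ())
                  (u 3F) (dense 3F) (distinct λ ()) (distinct λ ()) (distinct λ ())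
  τ : Fin 4 → Fin 4
  τ i = proj₁ (find i)
  u-τ : ∀ i → u (τ i) ≡ types i
  u-τ i = trans (same (τ i)) (proj₂ (find i))
    where
    same : ∀ k → u k ≡ lookup (u 0F ∷ u 1F ∷ u 2F ∷ u 3F ∷ []) k
    same 0F = refl
    same 1F = refl
    same 2F = refl
    same 3F = refl
  τ⁻¹ : Fin 4 → Fin 4
  τ⁻¹ k = proj₁ (dense⇒type (u k) (dense k))
  left : ∀ k → τ (τ⁻¹ k) ≡ k
  left k with τ (τ⁻¹ k) Fin.≟ k
  ... | yes eq = eq
  ... | no neq = contradiction (trans (u-τ (τ⁻¹ k)) (proj₂ (dense⇒type (u k) (dense k)))) (distinct neq)
  right : ∀ i → τ⁻¹ (τ i) ≡ i
  right i = types-injective _ _ (trans (proj₂ (dense⇒type (u (τ i)) (dense (τ i)))) (u-τ i))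

Z-matrix : Matrix₂ 5 ∣ ∁ ⁅ tip 5 ⁆ ∣
Z-matrix = Vec.map (pull (embed (∁ ⁅ tip 5 ⁆))) (spikeMatrix 5)

-- The bounds on `s` are used after dualizing a matroid of rank at least six: there `s` is that
-- rank, so the duals of P₁₀ and of Z₅ without its tip do not arise.
data RankFive (C : Code n) (s : ℕ) : Set where
  affine   : C ⊴ rows AG-matrix → RankFive C s
  coaffine : C ᗮ ⊴ rows AG-matrix → RankFive C s
  withinP₁₀ : s ≤ 5 → C ⊴ rows P₁₀-matrix → RankFive C s
  withinZ    : s ≤ 5 → C ⊴ rows Z-matrix → RankFive C s

EmbedsBy-≗ : {A B : Fin s → Vec Bool r} {W : Vec (Vec Bool n) k} {t : Vec (Vec Bool k) r} →
             (∀ j → A j ≡ B j) → EmbedsBy A W t → EmbedsBy B W t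
EmbedsBy-≗ {W = W} {t} eq (cols , rest) = (λ j → subst (λ v → IsColumn W (comb v (lookup t))) (eq j) (cols j)) , rest

lastThree : Fin 3 → Fin 5
lastThree k = suc (suc k)

lastThree-injective : Injective lastThree
lastThree-injective = Fin.suc-injective ∘ Fin.suc-injective

module _ {C : Code n} (simple : Simple C) (simple* : Simple (C ᗮ)) (¬bad : ¬ Bad C) where

  sortedTriangle⇒rankFive : (F : Frame C 5 5) (p q : Vec Bool 4) → (∀ j → Frame.A F j ≡ triangleColumns p q j) → RankFive C 5
  sortedTriangle⇒rankFive F p q eq = at (triangleCase p q)
    where
    row-eq : ∀ i → row (Frame.A F) i ≡ row (triangleColumns p q) i
    row-eq i = tabulate-cong λ j → cong (_! i) (eq j)
    light : LightRow (triangleColumns p q) → LightRow (Frame.A F)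
    light (i , inj₁ (j , r)) = i , inj₁ (j , trans (row-eq i) r)
    light (i , inj₂ (i′ , i≢ , r)) = i , inj₂ (i′ , i≢ , trans (row-eq i) (trans r (sym (row-eq i′))))
    at : TriangleCase p q → RankFive C 5
    at (oddRows odd) = coaffine (affine⇒⊴AG (dualFrame F) simple* λ i →
      subst Odd (sym (trans (dual-A F i) (row-eq i))) (odd i))
    at (lightRow lr) = contradiction (light lr) (lightRow⇒⊥ F simple*)
    at (badGraph bg) = contradiction
      (BadMatrix-≗ (λ k → sym (eq (suc k))) (badGraph⇒badMatrix bg)) (¬badMatrix F ¬bad suc Fin.suc-injective)
    at (embedded i j emb) = withinP₁₀ ℕ.≤-refl
      (embedsBy⇒⊴ F simple {P₁₀-matrix} {candidate i j} (EmbedsBy-≗ {W = P₁₀-matrix} {candidate i j} (sym ∘ eq) emb))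

  unsortedTriangle⇒rankFive : (F : Frame C 5 5) → Frame.A F 0F ≡ true ∷ true ∷ ⊥ → RankFive C 5
  unsortedTriangle⇒rankFive F A0 = sort (sortTypes (λ k → pull lastThree (Frame.A F (suc k)))
    (λ k → dense F ¬bad {lastThree} lastThree-injective {0F} zero₀ λ ())
    (λ k≢l → distinct F ¬bad {lastThree} lastThree-injective {0F} zero₀ (λ ()) (λ ()) (k≢l ∘ Fin.suc-injective)))
    where
    zero₀ : pull lastThree (Frame.A F 0F) ≡ ⊥
    zero₀ = cong (pull lastThree) A0
    sort : (∃ λ (τ : Permutation 4 4) → ∀ i → pull lastThree (Frame.A F (suc (τ ⟨$⟩ʳ i))) ≡ types i) → RankFive C 5
    sort (τ , sorted) = sortedTriangle⇒rankFive F₃ p q eq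
      where
      F₃ = permuteFrame Perm.id (Perm.lift₀ τ) F
      A₃ : ∀ j → Frame.A F₃ j ≡ Frame.A F (Perm.lift₀ τ ⟨$⟩ʳ j)
      A₃ j = trans (permute-A F Perm.id (Perm.lift₀ τ) j) (pull-id (λ _ → refl) (Frame.A F (Perm.lift₀ τ ⟨$⟩ʳ j)))
      p q : Vec Bool 4
      p = tabulate λ k → Frame.A F (suc (τ ⟨$⟩ʳ k)) ! 0F
      q = tabulate λ k → Frame.A F (suc (τ ⟨$⟩ʳ k)) ! 1F
      sortedColumn : ∀ k l → Frame.A F (suc (τ ⟨$⟩ʳ k)) ! l ≡ triangleColumns p q (suc k) ! l
      sortedColumn k zero          = sym (lookup∘tabulate (λ k → Frame.A F (suc (τ ⟨$⟩ʳ k)) ! 0F) k)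
      sortedColumn k (suc zero)    = sym (lookup∘tabulate (λ k → Frame.A F (suc (τ ⟨$⟩ʳ k)) ! 1F) k)
      sortedColumn k (suc (suc l)) = trans (sym (pull! lastThree (Frame.A F (suc (τ ⟨$⟩ʳ k))) l)) (cong (_! l) (sorted k))
      eq : ∀ j → Frame.A F₃ j ≡ triangleColumns p q j
      eq zero    = trans (A₃ zero) A0
      eq (suc k) = trans (A₃ (suc k)) (vec-ext (sortedColumn k))

  triangleColumn⇒rankFive : (F : Frame C 5 s) → 5 ≤ s → ∀ j → Frame.A F j ≡ true ∷ true ∷ ⊥ → RankFive C s
  triangleColumn⇒rankFive F 5≤s j Aj
    with ℕ.≤-antisym 5≤s (threeZeros F ¬bad {lastThree} lastThree-injective {j} (cong (pull lastThree) Aj))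
  ... | refl = unsortedTriangle⇒rankFive (permuteFrame Perm.id (swap-0 j) F)
    (trans (permute-A F Perm.id (swap-0 j) 0F)
      (trans (pull-id (λ _ → refl) (Frame.A F (swap-0 j ⟨$⟩ʳ 0F))) (trans (cong (Frame.A F) (swap-0-correct j)) Aj)))

  triangle⇒rankFive : Frame C 5 s → 5 ≤ s → Triangle C → RankFive C s
  triangle⇒rankFive F 5≤s tri =
    let (F′ , i , i′ , j , i≢i′ , Aj) = triangleFrame F simple tri
    in triangleColumn⇒rankFive (permuteFrame (pairRows i i′) Perm.id F′) 5≤s j
         (trans (permute-A F′ (pairRows i i′) Perm.id j)
                (trans (cong (pull (pairRows i i′ ⟨$⟩ʳ_)) Aj) (pairRows-correct i i′ i≢i′)))

-- Rank five without triangles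

fourSum : Vec Bool 5
fourSum = true ∷ true ∷ true ∷ true ∷ false ∷ []

-- `fourSum` closes a 5-circuit with the first four basis elements. Without triangles, another
-- column is neither a sum of at most two basis vectors nor within distance one of `fourSum`. Ten
-- vectors remain, all with last coordinate one: every further point of the hyperplane spanned by
-- the circuit is a sum of two circuit elements.
Lone : Vec Bool 5 → Set
Lone u = 3 ≤ ∣ u ∣ × 2 ≤ ∣ u ⊕ᵥ fourSum ∣

Apart : (u v : Vec Bool 5) → Set
Apart u v = 2 ≤ ∣ u ⊕ᵥ v ∣ × u ⊕ᵥ v ≢ fourSum

lone? : ∀ u → Dec (Lone u)
lone? u = (3 ≤? ∣ u ∣) ×-dec (2 ≤? ∣ u ⊕ᵥ fourSum ∣)

apart? : ∀ u v → Dec (Apart u v)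
apart? u v = (2 ≤? ∣ u ⊕ᵥ v ∣) ×-dec ¬? ((u ⊕ᵥ v) ≟ᵥ fourSum)

-- In the hyperplane spanned by the 5-circuit, the differences of the points
-- off that hyperplane form a star with the given centre.
spikeImage : Fin 5 → Vec (Vec Bool 5) 5
spikeImage c = ⁅ 0F ⁆ ∷ ⁅ 1F ⁆ ∷ ⁅ 2F ⁆ ∷ ⁅ 3F ⁆ ∷ lookup (∁ ⁅ 0F ⁆ ∷ ∁ ⁅ 1F ⁆ ∷ ∁ ⁅ 2F ⁆ ∷ ∁ ⁅ 3F ⁆ ∷ ⁅ 4F ⁆ ∷ []) c ∷ []

abstract
  -- Subtracting the fifth basis vector turns the ten vectors into the sums of two circuit elements,
  -- that is, the edges of a complete graph on five vertices. Disjoint edges sum to the fifth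
  -- circuit element, so `Apart` says that distinct edges meet, and four pairwise meeting edges form
  -- a star. In Z₅ without its tip, the partners of the elements of such a circuit differ in the
  -- same way; the fifth basis element goes to the partner of the centre.
  starFour : ∀ u₀ → Lone u₀ → ∀ u₁ → Lone u₁ → Apart u₀ u₁ →
             ∀ u₂ → Lone u₂ → Apart u₀ u₂ → Apart u₁ u₂ →
             ∀ u₃ → Lone u₃ → Apart u₀ u₃ → Apart u₁ u₃ → Apart u₂ u₃ →
             ∃ λ c → EmbedsBy (lookup (fourSum ∷ u₀ ∷ u₁ ∷ u₂ ∷ u₃ ∷ [])) Z-matrix (spikeImage c)
  starFour = toWitness {a? =
    allSubsets? λ u₀ → lone? u₀ →-dec
    allSubsets? λ u₁ → lone? u₁ →-dec apart? u₀ u₁ →-dec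
    allSubsets? λ u₂ → lone? u₂ →-dec apart? u₀ u₂ →-dec apart? u₁ u₂ →-dec
    allSubsets? λ u₃ → lone? u₃ →-dec apart? u₀ u₃ →-dec apart? u₁ u₃ →-dec apart? u₂ u₃ →-dec
    Fin.any? λ c → embedsBy? (lookup (fourSum ∷ u₀ ∷ u₁ ∷ u₂ ∷ u₃ ∷ [])) Z-matrix (spikeImage c)} _

  -- Pairwise meeting edges on five vertices form a star, with at most four edges, or a triangle.
  noStarFive : ∀ u₀ → Lone u₀ → ∀ u₁ → Lone u₁ → Apart u₀ u₁ →
             ∀ u₂ → Lone u₂ → Apart u₀ u₂ → Apart u₁ u₂ →
             ∀ u₃ → Lone u₃ → Apart u₀ u₃ → Apart u₁ u₃ → Apart u₂ u₃ →
             ∀ u₄ → Lone u₄ → Apart u₀ u₄ → Apart u₁ u₄ → Apart u₂ u₄ → ¬ Apart u₃ u₄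
  noStarFive = toWitness {a? =
    allSubsets? λ u₀ → lone? u₀ →-dec
    allSubsets? λ u₁ → lone? u₁ →-dec apart? u₀ u₁ →-dec
    allSubsets? λ u₂ → lone? u₂ →-dec apart? u₀ u₂ →-dec apart? u₁ u₂ →-dec
    allSubsets? λ u₃ → lone? u₃ →-dec apart? u₀ u₃ →-dec apart? u₁ u₃ →-dec apart? u₂ u₃ →-dec
    allSubsets? λ u₄ → lone? u₄ →-dec apart? u₀ u₄ →-dec apart? u₁ u₄ →-dec apart? u₂ u₄ →-dec ¬? (apart? u₃ u₄)} _

  evenColumn : (u : Vec Bool 5) → ¬ Odd u → u ≢ ⊥ → (∀ i i′ → u ≢ ⁅ i ⁆ ⊕ᵥ ⁅ i′ ⁆) → ∃ λ i → u ≡ ∁ ⁅ i ⁆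
  evenColumn = toWitness {a? = allSubsets? λ u → ¬? (odd? u) →-dec ¬? (u ≟ᵥ ⊥) →-dec
    Fin.all? (λ i → Fin.all? λ i′ → ¬? (u ≟ᵥ (⁅ i ⁆ ⊕ᵥ ⁅ i′ ⁆))) →-dec Fin.any? λ i → u ≟ᵥ ∁ ⁅ i ⁆} _

  heavy₃ : (u : Vec Bool 5) → u ≢ ⊥ → (∀ i → u ≢ ⁅ i ⁆) → (∀ i i′ → u ≢ ⁅ i ⁆ ⊕ᵥ ⁅ i′ ⁆) → 3 ≤ ∣ u ∣
  heavy₃ = toWitness {a? = allSubsets? λ u → ¬? (u ≟ᵥ ⊥) →-dec Fin.all? (λ i → ¬? (u ≟ᵥ ⁅ i ⁆)) →-dec
    Fin.all? (λ i → Fin.all? λ i′ → ¬? (u ≟ᵥ (⁅ i ⁆ ⊕ᵥ ⁅ i′ ⁆))) →-dec (3 ≤? ∣ u ∣)} _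

  heavy₂ : (u : Vec Bool 5) → u ≢ ⊥ → (∀ i → u ≢ ⁅ i ⁆) → 2 ≤ ∣ u ∣
  heavy₂ = toWitness {a? = allSubsets? λ u → ¬? (u ≟ᵥ ⊥) →-dec Fin.all? (λ i → ¬? (u ≟ᵥ ⁅ i ⁆)) →-dec (2 ≤? ∣ u ∣)} _

  swap-4 : Fin 5 → Permutation 5 5
  swap-4 = Perm.transpose 4F

  swap-4-correct : ∀ i → pull (swap-4 i ⟨$⟩ʳ_) (∁ ⁅ i ⁆) ≡ fourSum
  swap-4-correct = toWitness {a? = Fin.all? λ i → pull (swap-4 i ⟨$⟩ʳ_) (∁ ⁅ i ⁆) ≟ᵥ fourSum} _

module _ {C : Code n} (simple : Simple C) (¬triangle : ¬ Triangle C) where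

  module _ (F : Frame C 5 s) where

    open Frame F

    noPair : ∀ j i i′ → A j ≢ ⁅ i ⁆ ⊕ᵥ ⁅ i′ ⁆
    noPair j i i′ eq with i Fin.≟ i′
    ... | yes refl = col≢⊥ F simple (e j) (trans eq (⊕-self ⁅ i ⁆))
    ... | no i≢i′  = ¬triangle (col⇒triangle F (i≢i′ ∘ b-injective)
                       (trans (cong₂ _⊕ᵥ_ (col-b F i) (col-b F i′)) (sym eq)))

    noUnit : ∀ j i → A j ≢ ⁅ i ⁆
    noUnit j i eq = b≢e i j (sym (col-injective F simple (trans eq (sym (col-b F i)))))

    far : ∀ {j k} → j ≢ k → 2 ≤ ∣ A j ⊕ᵥ A k ∣
    far j≢k = heavy₂ _ (λ eq → j≢k (e-injective (col-injective F simple (⊕-zero eq))))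
      (λ i eq → ¬triangle (col⇒triangle F (j≢k ∘ e-injective) (trans eq (sym (col-b F i)))))

    module _ {j₀} (Aj₀ : A j₀ ≡ fourSum) where

      lone : ∀ {j} → j ≢ j₀ → Lone (A j)
      lone {j} j≢ = heavy₃ (A j) (col≢⊥ F simple (e j)) (noUnit j) (noPair j) ,
        subst (λ v → 2 ≤ ∣ A j ⊕ᵥ v ∣) Aj₀ (far j≢)

      apart : ∀ {j k} → j ≢ k → Apart (A j) (A k)
      apart j≢k = far j≢k , λ eq → ¬triangle (col⇒triangle F (j≢k ∘ e-injective) (trans eq (sym Aj₀)))

  atMostFive : (F : Frame C 5 s) → ∀ {j₀} → Frame.A F j₀ ≡ fourSum → s ≤ 5
  atMostFive {s = suc s} F {j₀} Aj₀ = ℕ.≮⇒≥ λ { (s≤s 5≤s) → clash 5≤s }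
    where
    clash : ¬ 5 ≤ s
    clash 5≤s = noStarFive (v 0F) (ln 0F) (v 1F) (ln 1F) (ap {0F} {1F} λ ()) (v 2F) (ln 2F) (ap {0F} {2F} λ ()) (ap {1F} {2F} λ ())
      (v 3F) (ln 3F) (ap {0F} {3F} λ ()) (ap {1F} {3F} λ ()) (ap {2F} {3F} λ ())
      (v 4F) (ln 4F) (ap {0F} {4F} λ ()) (ap {1F} {4F} λ ()) (ap {2F} {4F} λ ()) (ap {3F} {4F} λ ())
      where
      κ : Fin 5 → Fin (suc s)
      κ k = Fin.punchIn j₀ (Fin.inject≤ k 5≤s)
      v : Fin 5 → Vec Bool 5
      v k = Frame.A F (κ k)
      ln : ∀ k → Lone (v k)
      ln k = lone F Aj₀ (Fin.punchInᵢ≢i j₀ _)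
      ap : ∀ {k l} → k ≢ l → Apart (v k) (v l)
      ap {k} {l} k≢l = apart F Aj₀ (λ eq → k≢l (Fin.inject≤-injective 5≤s 5≤s k l (Fin.punchIn-injective j₀ _ _ eq)))

  star⇒rankFive : (F : Frame C 5 5) → Frame.A F 0F ≡ fourSum → RankFive C 5
  star⇒rankFive F A0 = embed′ (starFour (A 1F) (ln 0F) (A 2F) (ln 1F) (ap {0F} {1F} λ ())
    (A 3F) (ln 2F) (ap {0F} {2F} λ ()) (ap {1F} {2F} λ ())
    (A 4F) (ln 3F) (ap {0F} {3F} λ ()) (ap {1F} {3F} λ ()) (ap {2F} {3F} λ ()))
    where
    open Frame F using (A)
    ln : ∀ k → Lone (A (suc k))
    ln k = lone F A0 λ ()
    ap : ∀ {k l} → k ≢ l → Apart (A (suc k)) (A (suc l))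
    ap k≢l = apart F A0 (k≢l ∘ Fin.suc-injective)
    columns : ∀ j → lookup (fourSum ∷ A 1F ∷ A 2F ∷ A 3F ∷ A 4F ∷ []) j ≡ A j
    columns 0F = sym A0
    columns 1F = refl
    columns 2F = refl
    columns 3F = refl
    columns 4F = refl
    embed′ : (∃ λ c → EmbedsBy (lookup (fourSum ∷ A 1F ∷ A 2F ∷ A 3F ∷ A 4F ∷ [])) Z-matrix (spikeImage c)) → RankFive C 5
    embed′ (c , emb) = withinZ ℕ.≤-refl
      (embedsBy⇒⊴ F simple {Z-matrix} {spikeImage c} (EmbedsBy-≗ {W = Z-matrix} {spikeImage c} columns emb))

  fourSum⇒rankFive : (F : Frame C 5 s) → 5 ≤ s → ∀ j → Frame.A F j ≡ fourSum → RankFive C s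
  fourSum⇒rankFive F 5≤s j Aj with ℕ.≤-antisym 5≤s (atMostFive F Aj)
  ... | refl = star⇒rankFive (permuteFrame Perm.id (swap-0 j) F)
    (trans (permute-A F Perm.id (swap-0 j) 0F)
      (trans (pull-id (λ _ → refl) (Frame.A F (swap-0 j ⟨$⟩ʳ 0F))) (trans (cong (Frame.A F) (swap-0-correct j)) Aj)))

  -- An even column is neither zero nor a sum of two basis vectors, so it has weight four and closes
  -- a 5-circuit.
  triangleFree⇒rankFive : (F : Frame C 5 s) → 5 ≤ s → RankFive C s
  triangleFree⇒rankFive F 5≤s with Fin.any? (λ j → ¬? (odd? (Frame.A F j)))
  ... | no ¬even = affine (affine⇒⊴AG F simple λ j → decidable-stable (odd? (Frame.A F j)) (λ ¬odd → ¬even (j , ¬odd)))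
  ... | yes (j , ¬odd) =
    let (i , Aj) = evenColumn (Frame.A F j) ¬odd (col≢⊥ F simple (Frame.e F j)) (noPair F j)
    in fourSum⇒rankFive (permuteFrame (swap-4 i) Perm.id F) 5≤s j
         (trans (permute-A F (swap-4 i) Perm.id j) (trans (cong (pull (swap-4 i ⟨$⟩ʳ_)) Aj) (swap-4-correct i)))

rankFive : {C : Code n} → Frame C 5 s → 5 ≤ s → Simple C → Simple (C ᗮ) → ¬ Bad C → RankFive C s
rankFive {C = C} F 5≤s simple simple* ¬bad with triangle? C
... | yes tri = triangle⇒rankFive simple simple* ¬bad F 5≤s tri
... | no ¬tri = triangleFree⇒rankFive simple ¬tri F 5≤s

-- The maximal matroids are (2,2)-uniform

rowSpace : Vec (Vec Bool n) k → Code n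
rowSpace W = record
  { Mem   = λ f → ∃ λ g → comb g (lookup W) ≡ f
  ; mem?  = λ f → anySubset? λ g → comb g (lookup W) ≟ᵥ f
  ; mem-⊥ = ⊥ , vec-ext λ x → trans (comb! ⊥ (lookup W) x) (trans (∙-⊥ˡ (tabulate λ i → W ! i ! x)) (sym (⊥! x)))
  ; mem-⊕ = λ {f} {f′} (g , eq) (g′ , eq′) → g ⊕ᵥ g′ , vec-ext λ x → trans (comb! (g ⊕ᵥ g′) (lookup W) x)
      (trans (∙-⊕ˡ g g′ (tabulate λ i → W ! i ! x)) (trans (cong₂ _xor_
        (trans (sym (comb! g (lookup W) x)) (cong (_! x) eq)) (trans (sym (comb! g′ (lookup W) x)) (cong (_! x) eq′)))
        (sym (⊕! f f′ x))))
  }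

comb⊥rows : (W : Vec (Vec Bool n) k) (g : Vec Bool k) → rows W ᗮ ∋ comb g (lookup W)
comb⊥rows W g c Wc = trans (∙-comm c (comb g (lookup W))) (trans (comb-∙ g (lookup W) c) (∙-zero g _ Wc))

-- A vector outside the row space is separated from it by some `h` orthogonal to all rows, and such
-- an `h` is a word of `rows W`.
rows-ᗮ : (W : Vec (Vec Bool n) k) → ∀ {f} → rows W ᗮ ∋ f → rowSpace W ∋ f
rows-ᗮ W {f} f⊥ with mem? (rowSpace W) f
... | yes p = p
... | no f∉ with separate (rowSpace W) f f∉
... | h , h⊥ , fh = contradiction (trans (∙-comm f h) (f⊥ h λ i → h⊥ (W ! i) (⁅ i ⁆ , unit i))) (true≢false fh)
  where
  unit : ∀ i → comb ⁅ i ⁆ (lookup W) ≡ W ! i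
  unit i = vec-ext λ x → trans (comb! ⁅ i ⁆ (lookup W) x) (trans (∙-⁅⁆ i _) (lookup∘tabulate (λ i → W ! i ! x) i))

SimpleColumns : Vec (Vec Bool n) k → Set
SimpleColumns W = ∀ x → column W x ≢ ⊥ × (∀ y → x ≢ y → column W x ≢ column W y)

-- Two distinct nonzero functionals are independent over GF(2). With five rows, the elements on
-- which both vanish form a flat of rank at most three.
ThinFlats : Vec (Vec Bool n) k → Set
ThinFlats W = ∀ g → g ≢ ⊥ → ∀ g′ → g′ ≢ ⊥ → g ≢ g′ → ∣ ∁ (comb g (lookup W) ∪ comb g′ (lookup W)) ∣ ≤ 4

simpleColumns? : (W : Vec (Vec Bool n) k) → Dec (SimpleColumns W)
simpleColumns? W = Fin.all? λ x → ¬? (column W x ≟ᵥ ⊥) ×-dec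
  Fin.all? λ y → x ≢? y →-dec ¬? (column W x ≟ᵥ column W y)

thinFlats? : (W : Vec (Vec Bool n) k) → Dec (ThinFlats W)
thinFlats? W = allSubsets? λ g → ¬? (g ≟ᵥ ⊥) →-dec allSubsets? λ g′ → ¬? (g′ ≟ᵥ ⊥) →-dec ¬? (g ≟ᵥ g′) →-dec
  (∣ ∁ (comb g (lookup W) ∪ comb g′ (lookup W)) ∣ ≤? 4)

small⇒≡ : {c : Vec Bool n} → ∣ c ∣ ≤ 2 → c ≢ ⊥ → ∃ λ x → c ≡ ⁅ x ⁆ ⊎ (∃ λ y → x ≢ y × c ≡ ⁅ x ⁆ ⊕ᵥ ⁅ y ⁆)
small⇒≡ {c = c} ≤2 c≢⊥ with ≢⊥⇒∃ c≢⊥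
... | x , cx with (c ⊕ᵥ ⁅ x ⁆) ≟ᵥ ⊥
... | yes eq = x , inj₁ (⊕-zero eq)
... | no neq with ≢⊥⇒∃ neq
... | y , c′y = x , inj₂ (y , x≢y , decidable-stable (c ≟ᵥ (⁅ x ⁆ ⊕ᵥ ⁅ y ⁆)) third)
  where
  x≢y : x ≢ y
  x≢y refl = true≢false c′y (trans (⊕! c ⁅ x ⁆ x) (cong₂ _xor_ cx (∈⇒! (x∈⁅x⁆ x))))
  off : ∀ {z} → z ≢ x → ⁅ x ⁆ ! z ≡ false
  off z≢x = ∉⇒! (z≢x ∘ x∈⁅y⁆⇒x≡y x)
  cy : c ! y ≡ true
  cy = trans (sym (trans (⊕! c ⁅ x ⁆ y) (trans (cong (c ! y xor_) (off (x≢y ∘ sym))) (Bool.xor-identityʳ _)))) c′y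
  third : ¬ c ≢ ⁅ x ⁆ ⊕ᵥ ⁅ y ⁆
  third c≢ with ≢⊥⇒∃ (c≢ ∘ ⊕-zero)
  ... | z , wz = ℕ.<⇒≱ (ℕ.<-≤-trans
          (ℕ.≤-trans (s≤s (ℕ.≤-trans (s≤s (ℕ.≤-trans (s≤s z≤n) (x∈p⇒∣p-x∣<∣p∣ z∈)))
            (x∈p⇒∣p-x∣<∣p∣ y∈))) (x∈p⇒∣p-x∣<∣p∣ (!⇒∈ {c = c} cx))) ≤2) ℕ.≤-refl
    where
    w = ⁅ x ⁆ ⊕ᵥ ⁅ y ⁆
    z≢x : z ≢ x
    z≢x refl = true≢false wz (trans (⊕! c w x) (cong₂ _xor_ cx
      (trans (⊕! ⁅ x ⁆ ⁅ y ⁆ x) (cong₂ _xor_ (∈⇒! (x∈⁅x⁆ x)) (∉⇒! (x≢y ∘ x∈⁅y⁆⇒x≡y y))))))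
    z≢y : z ≢ y
    z≢y refl = true≢false wz (trans (⊕! c w y) (cong₂ _xor_ cy
      (trans (⊕! ⁅ x ⁆ ⁅ y ⁆ y) (cong₂ _xor_ (off (x≢y ∘ sym)) (∈⇒! (x∈⁅x⁆ y))))))
    cz : c ! z ≡ true
    cz = trans (sym (trans (⊕! c w z) (trans (cong (c ! z xor_)
      (trans (⊕! ⁅ x ⁆ ⁅ y ⁆ z) (cong₂ _xor_ (off z≢x) (∉⇒! (z≢y ∘ x∈⁅y⁆⇒x≡y y))))) (Bool.xor-identityʳ _)))) wz
    y∈ : y ∈ c - x
    y∈ = x∈p∧x≢y⇒x∈p-y (!⇒∈ cy) (x≢y ∘ sym)
    z∈ : z ∈ c - x - y
    z∈ = x∈p∧x≢y⇒x∈p-y (x∈p∧x≢y⇒x∈p-y (!⇒∈ cz) z≢x) z≢y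

simpleColumns⇒simple : (W : Vec (Vec Bool n) k) → SimpleColumns W → Simple (rows W)
simpleColumns⇒simple W sc c Wc c≢⊥ = ℕ.≰⇒> λ ≤2 → at (small⇒≡ ≤2 c≢⊥) refl
  where
  unit : ∀ i x → W ! i ∙ ⁅ x ⁆ ≡ column W x ! i
  unit i x = trans (∙-comm (W ! i) ⁅ x ⁆) (trans (∙-⁅⁆ x (W ! i)) (sym (lookup∘tabulate (λ i → W ! i ! x) i)))
  at : (∃ λ x → c ≡ ⁅ x ⁆ ⊎ (∃ λ y → x ≢ y × c ≡ ⁅ x ⁆ ⊕ᵥ ⁅ y ⁆)) → ¬ c ≡ c
  at (x , inj₁ refl) _ = proj₁ (sc x) (vec-ext λ i → trans (sym (unit i x)) (trans (Wc i) (sym (⊥! i))))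
  at (x , inj₂ (y , x≢y , refl)) _ = proj₂ (sc x) y x≢y (vec-ext λ i → xor-≡
    (trans (sym (cong₂ _xor_ (unit i x) (unit i y))) (trans (sym (∙-⊕ʳ (W ! i) ⁅ x ⁆ ⁅ y ⁆)) (Wc i))))

-- Every element of the union lies in exactly two of the three sets.
∣a∣+∣b∣+∣a⊕b∣ : (a b : Subset n) → ∣ a ∣ + ∣ b ∣ + ∣ a ⊕ᵥ b ∣ ≡ ∣ a ∪ b ∣ + ∣ a ∪ b ∣
∣a∣+∣b∣+∣a⊕b∣ []          []          = refl
∣a∣+∣b∣+∣a⊕b∣ (false ∷ a) (false ∷ b) = ∣a∣+∣b∣+∣a⊕b∣ a b
∣a∣+∣b∣+∣a⊕b∣ (true ∷ a)  (true ∷ b)  = cong suc (trans (cong (_+ ∣ a ⊕ᵥ b ∣) (ℕ.+-suc ∣ a ∣ ∣ b ∣))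
  (trans (cong suc (∣a∣+∣b∣+∣a⊕b∣ a b)) (sym (ℕ.+-suc _ _))))
∣a∣+∣b∣+∣a⊕b∣ (true ∷ a)  (false ∷ b) = cong suc (trans (ℕ.+-suc _ _)
  (trans (cong suc (∣a∣+∣b∣+∣a⊕b∣ a b)) (sym (ℕ.+-suc _ _))))
∣a∣+∣b∣+∣a⊕b∣ (false ∷ a) (true ∷ b)  = trans (cong (_+ suc ∣ a ⊕ᵥ b ∣) (ℕ.+-suc ∣ a ∣ ∣ b ∣))
  (cong suc (trans (ℕ.+-suc _ _) (trans (cong suc (∣a∣+∣b∣+∣a⊕b∣ a b)) (sym (ℕ.+-suc _ _)))))

-- Three nonzero codewords of weight at least three, summing to zero, cannot
-- be supported on four elements.
thinFlats⇒¬bad : (W : Vec (Vec Bool n) k) → SimpleColumns W → ThinFlats W → ¬ Bad (rows W)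
thinFlats⇒¬bad W sc thin (P , Q , off) = at (rows-ᗮ W Q.a∈) (rows-ᗮ W Q.b∈)
  where
  module P = Plane P
  module Q = Plane Q
  simple = simpleColumns⇒simple W sc
  nine : 9 ≤ ∣ P.a ∣ + ∣ P.b ∣ + ∣ P.a ⊕ᵥ P.b ∣
  nine = ℕ.+-mono-≤ (ℕ.+-mono-≤ (simple P.a P.a∈ (∃⇒≢⊥ P.p P.a!p)) (simple P.b P.b∈ (∃⇒≢⊥ P.q P.b!q)))
    (simple (P.a ⊕ᵥ P.b) (mem-⊕ (rows W) P.a∈ P.b∈) (∃⇒≢⊥ P.p (trans (⊕! P.a P.b P.p) (cong₂ _xor_ P.a!p P.b!p))))
  comb-⊥ : ∀ x → comb ⊥ (lookup W) ! x ≡ false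
  comb-⊥ x = trans (comb! ⊥ (lookup W) x) (∙-⊥ˡ (tabulate λ i → W ! i ! x))
  at : rowSpace W ∋ Q.a → rowSpace W ∋ Q.b → _
  at (g , ga) (g′ , g′b) = ℕ.<⇒≱ nine (ℕ.≤-trans (ℕ.≤-reflexive (∣a∣+∣b∣+∣a⊕b∣ P.a P.b)) (ℕ.+-mono-≤ support≤4 support≤4))
    where
    g≢⊥ : g ≢ ⊥
    g≢⊥ refl = true≢false (trans (cong (_! Q.p) ga) Q.a!p) (comb-⊥ Q.p)
    g′≢⊥ : g′ ≢ ⊥
    g′≢⊥ refl = true≢false (trans (cong (_! Q.q) g′b) Q.b!q) (comb-⊥ Q.q)
    g≢g′ : g ≢ g′
    g≢g′ refl = true≢false Q.a!p (trans (cong (_! Q.p) (trans (sym ga) g′b)) Q.b!p)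
    sub : P.a ∪ P.b ⊆ ∁ (comb g (lookup W) ∪ comb g′ (lookup W))
    sub {x} x∈ = x∉p⇒x∈∁p λ x∈Q → clash (off x) (x∈p∪q⁻ P.a P.b x∈) (x∈p∪q⁻ (comb g (lookup W)) (comb g′ (lookup W)) x∈Q)
      where
      clash : Off P x ⊎ Off Q x → x ∈ P.a ⊎ x ∈ P.b → ¬ (x ∈ comb g (lookup W) ⊎ x ∈ comb g′ (lookup W))
      clash (inj₁ (ax , _)) (inj₁ x∈) _ = !⇒∉ ax x∈
      clash (inj₁ (_ , bx)) (inj₂ x∈) _ = !⇒∉ bx x∈
      clash (inj₂ (ax , _)) _ (inj₁ x∈) = !⇒∉ (trans (cong (_! x) ga) ax) x∈
      clash (inj₂ (_ , bx)) _ (inj₂ x∈) = !⇒∉ (trans (cong (_! x) g′b) bx) x∈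
    support≤4 : ∣ P.a ∪ P.b ∣ ≤ 4
    support≤4 = ℕ.≤-trans (p⊆q⇒∣p∣≤∣q∣ {p = P.a ∪ P.b} {∁ (comb g (lookup W) ∪ comb g′ (lookup W))}
      (λ {x} → sub {x})) (thin g g≢⊥ g′ g′≢⊥ g≢g′)

abstract
  ¬bad-P₁₀ : ¬ Bad (rows P₁₀-matrix)
  ¬bad-P₁₀ = thinFlats⇒¬bad P₁₀-matrix (toWitness {a? = simpleColumns? P₁₀-matrix} _) (toWitness {a? = thinFlats? P₁₀-matrix} _)

  ¬bad-Z : ¬ Bad (rows Z-matrix)
  ¬bad-Z = thinFlats⇒¬bad Z-matrix (toWitness {a? = simpleColumns? Z-matrix} _) (toWitness {a? = thinFlats? Z-matrix} _)

  ¬bad-AG : ¬ Bad (rows AG-matrix)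
  ¬bad-AG = thinFlats⇒¬bad AG-matrix (toWitness {a? = simpleColumns? AG-matrix} _) (toWitness {a? = thinFlats? AG-matrix} _)

-- Codes of the maximal matroids and their minors

shorten-rows : (p : Subset n) (W : Vec (Vec Bool n) k) → shorten p (rows W) ≐ rows (Vec.map (pull (embed p)) W)
shorten-rows p W {c} = (λ h i → trans (sym (eq i)) (h i)) , (λ h i → trans (eq i) (h i))
  where
  expand≡push : expand p c ≡ push (embed p) c
  expand≡push = trans (sym (supported⇒push (embed-injective p) {expand p c}
                        λ {x} e → inj₂ (embed-surjective p (expand-⊆ p c (!⇒∈ {c = expand p c} e)))))
                      (cong (push (embed p)) (pull-expand p c))
  eq : ∀ i → W ! i ∙ expand p c ≡ Vec.map (pull (embed p)) W ! i ∙ c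
  eq i = trans (cong (W ! i ∙_) expand≡push) (trans (∙-comm (W ! i) (push (embed p) c))
    (trans (push-∙ (embed p) c (W ! i)) (trans (∙-comm c (pull (embed p) (W ! i)))
      (cong (_∙ c) (sym (lookup-map i (pull (embed p)) W))))))

rep-vectorMatroid-＼ : (W : Matrix₂ r n) (D : Subset n) →
                       Rep (vectorMatroid W ＼ D) (rows (Vec.map (pull (embed (∁ D))) W))
rep-vectorMatroid-＼ W D = Rep-≐ {M = vectorMatroid W ＼ D} {shorten (∁ D) (rows W)} {rows (Vec.map (pull (embed (∁ D))) W)}
  (shorten-rows (∁ D) W) (rep-＼ {M = vectorMatroid W} {rows W} D (rep-vectorMatroid W))

rep-Z : Rep (Z 5 ＼ ⁅ tip 5 ⁆) (rows Z-matrix)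
rep-Z = rep-vectorMatroid-＼ (spikeMatrix 5) ⁅ tip 5 ⁆

rep-P₁₀ : Rep P₁₀ (rows P₁₀-matrix)
rep-P₁₀ = rep-vectorMatroid P₁₀-matrix

rep-AG : Rep AG[ 4 ,2] (rows AG-matrix)
rep-AG = rep-vectorMatroid AG-matrix

frame⇒binary : {M : RawMatroid n} {C : Code n} → Rep M C → Frame C r s → Binary M
frame⇒binary {r = r} {M = M} {C} R F = r , D , Perm.id , λ Y → mk⇔ (to Y) (from Y)
  where
  open Frame F
  D : Matrix₂ r _
  D = tabulate d
  C≐D : C ≐ rows D
  C≐D {c} = (λ Cc i → trans (cong (_∙ c) (lookup∘tabulate d i)) (d-sound Cc i)) ,
            (λ Dc → d-complete λ i → trans (cong (_∙ c) (sym (lookup∘tabulate d i))) (Dc i))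
  R′ : Rep M (rows D)
  R′ = Rep-≐ {M = M} {C} {rows D} C≐D R
  to : ∀ Y → Indep M (tabulate (lookup Y)) → Indep (vectorMatroid D) Y
  to Y indep = Equivalence.from (rep-vectorMatroid D Y)
    (Equivalence.to (R′ Y) (subst (Indep M) (tabulate∘lookup Y) indep))
  from : ∀ Y → Indep (vectorMatroid D) Y → Indep M (tabulate (lookup Y))
  from Y indep = subst (Indep M) (sym (tabulate∘lookup Y))
    (Equivalence.from (R′ Y) (Equivalence.to (rep-vectorMatroid D Y) indep))

rep⇒binary : {M : RawMatroid n} {C : Code n} → Rep M C → Binary M
rep⇒binary {M = M} {C} R = let (_ , _ , F) = frame C in frame⇒binary {M = M} {C} R F

minor⇒binary×uniform : {M : RawMatroid m} {N : RawMatroid n} {C : Code n} →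
                       Rep N C → ¬ Bad C → M ≼ N → Binary M × IsUniform 2 2 M
minor⇒binary×uniform {M = M} {N} {C} R ¬bad M≼N = back (≼⇒Minor {M = M} {N} {C} M≼N R)
  where
  back : (∃ λ C′ → Rep M C′ × ∃ λ ι → ∃₂ λ X Y → Split ι X Y × Minor C′ C ι X) → Binary M × IsUniform 2 2 M
  back (C′ , R′ , ι , X , Y , S , Mi) = rep⇒binary {M = M} {C′} R′ , λ U≼M →
    let (C″ , R″ , _ , _ , _ , S′ , Mi′) = ≼⇒Minor {M = U₂₂⊕U₀₂} {M} {C′} U≼M R′
    in ¬bad (bad-lift S Mi (bad-lift S′ Mi′ (U⇒bad {C″} R″)))

-- At most three elements

-- Words that `NoLight` tolerates although they have weight at most two, because they cover more
-- than half of the elements; this forces at most three elements.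
Half : Subset n → Set
Half c = ∣ ∁ c ∣ < ∣ c ∣ × ∣ c ∣ ≤ 2

half? : (c : Subset n) → Dec (Half c)
half? c = (∣ ∁ c ∣ <? ∣ c ∣) ×-dec (∣ c ∣ ≤? 2)

simple? : (C : Code n) → Dec (Simple C)
simple? C = allSubsets? λ c → mem? C c →-dec ¬? (c ≟ᵥ ⊥) →-dec (2 <? ∣ c ∣)

notSimple : {C : Code n} → NoLight C → ¬ Simple C → ∃ λ c → C ∋ c × c ≢ ⊥ × Half c
notSimple {C = C} noLight ¬simple with anySubset? (λ c → mem? C c ×-dec ¬? (c ≟ᵥ ⊥) ×-dec half? c)
... | yes w = w
... | no ¬w = contradiction (λ c Cc c≢⊥ → ℕ.≰⇒> λ ≤2 →
    ¬w (c , Cc , c≢⊥ , ℕ.≰⇒> (λ le → ℕ.<⇒≱ (noLight Cc c≢⊥ le) ≤2) , ≤2)) ¬simple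

abstract
  half₁ : (c d : Vec Bool 1) → Half c → Half d → c ∙ d ≡ true
  half₁ = toWitness {a? = allSubsets? λ c → allSubsets? λ d → half? c →-dec half? d →-dec (c ∙ d Bool.≟ true)} _

  half₂ : (c : Vec Bool 2) → Half c → c ≡ ⊤
  half₂ = toWitness {a? = allSubsets? λ c → half? c →-dec c ≟ᵥ ⊤} _

  -- Two orthogonal pairs out of three elements coincide; `x` is the third element. As `f` meets the
  -- pair evenly, it contains the whole pair or none of it.
  half₃ : (c d : Vec Bool 3) → Half c → Half d → c ∙ d ≡ false →
          ∃ λ x → ∀ f → f ! x ≡ true → c ∙ f ≡ false → f ≡ ⁅ x ⁆ ⊎ d ⊕ᵥ f ≡ ⁅ x ⁆
  half₃ = toWitness {a? = allSubsets? λ c → allSubsets? λ d → half? c →-dec half? d →-dec (c ∙ d Bool.≟ false) →-dec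
    Fin.any? λ x → allSubsets? λ f → (f ! x Bool.≟ true) →-dec (c ∙ f Bool.≟ false) →-dec
    (f ≟ᵥ ⁅ x ⁆ ⊎-dec (d ⊕ᵥ f) ≟ᵥ ⁅ x ⁆)} _

  even₂ : (c : Vec Bool 2) → ⊤ ∙ c ≡ false → c ≡ ⊥ ⊎ c ≡ ⊤
  even₂ = toWitness {a? = allSubsets? λ c → (⊤ ∙ c Bool.≟ false) →-dec (c ≟ᵥ ⊥ ⊎-dec c ≟ᵥ ⊤)} _

singletonLight : {C : Code 3} → NoLight C → ∀ x → ¬ C ∋ ⁅ x ⁆
singletonLight noLight x x∈ = ℕ.<⇒≱ (noLight x∈ (∃⇒≢⊥ x (∈⇒! (x∈⁅x⁆ x))) (le x)) (ℕ.≤-trans (ℕ.≤-reflexive (∣⁅x⁆∣≡1 x)) (s≤s z≤n))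
  where
  le : ∀ (x : Fin 3) → ∣ ⁅ x ⁆ ∣ ≤ ∣ ∁ ⁅ x ⁆ ∣
  le 0F = s≤s z≤n
  le 1F = s≤s z≤n
  le 2F = s≤s z≤n

-- U₁,₂ is obtained from a plane of AG(4,2) by contracting two of its points.
parallelPair : Fin 2 → Fin (2 ^ 4)
parallelPair = lookup (0F ∷ 1F ∷ [])

contracted : Subset (2 ^ 4)
contracted = ⁅ 2F ⁆ ∪ ⁅ 3F ⁆

abstract
  -- Row 0 is constantly one, and row 3 is zero on the elements 0 and 1 and one on 2 and 3. Their
  -- sum therefore picks out the kept pair.
  separator : ∀ x → x ∈ contracted ⊎ Image parallelPair x →
              comb (⁅ 0F ⁆ ⊕ᵥ ⁅ 3F ⁆) (lookup AG-matrix) ! x ≡ push parallelPair ⊤ ! x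
  separator = toWitness {a? = Fin.all? λ x → ((x ∈? contracted) ⊎-dec Fin.any? λ i → parallelPair i Fin.≟ x) →-dec
    (comb (⁅ 0F ⁆ ⊕ᵥ ⁅ 3F ⁆) (lookup AG-matrix) ! x Bool.≟ push parallelPair ⊤ ! x)} _

  plane∈AG : rows AG-matrix ∋ contracted ∪ push parallelPair ⊤
  plane∈AG = toWitness {a? = mem? (rows AG-matrix) (contracted ∪ push parallelPair ⊤)} _

  plane-pull : pull parallelPair (contracted ∪ push parallelPair ⊤) ≡ ⊤
  plane-pull = refl

  parallel-∉ : ∀ i → parallelPair i ∉ contracted
  parallel-∉ = toWitness {a? = Fin.all? λ i → ¬? (parallelPair i ∈? contracted)} _

parallel⊴AG : rows (⊤ {2} ∷ []) ⊴ rows AG-matrix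
parallel⊴AG = parallelPair , contracted , proj₁ split , proj₂ split ,
  record { lift = λ {c} h → lift′ c (even₂ c (h 0F)) ; proj = proj′ }
  where
  ι = parallelPair
  split = splitOff {ι = ι} {contracted} (λ {x} {y} → distinct₂ {a = 0F} {1F} (λ ()) {x} {y}) parallel-∉
  lift′ : ∀ c → c ≡ ⊥ ⊎ c ≡ ⊤ → ∃ λ c̃ → rows AG-matrix ∋ c̃ × pull ι c̃ ≡ c × Supported ι contracted c̃
  lift′ _ (inj₁ refl) = ⊥ , mem-⊥ (rows AG-matrix) , pull-⊥ ι , λ {x} e → contradiction (⊥! x) (true≢false e)
  lift′ _ (inj₂ refl) = contracted ∪ push ι ⊤ , plane∈AG , plane-pull , λ e →
    [ inj₁ , (λ x∈ → inj₂ (push-supp ι ⊤ (∈⇒! x∈))) ]′ (x∈p∪q⁻ contracted (push ι ⊤) (!⇒∈ e))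
  proj′ : ∀ {c̃} → rows AG-matrix ∋ c̃ → Supported ι contracted c̃ → rows (⊤ {2} ∷ []) ∋ pull ι c̃
  proj′ {c̃} h supp 0F = trans (sym (push-∙ ι ⊤ c̃)) (trans
    (sym (∙-congˡ {c = comb (⁅ 0F ⁆ ⊕ᵥ ⁅ 3F ⁆) (lookup AG-matrix)} {push ι ⊤} {c̃} λ x e → separator x (supp e)))
    (trans (∙-comm (comb (⁅ 0F ⁆ ⊕ᵥ ⁅ 3F ⁆) (lookup AG-matrix)) c̃) (comb⊥rows AG-matrix (⁅ 0F ⁆ ⊕ᵥ ⁅ 3F ⁆) c̃ h)))

-- The classification

data Classified (C : Code n) : Set where
  affine   : C ⊴ rows AG-matrix → Classified C
  coaffine : C ᗮ ⊴ rows AG-matrix → Classified C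
  withinP₁₀ : C ⊴ rows P₁₀-matrix → Classified C
  withinZ    : C ⊴ rows Z-matrix → Classified C

-- On one element the two words would meet just once, and on three elements `half₃` produces a dual
-- word of weight one. Only U₁,₂ is left.
bothLight : (C : Code n) → NoLight C → NoLight (C ᗮ) → n ≤ 3 →
            (∃ λ c → C ∋ c × c ≢ ⊥ × Half c) → (∃ λ d → C ᗮ ∋ d × d ≢ ⊥ × Half d) → Classified C
bothLight {0} _ _ _ _ ([] , _ , []≢ , _) _ = contradiction refl []≢
bothLight {1} _ _ _ _ (c , Cc , _ , hc) (d , d⊥ , _ , hd) = contradiction (d⊥ c Cc) (true≢false (half₁ c d hc hd))
bothLight {2} C _ _ _ (c , Cc , _ , hc) (d , d⊥ , _ , hd) with half₂ c hc | half₂ d hd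
... | refl | refl = affine (≐-⊴ (λ {c} → from c , to c) parallel⊴AG)
  where
  to : ∀ c → C ∋ c → rows (⊤ ∷ []) ∋ c
  to c Cc 0F = trans (∙-comm ⊤ c) (d⊥ c Cc)
  from : ∀ c → rows (⊤ ∷ []) ∋ c → C ∋ c
  from c h with even₂ c (h 0F)
  ... | inj₁ refl = mem-⊥ C
  ... | inj₂ refl = Cc
bothLight {3} C noLight noLight* _ (c , Cc , _ , hc) (d , d⊥ , _ , hd) = at (half₃ c d hc hd (d⊥ c Cc))
  where
  at : (∃ λ x → ∀ f → f ! x ≡ true → c ∙ f ≡ false → f ≡ ⁅ x ⁆ ⊎ d ⊕ᵥ f ≡ ⁅ x ⁆) → Classified C
  at (x , h) with separate C ⁅ x ⁆ (singletonLight {C} noLight x)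
  ... | f , f⊥ , xf with h f (trans (sym (∙-⁅⁆ x f)) xf) (f⊥ c Cc)
  ... | inj₁ refl = contradiction f⊥ (singletonLight {C ᗮ} noLight* x)
  ... | inj₂ eq   = contradiction (subst (C ᗮ ∋_) eq (mem-⊕ (C ᗮ) d⊥ f⊥)) (singletonLight {C ᗮ} noLight* x)
bothLight {suc (suc (suc (suc _)))} _ _ _ (s≤s (s≤s (s≤s ())))

noLight⇒simple : {C : Code n} → 4 ≤ n → NoLight C → Simple C
noLight⇒simple {n} 4≤n noLight c Cc c≢⊥ = ℕ.≰⇒> λ ≤2 → ℕ.<⇒≱ (noLight Cc c≢⊥ (ℕ.≤-trans ≤2 (∁-large ≤2))) ≤2
  where
  ∁-large : ∣ c ∣ ≤ 2 → 2 ≤ ∣ ∁ c ∣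
  ∁-large ≤2 = subst (2 ≤_) (sym (∣∁p∣≡n∸∣p∣ c)) (ℕ.≤-trans (ℕ.∸-monoˡ-≤ 2 4≤n) (ℕ.∸-monoʳ-≤ n ≤2))

-- Rank and corank are at most three here, so simplicity of the code or of its dual is enough for an
-- embedding.
classifySmall : (C : Code n) → Frame C r s → NoLight C → NoLight (C ᗮ) → n ≤ 3 → Classified C
classifySmall {n} {r} {s} C F noLight noLight* n≤3 with simple? C | simple? (C ᗮ)
... | yes simple | _           = affine (rank≤4⇒⊴AG F simple (ℕ.≤-trans (Fin.injective⇒≤ b-injective) n≤4))
  where
  open Frame F
  n≤4 = ℕ.≤-trans n≤3 (ℕ.n≤1+n 3)
... | no _       | yes simple* = coaffine (rank≤4⇒⊴AG (dualFrame F) simple* (ℕ.≤-trans (Fin.injective⇒≤ e-injective) n≤4))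
  where
  open Frame F
  n≤4 = ℕ.≤-trans n≤3 (ℕ.n≤1+n 3)
... | no ¬simple | no ¬simple* = bothLight C noLight noLight* n≤3
      (notSimple {C = C} noLight ¬simple) (notSimple {C = C ᗮ} noLight* ¬simple*)

classifyLarge : (C : Code n) → Frame C r s → Simple C → Simple (C ᗮ) → ¬ Bad C → Classified C
classifyLarge {r = r} {s} C F simple simple* ¬bad with r ≤? 4 | s ≤? 4
... | yes r≤4 | _       = affine (rank≤4⇒⊴AG F simple r≤4)
... | no _    | yes s≤4 = coaffine (rank≤4⇒⊴AG (dualFrame F) simple* s≤4)
... | no r≰4  | no s≰4  = large (r ≤? 5) F (ℕ.≰⇒> r≰4) (ℕ.≰⇒> s≰4)
  where
  primal : {s : ℕ} → RankFive C s → Classified C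
  primal (affine p)     = affine p
  primal (coaffine p)   = coaffine p
  primal (withinP₁₀ _ p) = withinP₁₀ p
  primal (withinZ _ p)    = withinZ p
  dual : {r : ℕ} → 6 ≤ r → RankFive (C ᗮ) r → Classified C
  dual _   (affine p)       = coaffine p
  dual _   (coaffine p)     = affine (≐-⊴ (ᗮᗮ C) p)
  dual 6≤r (withinP₁₀ r≤5 _) = contradiction r≤5 (ℕ.<⇒≱ 6≤r)
  dual 6≤r (withinZ r≤5 _)    = contradiction r≤5 (ℕ.<⇒≱ 6≤r)
  large : {r s : ℕ} → Dec (r ≤ 5) → Frame C r s → 5 ≤ r → 5 ≤ s → Classified C
  large (yes r≤5) F 5≤r 5≤s with ℕ.≤-antisym 5≤r r≤5
  ... | refl = primal (rankFive F 5≤s simple simple* ¬bad)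
  large {r} {s} (no r≰5) F 5≤r 5≤s with s ≤? 5
  ... | no s≰5 = contradiction (ℕ.≰⇒> s≰5) (¬rank,corank≥6 F ¬bad (ℕ.≰⇒> r≰5))
  ... | yes s≤5 with ℕ.≤-antisym 5≤s s≤5
  ... | refl = dual (ℕ.≰⇒> r≰5) (rankFive (dualFrame F) 5≤r simple* (λ c Cc → simple c (ᗮᗮ⁻ C Cc)) (¬bad ∘ bad-ᗮ))

classify : (C : Code n) → NoLight C → NoLight (C ᗮ) → ¬ Bad C → Classified C
classify {n} C noLight noLight* ¬bad with frame C | n ≤? 3
... | _ , _ , F | yes n≤3 = classifySmall C F noLight noLight* n≤3
... | _ , _ , F | no n≰3  = classifyLarge C F (noLight⇒simple {C = C} (ℕ.≰⇒> n≰3) noLight)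
                              (noLight⇒simple {C = C ᗮ} (ℕ.≰⇒> n≰3) noLight*) ¬bad

⊴⇒≼ : {M : RawMatroid m} {N : RawMatroid n} {C′ : Code m} {C : Code n} → Rep M C′ → Rep N C → C′ ⊴ C → M ≼ N
⊴⇒≼ {M = M} {N} {C′} {C} R′ R (ι , X , Y , S , Mi) = Minor⇒≼ {M = M} {N} {C′} {C} R′ R S Mi

ExceptionalMinor : RawMatroid n → Set
ExceptionalMinor M = M ≼ Z 5 ＼ ⁅ tip 5 ⁆ ⊎ M ≼ P₁₀ ⊎ M ≼ AG[ 4 ,2] ⊎ M ≼ AG[ 4 ,2] *

classified⇒minor : {M : RawMatroid n} {C : Code n} → Rep M C → Classified C → ExceptionalMinor M
classified⇒minor {M = M} {C} R (affine p) = inj₂ (inj₂ (inj₁ (⊴⇒≼ {M = M} {AG[ 4 ,2]} {C} {rows AG-matrix} R rep-AG p)))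
classified⇒minor {M = M} {C} R (coaffine p) = inj₂ (inj₂ (inj₂ (⊴⇒≼ {M = M} {AG[ 4 ,2] *} {C} {rows AG-matrix ᗮ} R
  (rep-* {M = AG[ 4 ,2]} {rows AG-matrix} rep-AG) (≐-⊴ (ᗮᗮ C) (⊴-ᗮ p)))))
classified⇒minor {M = M} {C} R (withinP₁₀ p) = inj₂ (inj₁ (⊴⇒≼ {M = M} {P₁₀} {C} {rows P₁₀-matrix} R rep-P₁₀ p))
classified⇒minor {M = M} {C} R (withinZ p) = inj₁ (⊴⇒≼ {M = M} {Z 5 ＼ ⁅ tip 5 ⁆} {C} {rows Z-matrix} R rep-Z p)

exceptionalMinor⇒binary×uniform : {M : RawMatroid n} → ExceptionalMinor M → Binary M × IsUniform 2 2 M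
exceptionalMinor⇒binary×uniform {M = M} = [ minor⇒binary×uniform {M = M} {Z 5 ＼ ⁅ tip 5 ⁆} {rows Z-matrix} rep-Z ¬bad-Z ,
  [ minor⇒binary×uniform {M = M} {P₁₀} {rows P₁₀-matrix} rep-P₁₀ ¬bad-P₁₀ ,
  [ minor⇒binary×uniform {M = M} {AG[ 4 ,2]} {rows AG-matrix} rep-AG ¬bad-AG ,
    minor⇒binary×uniform {M = M} {AG[ 4 ,2] *} {rows AG-matrix ᗮ}
      (rep-* {M = AG[ 4 ,2]} {rows AG-matrix} rep-AG) (¬bad-AG ∘ bad-ᗮ) ]′ ]′ ]′

uniform⇒minor : {M : RawMatroid n} → IsMatroid M → IsConnected 3 M → Binary M → IsUniform 2 2 M → ExceptionalMinor M
uniform⇒minor {M = M} isM con (r , A , iso) uniform =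
  classified⇒minor {M = M} {C} R (classify C (proj₁ noLight) (proj₂ noLight) (uniform ∘ bad⇒U {M = M} {C} R))
  where
  C = relabel (proj₁ iso) (rows A)
  R : Rep M C
  R = rep-≅ {M = M} {vectorMatroid A} {rows A} iso (rep-vectorMatroid A)
  noLight = connected⇒noLight {M = M} isM {C} R con

theorem1p3 : (n : ℕ) (𝓜 : Matroid n) → let M = Matroid.raw 𝓜 in
    (IsConnected 3 M × Binary M × IsUniform 2 2 M)
    ⇔ (IsConnected 3 M × (M ≼ Z 5 ＼ ⁅ tip 5 ⁆ ⊎ M ≼ P₁₀ ⊎ M ≼ AG[ 4 ,2] ⊎ M ≼ AG[ 4 ,2] *))
theorem1p3 n 𝓜 = mk⇔
  (λ (con , binary , uniform) → con , uniform⇒minor {M = raw} isMatroid con binary uniform)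
  (λ (con , targets) → con , exceptionalMinor⇒binary×uniform {M = raw} targets)
  where open Matroid 𝓜
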